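{- Suppose that $\lambda=\lambda^{<\lambda}\ge\aleph_2$ is a regular cardinal, $1<\kappa\le\lambda$, and $\mathrm{Refl}^*({<}\kappa,S^\lambda_\omega)$ holds. Then there is a cofinality-preserving forcing extension in which $\mathrm{Refl}({<}\kappa,S^\lambda_\omega)$ holds and $\mathsf{uDSR}(1,S^\lambda_\omega)$ fails.
   Context: $S^\lambda_\omega$ is the set of limit ordinals below $\lambda$ of cofinality $\omega$. A set $T$ of ordinals reflects at $\gamma$ if $\mathrm{cf}(\gamma)>\omega$ and $T\cap\gamma$ is stationary in $\gamma$. For $S\subseteq\lambda$ stationary and $1<\kappa\le\lambda$, $\mathrm{Refl}({<}\kappa,S)$ asserts that every family of fewer than $\kappa$ stationary subsets of $S$ reflects simultaneously, i.e., there is $\gamma<\lambda$ at which every member of the family reflects. $\mathrm{Refl}^*({<}\kappa,S)$ asserts that whenever $\mathbb{P}$ is a $\lambda$-directed closed forcing with $|\mathbb{P}|\le\lambda$, $\Vdash_{\mathbb{P}}\mathrm{Refl}({<}\kappa,S)$. $\mathsf{uDSR}(1,S)$ asserts: for every sequence $\langle S_\alpha\mid\alpha<\lambda\rangle$ of stationary subsets of $S$, there are $\gamma<\lambda$ of uncountable cofinality and an unbounded $F\subseteq\gamma$ such that $S_\alpha$ reflects at $\gamma$ for all $\alpha\in F$. -}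

module Defs where

open import Level using (Lift; 0ℓ) renaming (suc to lsuc)
open import Data.Empty.Polymorphic using (⊥)
open import Data.Product using (Σ-syntax; _×_; _,_; proj₁; proj₂)
open import Data.Sum using (_⊎_)
open import Function.Bundles using (Injection)
open import Relation.Binary.Bundles using (Setoid; Preorder)
open import Relation.Binary.Construct.On as On using ()
open import Relation.Binary.Definitions using (Maximum)
open import Relation.Unary using (Pred)

infix 4 _≋_ _∊_

------------------------------------------------------------------------
-- The ground model: Aczel's cumulative hierarchy over the universe Set.
-- Excluded middle and function extensionality, which are to be assumed
-- separately, make it a model of ZFC.

data V : Set₁ where
  sup : (A : Set) → (A → V) → V

_≋_ : V → V → Set
sup A f ≋ sup B g =
  (∀ a → Σ[ b ∈ B ] f a ≋ g b) × (∀ b → Σ[ a ∈ A ] f a ≋ g b)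

_∊_ : V → V → Set
x ∊ sup B g = Σ[ b ∈ B ] x ≋ g b

≋-refl : ∀ x → x ≋ x
≋-refl (sup A f) = (λ a → a , ≋-refl (f a)) , (λ a → a , ≋-refl (f a))

≋-sym : ∀ x y → x ≋ y → y ≋ x
≋-sym (sup A f) (sup B g) (p , q) =
  (λ b → let (a , e) = q b in a , ≋-sym (f a) (g b) e) ,
  (λ a → let (b , e) = p a in b , ≋-sym (f a) (g b) e)

≋-trans : ∀ x y z → x ≋ y → y ≋ z → x ≋ z
≋-trans (sup A f) (sup B g) (sup C h) (p , q) (r , s) =
  (λ a → let (b , e) = p a ; (c , e′) = r b in
         c , ≋-trans (f a) (g b) (h c) e e′) ,
  (λ c → let (b , e′) = s c ; (a , e) = q b in
         a , ≋-trans (f a) (g b) (h c) e e′)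

-- The members of a set, so that cardinalities of structures given on
-- types can be compared with ordinals of V.
Elements : V → Setoid 0ℓ 0ℓ
Elements (sup A f) = record
  { Carrier       = A
  ; _≈_           = λ a b → f a ≋ f b
  ; isEquivalence = record
    { refl  = λ {a} → ≋-refl (f a)
    ; sym   = λ {a b} → ≋-sym (f a) (f b)
    ; trans = λ {a b c} → ≋-trans (f a) (f b) (f c)
    }
  }

------------------------------------------------------------------------
-- First-order formulas in the language of set theory, with parameters
-- from X and binders represented by functions.  Everything below that is
-- polymorphic in X can be evaluated both in V and in a forcing extension.

infix  8 _∈_ _≐_
infixr 6 _∧_
infixr 5 _∨_
infixr 4 _⇒_

data Formula (X : Set₁) : Set₁ where
  _∈_ _≐_     : X → X → Formula X
  false       : Formula X
  _∧_ _∨_ _⇒_ : Formula X → Formula X → Formula X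
  all ex      : (X → Formula X) → Formula X

V⊨_ : Formula V → Set₁
V⊨ (x ∈ y) = Lift (lsuc 0ℓ) (x ∊ y)
V⊨ (x ≐ y) = Lift (lsuc 0ℓ) (x ≋ y)
V⊨ false   = ⊥
V⊨ (φ ∧ ψ) = (V⊨ φ) × (V⊨ ψ)
V⊨ (φ ∨ ψ) = (V⊨ φ) ⊎ (V⊨ ψ)
V⊨ (φ ⇒ ψ) = V⊨ φ → V⊨ ψ
V⊨ all φ   = (x : V) → V⊨ φ x
V⊨ ex φ    = Σ[ x ∈ V ] (V⊨ φ x)

------------------------------------------------------------------------
-- Forcing

record Forcing : Set₁ where
  field
    preorder : Preorder 0ℓ 0ℓ 0ℓ
  open Preorder preorder public renaming (_≲_ to _≤_)
  field
    𝟙     : Carrier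
    𝟙-max : Maximum _≤_ 𝟙

  DenseBelow : ∀ {ℓ} → Carrier → Pred Carrier ℓ → Set ℓ
  DenseBelow p D = ∀ q → q ≤ p → Σ[ r ∈ Carrier ] r ≤ q × D r

module _ (ℙ : Forcing) where
  open Forcing ℙ

  -- name I f c is the name {(f i , c i) | i : I}.
  data Name : Set₁ where
    name : (I : Set) → (I → Name) → (I → Carrier) → Name

  check : V → Name
  check (sup A f) = name A (λ a → check (f a)) (λ _ → 𝟙)

  -- The membership relation is written out inside this definition to keep
  -- the recursion structural: the two halves say that every q below both p
  -- and the condition attached to a member of one name forces that member
  -- to belong to the other name.
  Forces≐ : Name → Name → Pred Carrier 0ℓ
  Forces≐ (name I f c) (name J g d) p =
    (∀ i q → q ≤ p → q ≤ c i →
       DenseBelow q λ r → Σ[ j ∈ J ] r ≤ d j × Forces≐ (f i) (g j) r) ×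
    (∀ j q → q ≤ p → q ≤ d j →
       DenseBelow q λ r → Σ[ i ∈ I ] r ≤ c i × Forces≐ (f i) (g j) r)

  Forces∈ : Name → Name → Pred Carrier 0ℓ
  Forces∈ x (name J g d) p =
    DenseBelow p λ r → Σ[ j ∈ J ] r ≤ d j × Forces≐ x (g j) r

  Forces : Formula Name → Pred Carrier (lsuc 0ℓ)
  Forces (x ∈ y) p = Lift (lsuc 0ℓ) (Forces∈ x y p)
  Forces (x ≐ y) p = Lift (lsuc 0ℓ) (Forces≐ x y p)
  Forces false   p = ⊥
  Forces (φ ∧ ψ) p = Forces φ p × Forces ψ p
  Forces (φ ∨ ψ) p = DenseBelow p λ q → Forces φ q ⊎ Forces ψ q
  Forces (φ ⇒ ψ) p = ∀ q → q ≤ p → Forces φ q → Forces ψ q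
  Forces (all φ) p = ∀ x → Forces (φ x) p
  Forces (ex φ)  p = DenseBelow p λ q → Σ[ x ∈ Name ] Forces (φ x) q

infix 3 _⊩_

_⊩_ : (ℙ : Forcing) → Formula (Name ℙ) → Set₁
ℙ ⊩ φ = ∀ p → Forces ℙ φ p

------------------------------------------------------------------------
-- Set-theoretic notions as formulas

module _ {X : Set₁} where

  infix  7 ¬_
  infixr 4 _⇔_

  ¬_ : Formula X → Formula X
  ¬ φ = φ ⇒ false

  _⇔_ : Formula X → Formula X → Formula X
  φ ⇔ ψ = (φ ⇒ ψ) ∧ (ψ ⇒ φ)

  all∈ ex∈ : X → (X → Formula X) → Formula X
  all∈ a φ = all λ x → x ∈ a ⇒ φ x
  ex∈  a φ = ex  λ x → x ∈ a ∧ φ x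

  infix 8 _⊆_ _≤ₒ_

  _⊆_ : X → X → Formula X
  x ⊆ y = all∈ x λ z → z ∈ y

  Empty : X → Formula X
  Empty x = all λ z → ¬ (z ∈ x)

  IsOne : X → Formula X
  IsOne x = ex λ o → Empty o ∧ (all λ z → z ∈ x ⇔ z ≐ o)

  -- Functions, as sets of Kuratowski pairs

  IsPair IsOrderedPair : X → X → X → Formula X
  IsPair z x y = all λ w → w ∈ z ⇔ (w ≐ x ∨ w ≐ y)
  IsOrderedPair z x y =
    ex λ a → ex λ b → IsPair a x x ∧ IsPair b x y ∧ IsPair z a b

  Maps : X → X → X → Formula X
  Maps f x y = ex∈ f λ z → IsOrderedPair z x y

  FunctionOn : X → X → Formula X
  FunctionOn f A =
    (all∈ f λ z → ex∈ A λ x → ex λ y → IsOrderedPair z x y) ∧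
    (all∈ A λ x → ex λ y → Maps f x y) ∧
    (all λ x → all λ y → all λ y′ → Maps f x y ⇒ Maps f x y′ ⇒ y ≐ y′)

  Function : X → X → X → Formula X
  Function f A B =
    FunctionOn f A ∧ (all λ x → all λ y → Maps f x y ⇒ y ∈ B)

  Injective : X → Formula X
  Injective f =
    all λ x → all λ x′ → all λ y → Maps f x y ⇒ Maps f x′ y ⇒ x ≐ x′

  Bijection : X → X → X → Formula X
  Bijection f A B =
    Function f A B ∧ Injective f ∧ (all∈ B λ y → ex∈ A λ x → Maps f x y)

  -- Ordinals and cardinals

  Transitive : X → Formula X
  Transitive x = all∈ x λ y → y ⊆ x

  -- By foundation, ∈ well-orders a transitive set of transitive sets.
  Ordinal : X → Formula X
  Ordinal x = Transitive x ∧ (all∈ x λ y → Transitive y)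

  _≤ₒ_ : X → X → Formula X
  α ≤ₒ β = α ∈ β ∨ α ≐ β

  Limit : X → Formula X
  Limit x = Ordinal x ∧ ¬ Empty x ∧ (all∈ x λ y → ex∈ x λ z → y ∈ z)

  IsOmega : X → Formula X
  IsOmega w = Limit w ∧ (all∈ w λ n → ¬ Limit n)

  Cardinal : X → Formula X
  Cardinal κ = Ordinal κ ∧ (all∈ κ λ α → ¬ (ex λ f → Bijection f α κ))

  IsSuccessorCardinal : X → X → Formula X
  IsSuccessorCardinal ν μ =
    Cardinal ν ∧ μ ∈ ν ∧ (all∈ ν λ x → Cardinal x ⇒ x ≤ₒ μ)

  IsAleph2 : X → Formula X
  IsAleph2 a = ex λ w → ex λ b →
    IsOmega w ∧ IsSuccessorCardinal b w ∧ IsSuccessorCardinal a b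

  -- |A| < κ, for a cardinal κ.
  FewerThan : X → X → Formula X
  FewerThan A κ = ex∈ κ λ α → ex λ f → Function f A α ∧ Injective f

  -- λ^{<λ} = λ, where λ^{<λ} is the cardinality of the set of functions
  -- from ordinals below λ to λ.
  WeakPowerFixed : X → Formula X
  WeakPowerFixed Λ = ex λ H →
    (all λ f → f ∈ H ⇔ (ex∈ Λ λ ν → Function f ν Λ)) ∧
    (ex λ g → Bijection g H Λ)

  -- Cofinality.  A is not assumed to be a subset of δ.

  Unbounded : X → X → Formula X
  Unbounded A δ = all∈ δ λ β → ex∈ A λ η → η ∈ δ ∧ β ≤ₒ η

  CofinalMap : X → X → X → Formula X
  CofinalMap f μ δ =
    Function f μ δ ∧
    (all∈ δ λ β → ex∈ μ λ ξ → ex∈ δ λ η → Maps f ξ η ∧ β ≤ₒ η)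

  IsCofinality : X → X → Formula X
  IsCofinality δ μ =
    Ordinal μ ∧ (ex λ f → CofinalMap f μ δ) ∧
    (all∈ μ λ ν → ¬ (ex λ f → CofinalMap f ν δ))

  UncountableCofinality : X → Formula X
  UncountableCofinality γ =
    ex λ μ → ex λ w → IsCofinality γ μ ∧ IsOmega w ∧ w ∈ μ

  Regular : X → Formula X
  Regular Λ =
    Cardinal Λ ∧ (ex λ w → IsOmega w ∧ w ≤ₒ Λ) ∧ IsCofinality Λ Λ

  -- Stationarity and reflection

  Club : X → X → Formula X
  Club C δ =
    C ⊆ δ ∧ Unbounded C δ ∧
    (all∈ δ λ α → Limit α ⇒ Unbounded C α ⇒ α ∈ C)

  -- As C ⊆ δ, this says that T ∩ δ is stationary in δ.
  Stationary : X → X → Formula X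
  Stationary T δ = all λ C → Club C δ ⇒ (ex∈ C λ x → x ∈ T)

  Reflects : X → X → Formula X
  Reflects T γ = UncountableCofinality γ ∧ Stationary T γ

  StationarySubset : X → X → X → Formula X
  StationarySubset Λ S T = T ⊆ S ∧ Stationary T Λ

  -- s = S^Λ_ω
  IsSω : X → X → Formula X
  IsSω Λ s = all λ x → x ∈ s ⇔
    (x ∈ Λ ∧ Limit x ∧ (ex λ w → IsOmega w ∧ IsCofinality x w))

  Refl : X → X → X → Formula X
  Refl Λ κ S = all λ 𝓢 →
    (all∈ 𝓢 λ T → StationarySubset Λ S T) ⇒ FewerThan 𝓢 κ ⇒
    (ex∈ Λ λ γ → all∈ 𝓢 λ T → Reflects T γ)

  -- uDSR(1,S)
  uDSR₁ : X → X → Formula X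
  uDSR₁ Λ S = all λ s →
    FunctionOn s Λ ⇒
    (all λ α → all λ T → Maps s α T ⇒ StationarySubset Λ S T) ⇒
    (ex∈ Λ λ γ → UncountableCofinality γ ∧
      (ex λ F → F ⊆ γ ∧ Unbounded F γ ∧
        (all∈ F λ α → all λ T → Maps s α T ⇒ Reflects T γ)))

------------------------------------------------------------------------
-- Properties of forcings

module _ (ℙ : Forcing) where
  open Forcing ℙ

  Directed : Pred Carrier 0ℓ → Set
  Directed D =
    (Σ[ p ∈ Carrier ] D p) ×
    (∀ p q → D p → D q → Σ[ r ∈ Carrier ] D r × r ≤ p × r ≤ q)

  SizeAtMost : V → Set
  SizeAtMost Λ = Injection Eq.setoid (Elements Λ)

  SubsetSizeBelow : Pred Carrier 0ℓ → V → Set₁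
  SubsetSizeBelow D Λ = Σ[ α ∈ V ] (α ∊ Λ) ×
    Injection (On.setoid Eq.setoid (proj₁ {B = D})) (Elements α)

  DirectedClosed : V → Set₁
  DirectedClosed Λ = ∀ D → Directed D → SubsetSizeBelow D Λ →
    Σ[ p ∈ Carrier ] (∀ q → D q → p ≤ q)

  CofinalityPreserving : Set₁
  CofinalityPreserving = ∀ δ μ → V⊨ Ordinal δ → V⊨ IsCofinality δ μ →
    ℙ ⊩ IsCofinality (check ℙ δ) (check ℙ μ)

Refl* : V → V → V → Set₁
Refl* Λ κ S = ∀ ℙ → DirectedClosed ℙ Λ → SizeAtMost ℙ Λ →
  ℙ ⊩ Refl (check ℙ Λ) (check ℙ κ) (check ℙ S)

module Submission where

-- ℙ adds, by initial segments, a function g : Λ → Λ such that at every β of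
-- uncountable cofinality the regressive values of g are bounded on a club of β;
-- its fibres S_α = {ξ ∈ S : g ξ = α} are stationary and refute uDSR(1,S).  Given
-- fewer than κ stationary sets in V^ℙ, Fodor's lemma yields a single δ such that
-- each of them stays stationary when the points ξ with δ ≤ g ξ < ξ are discarded.
-- Shooting a club through the remaining points results in a forcing ℚ of V, with
-- a projection to ℙ, which is Λ-directed closed, of size Λ, and preserves the
-- stationarity of those sets.  They thus reflect simultaneously in V^ℚ, and then
-- also in V^ℙ, because clubs of V^ℙ remain clubs in V^ℚ.  The projection moreover
-- makes ℙ distributive; since ℙ also has size Λ, it preserves cofinalities.

open import Defs
open import Axiom.ExcludedMiddle using (ExcludedMiddle)
open import Axiom.Extensionality.Propositional using (Extensionality; implicit-extensionality)
open import Axiom.UniquenessOfIdentityProofs.WithK using (uip)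
open import Data.Bool using (Bool; true; if_then_else_) renaming (false to ffalse)
open import Data.Empty using (⊥; ⊥-elim)
open import Data.Empty.Polymorphic using () renaming (⊥ to ⊥ₚ)
open import Data.Maybe using (Maybe; just; nothing)
open import Data.Nat as ℕ using (ℕ; zero)
open import Data.Nat.Properties as ℕₚ using ()
open import Data.Product using (Σ; Σ-syntax; _×_; _,_; proj₁; proj₂)
open import Data.Sum using (_⊎_; inj₁; inj₂; [_,_]′)
open import Data.Unit using (⊤; tt)
open import Function.Bundles using (Injection)
open import Induction.WellFounded using (Acc; acc; WellFounded)
open import Level using (Level; Lift; lift; lower; 0ℓ; _⊔_) renaming (suc to lsuc)
open import Relation.Binary.Bundles using (Setoid)
open import Relation.Binary.Definitions using (tri<; tri≈; tri>)
open import Relation.Binary.PropositionalEquality using (_≡_; refl; sym; trans; cong; subst)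
open import Relation.Nullary using (Dec; yes; no; does)
open import Relation.Nullary.Decidable using (dec-true; dec-false)

-- The requirement on g does not survive unions: when the length of a union has uncountable
-- cofinality, the clubs that witness the requirement at smaller lengths need not cohere, and
-- nothing provides a club there. So `Refl*` cannot be applied to ℙ itself. A condition of ℚ carries
-- one closed set, end-extended along ℚ, and the union of these sets is exactly the missing witness;
-- the forcing that discards points is also the one that restores closure. ℚ makes S_α nonstationary
-- for every α with δ ≤ α, so δ has to be found after the family is given. Fewer than κ ≤ Λ ordinals
-- δ have a common bound by regularity, whereas no δ serves all Λ fibres: this separates Refl(<κ,S)
-- from uDSR(1,S). Stationarity survives ℚ because the points in question have cofinality ω, so that
-- a condition can be built up to such a point in ω steps and capped by it. No generic filter is
-- mentioned: predicates that are monotone in the condition play the role of names of sets of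
-- ordinals, and are pulled back along the projection.

Ix : V → Set
Ix (sup A f) = A

el : (x : V) → Ix x → V
el (sup A f) = f

∊⇒ix : ∀ {x} y → x ∊ y → Σ[ b ∈ Ix y ] x ≋ el y b
∊⇒ix (sup B g) h = h

ix⇒∊ : ∀ {x} y (b : Ix y) → x ≋ el y b → x ∊ y
ix⇒∊ (sup B g) b e = b , e

el∊ : ∀ y (b : Ix y) → el y b ∊ y
el∊ y b = ix⇒∊ y b (≋-refl (el y b))

∊-congˡ : ∀ {x x′} y → x ≋ x′ → x ∊ y → x′ ∊ y
∊-congˡ {x} {x′} (sup B g) e (b , h) = b , ≋-trans x′ x (g b) (≋-sym x x′ e) h

∊-congʳ : ∀ {x} y y′ → y ≋ y′ → x ∊ y → x ∊ y′
∊-congʳ {x} (sup B g) (sup C h) (p , q) (b , e) =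
  let (c , e′) = p b in c , ≋-trans x (g b) (h c) e e′

≋-ext : ∀ x y → (∀ z → z ∊ x → z ∊ y) → (∀ z → z ∊ y → z ∊ x) → x ≋ y
≋-ext (sup A f) (sup B g) p q =
  (λ a → p (f a) (a , ≋-refl (f a))) ,
  (λ b → let (a , e) = q (g b) (b , ≋-refl (g b)) in a , ≋-sym (g b) (f a) e)

-- Models with locally determined truth

-- A Kripke structure for the language of set theory in which truth is
-- local for the dense topology on the worlds.  Both V, over a single world,
-- and every forcing extension are of this kind, so that what is proved for
-- all of them serves in the ground model as well.
record Model : Set₂ where
  infix 4 _⊑_
  field
    X : Set₁
    W : Set
    _⊑_ : W → W → Set
    ⊑-refl : ∀ {p} → p ⊑ p
    ⊑-trans : ∀ {p q r} → p ⊑ q → q ⊑ r → p ⊑ r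

  Dense : ∀ {ℓ} → W → (W → Set ℓ) → Set ℓ
  Dense p D = ∀ q → q ⊑ p → Σ[ r ∈ W ] r ⊑ q × D r

  Mono : ∀ {ℓ} → (W → Set ℓ) → Set ℓ
  Mono D = ∀ {p q} → q ⊑ p → D p → D q

  infix 4 _⇛_
  _⇛_ : ∀ {ℓ ℓ′} → (W → Set ℓ) → (W → Set ℓ′) → W → Set (ℓ ⊔ ℓ′)
  (D ⇛ E) p = ∀ {q} → q ⊑ p → D q → E q

  field
    Eq Mem : X → X → W → Set
    eq-refl : ∀ {x p} → Eq x x p
    eq-sym : ∀ {x y p} → Eq x y p → Eq y x p
    eq-trans : ∀ {x y z p} → Eq x y p → Eq y z p → Eq x z p
    eq-mono : ∀ {x y} → Mono (Eq x y)
    mem-mono : ∀ {x y} → Mono (Mem x y)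
    eq-dense : ∀ {x y p} → Dense p (Eq x y) → Eq x y p
    mem-dense : ∀ {x y p} → Dense p (Mem x y) → Mem x y p
    mem-cong : ∀ {x x′ y y′ p} → Eq x x′ p → Eq y y′ p → Mem x y p → Mem x′ y′ p
    extensionality : ∀ {x y p} → (∀ z → (Mem z x ⇛ Mem z y) p) →
                     (∀ z → (Mem z y ⇛ Mem z x) p) → Eq x y p
    -- `_◂_` relates the listed constituents of a set or name to it. Induction along it stands in
    -- for ∈-induction, which is not structural: a member is only densely equal to a constituent
    -- (`mem⇒◂`).
    _◂_ : X → X → Set₁
    ◂-ind : (Φ : X → Set₁) → (∀ x → (∀ y → y ◂ x → Φ y) → Φ x) → ∀ x → Φ x
    mem⇒◂ : ∀ {z x p} → Mem z x p → Dense p (λ r → Σ[ y ∈ X ] y ◂ x × Eq z y r)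
    -- N takes values in `Set` because names have small index types. Only elimination needs N to be
    -- monotone: in a forcing extension the witness of N belongs to a weaker condition than the one
    -- of interest.
    mk : (A : Set) → (A → X) → (A → W → Set) → X
    mk-intro : ∀ {A f N z p} → Dense p (λ r → Σ[ a ∈ A ] N a r × Eq z (f a) r) →
               Mem z (mk A f N) p
    mk-elim : ∀ {A f N z p} → (∀ a → Mono (N a)) → Mem z (mk A f N) p →
              Dense p (λ r → Σ[ a ∈ A ] N a r × Eq z (f a) r)
    chk : V → X
    chk-intro : ∀ x {z p} → Dense p (λ r → Σ[ a ∈ Ix x ] Eq z (chk (el x a)) r) →
                Mem z (chk x) p
    chk-elim : ∀ x {z p} → Mem z (chk x) p →
               Dense p (λ r → Σ[ a ∈ Ix x ] Eq z (chk (el x a)) r)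

  Sat : Formula X → W → Set₁
  Sat (x ∈ y) p = Lift (lsuc 0ℓ) (Mem x y p)
  Sat (x ≐ y) p = Lift (lsuc 0ℓ) (Eq x y p)
  Sat false   p = ⊥ₚ
  Sat (φ ∧ ψ) p = Sat φ p × Sat ψ p
  Sat (φ ∨ ψ) p = Dense p λ q → Sat φ q ⊎ Sat ψ q
  Sat (φ ⇒ ψ) p = ∀ q → q ⊑ p → Sat φ q → Sat ψ q
  Sat (all φ) p = ∀ x → Sat (φ x) p
  Sat (ex φ)  p = Dense p λ q → Σ[ x ∈ X ] Sat (φ x) q

VM : Model
VM = record
  { X = V ; W = ⊤ ; _⊑_ = λ _ _ → ⊤ ; ⊑-refl = tt ; ⊑-trans = λ _ _ → tt
  ; Eq = λ x y _ → x ≋ y ; Mem = λ x y _ → x ∊ y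
  ; eq-refl = λ {x} → ≋-refl x
  ; eq-sym = λ {x} {y} → ≋-sym x y
  ; eq-trans = λ {x} {y} {z} → ≋-trans x y z
  ; eq-mono = λ _ e → e ; mem-mono = λ _ m → m
  ; eq-dense = λ d → proj₂ (proj₂ (d tt tt))
  ; mem-dense = λ d → proj₂ (proj₂ (d tt tt))
  ; mem-cong = λ {x} {x′} {y} {y′} e e′ m → ∊-congʳ y y′ e′ (∊-congˡ y e m)
  ; extensionality = λ {x} {y} p q → ≋-ext x y (λ z → p z tt) (λ z → q z tt)
  ; _◂_ = λ x y → Σ[ b ∈ Ix y ] x ≡ el y b
  ; ◂-ind = ind
  ; mem⇒◂ = λ {z} {x} m _ _ → tt , tt , (let (b , e) = ∊⇒ix x m in
      el x b , (b , refl) , e)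
  ; mk = λ A f N → sup (Σ[ a ∈ A ] N a tt) (λ a → f (proj₁ a))
  ; mk-intro = λ d → let (_ , _ , a , n , e) = d tt tt in (a , n) , e
  ; mk-elim = λ { _ ((a , n) , e) _ _ → tt , tt , a , n , e }
  ; chk = λ x → x
  ; chk-intro = λ x d → let (_ , _ , a , e) = d tt tt in ix⇒∊ x a e
  ; chk-elim = λ x m _ _ → tt , tt , ∊⇒ix x m
  }
  where
  ind : (Φ : V → Set₁) →
        (∀ x → (∀ y → Σ[ b ∈ Ix x ] y ≡ el x b → Φ y) → Φ x) →
        ∀ x → Φ x
  ind Φ h (sup A f) = h (sup A f) λ { _ (b , refl) → ind Φ h (f b) }

-- Forcing extensions as models

module _ (ℙ : Forcing) where
  open Forcing ℙ using (Carrier; _≤_; DenseBelow) renaming (refl to ≤-refl; trans to ≤-trans)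

  private
    _⊨_≐_ : Carrier → Name ℙ → Name ℙ → Set
    p ⊨ x ≐ y = Forces≐ ℙ x y p

  forces≐-refl : ∀ x {p} → p ⊨ x ≐ x
  forces≐-refl (name I f c) =
    (λ i q _ q≤ci r r≤q → r , ≤-refl , i , ≤-trans r≤q q≤ci , forces≐-refl (f i)) ,
    (λ i q _ q≤ci r r≤q → r , ≤-refl , i , ≤-trans r≤q q≤ci , forces≐-refl (f i))

  forces≐-mono : ∀ x y {p q} → q ≤ p → p ⊨ x ≐ y → q ⊨ x ≐ y
  forces≐-mono (name I f c) (name J g d) q≤p (h , k) =
    (λ i r r≤q → h i r (≤-trans r≤q q≤p)) , (λ j r r≤q → k j r (≤-trans r≤q q≤p))

  forces≐-sym : ∀ x y {p} → p ⊨ x ≐ y → p ⊨ y ≐ x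
  forces≐-sym (name I f c) (name J g d) (h , k) =
    (λ j q q≤p q≤dj r r≤q → let (s , s≤r , i , s≤ci , e) = k j q q≤p q≤dj r r≤q in
       s , s≤r , i , s≤ci , forces≐-sym (f i) (g j) e) ,
    (λ i q q≤p q≤ci r r≤q → let (s , s≤r , j , s≤dj , e) = h i q q≤p q≤ci r r≤q in
       s , s≤r , j , s≤dj , forces≐-sym (f i) (g j) e)

  forces≐-trans : ∀ x y z {p} → p ⊨ x ≐ y → p ⊨ y ≐ z → p ⊨ x ≐ z
  forces≐-trans (name I f c) (name J g d) (name K h e) (u , v) (u′ , v′) =
    (λ i q q≤p q≤ci r r≤q →
      let (s , s≤r , j , s≤dj , eq) = u i q q≤p q≤ci r r≤q
          (t , t≤s , k , t≤ek , eq′) =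
            u′ j s (≤-trans s≤r (≤-trans r≤q q≤p)) s≤dj s ≤-refl
      in t , ≤-trans t≤s s≤r , k , t≤ek ,
         forces≐-trans (f i) (g j) (h k) (forces≐-mono (f i) (g j) t≤s eq) eq′) ,
    (λ k q q≤p q≤ek r r≤q →
      let (s , s≤r , j , s≤dj , eq) = v′ k q q≤p q≤ek r r≤q
          (t , t≤s , i , t≤ci , eq′) =
            v j s (≤-trans s≤r (≤-trans r≤q q≤p)) s≤dj s ≤-refl
      in t , ≤-trans t≤s s≤r , i , t≤ci ,
         forces≐-trans (f i) (g j) (h k) eq′ (forces≐-mono (g j) (h k) t≤s eq))

  forces≐-dense : ∀ x y {p} → DenseBelow p (Forces≐ ℙ x y) → p ⊨ x ≐ y
  forces≐-dense (name I f c) (name J g d) D =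
    (λ i q q≤p q≤ci r r≤q →
      let (s , s≤r , h , _) = D r (≤-trans r≤q q≤p)
          (t , t≤s , w) = h i s ≤-refl (≤-trans s≤r (≤-trans r≤q q≤ci)) s ≤-refl
      in t , ≤-trans t≤s s≤r , w) ,
    (λ j q q≤p q≤dj r r≤q →
      let (s , s≤r , _ , k) = D r (≤-trans r≤q q≤p)
          (t , t≤s , w) = k j s ≤-refl (≤-trans s≤r (≤-trans r≤q q≤dj)) s ≤-refl
      in t , ≤-trans t≤s s≤r , w)

  forces∈-cong : ∀ x x′ y y′ {p} → p ⊨ x ≐ x′ → p ⊨ y ≐ y′ → Forces∈ ℙ x y p → Forces∈ ℙ x′ y′ p
  forces∈-cong x x′ (name J g d) (name K h e) eqx (eqy , _) m q q≤p =
    let (r , r≤q , j , r≤dj , eq) = m q q≤p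
        r≤p = ≤-trans r≤q q≤p
        (s , s≤r , k , s≤ek , eq′) = eqy j r r≤p r≤dj r ≤-refl
    in s , ≤-trans s≤r r≤q , k , s≤ek ,
       forces≐-trans x′ (g j) (h k)
         (forces≐-trans x′ x (g j) (forces≐-sym x x′ (forces≐-mono x x′ (≤-trans s≤r r≤p) eqx))
           (forces≐-mono x (g j) s≤r eq))
         eq′

  forces≐-extensionality : ∀ x y {p} →
    (∀ z q → q ≤ p → Forces∈ ℙ z x q → Forces∈ ℙ z y q) →
    (∀ z q → q ≤ p → Forces∈ ℙ z y q → Forces∈ ℙ z x q) → p ⊨ x ≐ y
  forces≐-extensionality (name I f c) (name J g d) h k =
    (λ i q q≤p q≤ci → h (f i) q q≤p λ r r≤q → r , ≤-refl , i , ≤-trans r≤q q≤ci , forces≐-refl (f i)) ,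
    (λ j q q≤p q≤dj r r≤q →
      let (s , s≤r , i , s≤ci , e) =
            k (g j) q q≤p (λ r r≤q → r , ≤-refl , j , ≤-trans r≤q q≤dj , forces≐-refl (g j)) r r≤q
      in s , s≤r , i , s≤ci , forces≐-sym (g j) (f i) e)

  forces∈-mono : ∀ x y {p q} → q ≤ p → Forces∈ ℙ x y p → Forces∈ ℙ x y q
  forces∈-mono x (name J g d) q≤p m r r≤q = m r (≤-trans r≤q q≤p)

  forces∈-dense : ∀ x y {p} → DenseBelow p (Forces∈ ℙ x y) → Forces∈ ℙ x y p
  forces∈-dense x (name J g d) D q q≤p =
    let (r , r≤q , m) = D q q≤p ; (s , s≤r , w) = m r ≤-refl in s , ≤-trans s≤r r≤q , w

  data _∈ₙ_ : Name ℙ → Name ℙ → Set₁ where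
    child : ∀ {I f c} (i : I) → f i ∈ₙ name I f c

  ∈ₙ-ind : (Φ : Name ℙ → Set₁) → (∀ x → (∀ y → y ∈ₙ x → Φ y) → Φ x) → ∀ x → Φ x
  ∈ₙ-ind Φ h (name I f c) = h (name I f c) λ { _ (child i) → ∈ₙ-ind Φ h (f i) }

  forces∈⇒∈ₙ : ∀ z x {p} → Forces∈ ℙ z x p →
               DenseBelow p (λ r → Σ[ y ∈ Name ℙ ] y ∈ₙ x × r ⊨ z ≐ y)
  forces∈⇒∈ₙ z (name I f c) m q q≤p =
    let (r , r≤q , i , _ , e) = m q q≤p in r , r≤q , f i , child i , e

  forces∈-check-intro : ∀ x z {p} → DenseBelow p (λ r → Σ[ a ∈ Ix x ] r ⊨ z ≐ check ℙ (el x a)) →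
                        Forces∈ ℙ z (check ℙ x) p
  forces∈-check-intro (sup A f) z D q q≤p =
    let (r , r≤q , a , e) = D q q≤p in r , r≤q , a , Forcing.𝟙-max ℙ r , e

  forces∈-check-elim : ∀ x z {p} → Forces∈ ℙ z (check ℙ x) p →
                       DenseBelow p (λ r → Σ[ a ∈ Ix x ] r ⊨ z ≐ check ℙ (el x a))
  forces∈-check-elim (sup A f) z m q q≤p =
    let (r , r≤q , a , _ , e) = m q q≤p in r , r≤q , a , e

  FM : Model
  FM = record
    { X = Name ℙ ; W = Carrier ; _⊑_ = _≤_ ; ⊑-refl = ≤-refl ; ⊑-trans = ≤-trans
    ; Eq = Forces≐ ℙ ; Mem = Forces∈ ℙ
    ; eq-refl = λ {x} → forces≐-refl x
    ; eq-sym = λ {x} {y} → forces≐-sym x y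
    ; eq-trans = λ {x} {y} {z} → forces≐-trans x y z
    ; eq-mono = λ {x} {y} → forces≐-mono x y
    ; mem-mono = λ {x} {y} → forces∈-mono x y
    ; eq-dense = λ {x} {y} → forces≐-dense x y
    ; mem-dense = λ {x} {y} → forces∈-dense x y
    ; mem-cong = λ {x} {x′} {y} {y′} → forces∈-cong x x′ y y′
    ; extensionality = λ {x} {y} h k →
        forces≐-extensionality x y (λ z q q≤p → h z q≤p) (λ z q q≤p → k z q≤p)
    ; _◂_ = _∈ₙ_ ; ◂-ind = ∈ₙ-ind
    ; mem⇒◂ = λ {z} {x} → forces∈⇒∈ₙ z x
    ; mk = λ A f N → name (Σ[ a ∈ A ] Σ[ p ∈ Carrier ] N a p) (λ i → f (proj₁ i)) (λ i → proj₁ (proj₂ i))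
    ; mk-intro = λ D q q≤p → let (r , r≤q , a , n , e) = D q q≤p in r , r≤q , (a , r , n) , ≤-refl , e
    ; mk-elim = λ mono m q q≤p →
        let (r , r≤q , (a , s , n) , r≤s , e) = m q q≤p in r , r≤q , a , mono a r≤s n , e
    ; chk = check ℙ
    ; chk-intro = λ x {z} → forces∈-check-intro x z
    ; chk-elim = λ x {z} → forces∈-check-elim x z
    }

  private module M = Model FM

  -- Both sides have the same clauses, but as different recursive functions they agree only formula
  -- by formula. Implication is contravariant, hence the mutual recursion.
  forces⇒sat : ∀ φ {p} → Forces ℙ φ p → M.Sat φ p
  sat⇒forces : ∀ φ {p} → M.Sat φ p → Forces ℙ φ p
  forces⇒sat (x ∈ y) h = h
  forces⇒sat (x ≐ y) h = h
  forces⇒sat (φ ∧ ψ) (h , k) = forces⇒sat φ h , forces⇒sat ψ k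
  forces⇒sat (φ ∨ ψ) h q q≤p with h q q≤p
  ... | r , r≤q , inj₁ k = r , r≤q , inj₁ (forces⇒sat φ k)
  ... | r , r≤q , inj₂ k = r , r≤q , inj₂ (forces⇒sat ψ k)
  forces⇒sat (φ ⇒ ψ) h q q≤p k = forces⇒sat ψ (h q q≤p (sat⇒forces φ k))
  forces⇒sat (all φ) h x = forces⇒sat (φ x) (h x)
  forces⇒sat (ex φ) h q q≤p =
    let (r , r≤q , x , k) = h q q≤p in r , r≤q , x , forces⇒sat (φ x) k
  sat⇒forces (x ∈ y) h = h
  sat⇒forces (x ≐ y) h = h
  sat⇒forces (φ ∧ ψ) (h , k) = sat⇒forces φ h , sat⇒forces ψ k
  sat⇒forces (φ ∨ ψ) h q q≤p with h q q≤p
  ... | r , r≤q , inj₁ k = r , r≤q , inj₁ (sat⇒forces φ k)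
  ... | r , r≤q , inj₂ k = r , r≤q , inj₂ (sat⇒forces ψ k)
  sat⇒forces (φ ⇒ ψ) h q q≤p k = sat⇒forces ψ (h q q≤p (forces⇒sat φ k))
  sat⇒forces (all φ) h x = sat⇒forces (φ x) (h x)
  sat⇒forces (ex φ) h q q≤p =
    let (r , r≤q , x , k) = h q q≤p in r , r≤q , x , sat⇒forces (φ x) k

V⊨⇒sat : ∀ φ → V⊨ φ → Model.Sat VM φ tt
sat⇒V⊨ : ∀ φ → Model.Sat VM φ tt → V⊨ φ
V⊨⇒sat (x ∈ y) h = h
V⊨⇒sat (x ≐ y) h = h
V⊨⇒sat (φ ∧ ψ) (h , k) = V⊨⇒sat φ h , V⊨⇒sat ψ k
V⊨⇒sat (φ ∨ ψ) (inj₁ h) _ _ = tt , tt , inj₁ (V⊨⇒sat φ h)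
V⊨⇒sat (φ ∨ ψ) (inj₂ h) _ _ = tt , tt , inj₂ (V⊨⇒sat ψ h)
V⊨⇒sat (φ ⇒ ψ) h _ _ k = V⊨⇒sat ψ (h (sat⇒V⊨ φ k))
V⊨⇒sat (all φ) h x = V⊨⇒sat (φ x) (h x)
V⊨⇒sat (ex φ) (x , h) _ _ = tt , tt , x , V⊨⇒sat (φ x) h
sat⇒V⊨ (x ∈ y) h = h
sat⇒V⊨ (x ≐ y) h = h
sat⇒V⊨ (φ ∧ ψ) (h , k) = sat⇒V⊨ φ h , sat⇒V⊨ ψ k
sat⇒V⊨ (φ ∨ ψ) h with h tt tt
... | _ , _ , inj₁ k = inj₁ (sat⇒V⊨ φ k)
... | _ , _ , inj₂ k = inj₂ (sat⇒V⊨ ψ k)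
sat⇒V⊨ (φ ⇒ ψ) h k = sat⇒V⊨ ψ (h tt tt (V⊨⇒sat φ k))
sat⇒V⊨ (all φ) h x = sat⇒V⊨ (φ x) (h x)
sat⇒V⊨ (ex φ) h = let (_ , _ , x , k) = h tt tt in x , sat⇒V⊨ (φ x) k

module Classical (em : ∀ {ℓ} → ExcludedMiddle ℓ) (fe : ∀ {a b} → Extensionality a b) where

  -- First-order codes of the formulas in use

  -- Congruence fails for arbitrary functions X → Formula X and is proved by
  -- induction on first-order codes instead.

  data Fm (Γ : Set) : Set where
    memᶠ eqᶠ : Γ → Γ → Fm Γ
    ffᶠ : Fm Γ
    andᶠ orᶠ impᶠ : Fm Γ → Fm Γ → Fm Γ
    allᶠ exᶠ : Fm (Maybe Γ) → Fm Γ

  _▸_ : ∀ {Γ : Set} {X : Set₁} → (Γ → X) → X → Maybe Γ → X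
  (ρ ▸ x) nothing  = x
  (ρ ▸ x) (just v) = ρ v

  ⟦_⟧ : ∀ {Γ X} → Fm Γ → (Γ → X) → Formula X
  ⟦ memᶠ u v ⟧ ρ = ρ u ∈ ρ v
  ⟦ eqᶠ u v ⟧  ρ = ρ u ≐ ρ v
  ⟦ ffᶠ ⟧      ρ = false
  ⟦ andᶠ φ ψ ⟧ ρ = ⟦ φ ⟧ ρ ∧ ⟦ ψ ⟧ ρ
  ⟦ orᶠ φ ψ ⟧  ρ = ⟦ φ ⟧ ρ ∨ ⟦ ψ ⟧ ρ
  ⟦ impᶠ φ ψ ⟧ ρ = ⟦ φ ⟧ ρ ⇒ ⟦ ψ ⟧ ρ
  ⟦ allᶠ φ ⟧   ρ = all λ x → ⟦ φ ⟧ (ρ ▸ x)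
  ⟦ exᶠ φ ⟧    ρ = ex λ x → ⟦ φ ⟧ (ρ ▸ x)

  module _ where
    private
      pattern ν₀ = nothing
      pattern ν₁ = just nothing
      pattern ν₂ = just (just nothing)
      pattern s¹ v = just v
      pattern s² v = just (just v)
      pattern s³ v = just (just (just v))
      variable Γ : Set

    notᶠ : Fm Γ → Fm Γ
    notᶠ φ = impᶠ φ ffᶠ

    iffᶠ : Fm Γ → Fm Γ → Fm Γ
    iffᶠ φ ψ = andᶠ (impᶠ φ ψ) (impᶠ ψ φ)

    all∈ᶠ ex∈ᶠ : Γ → Fm (Maybe Γ) → Fm Γ
    all∈ᶠ a φ = allᶠ (impᶠ (memᶠ ν₀ (s¹ a)) φ)
    ex∈ᶠ a φ = exᶠ (andᶠ (memᶠ ν₀ (s¹ a)) φ)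

    subᶠ : Γ → Γ → Fm Γ
    subᶠ x y = all∈ᶠ x (memᶠ ν₀ (s¹ y))

    emptyᶠ : Γ → Fm Γ
    emptyᶠ x = allᶠ (notᶠ (memᶠ ν₀ (s¹ x)))

    pairᶠ opairᶠ mapsᶠ : Γ → Γ → Γ → Fm Γ
    pairᶠ z x y = allᶠ (iffᶠ (memᶠ ν₀ (s¹ z)) (orᶠ (eqᶠ ν₀ (s¹ x)) (eqᶠ ν₀ (s¹ y))))
    opairᶠ z x y = exᶠ (exᶠ (andᶠ (pairᶠ ν₁ (s² x) (s² x))
                            (andᶠ (pairᶠ ν₀ (s² x) (s² y)) (pairᶠ (s² z) ν₁ ν₀))))
    mapsᶠ f x y = ex∈ᶠ f (opairᶠ ν₀ (s¹ x) (s¹ y))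

    functionOnᶠ : Γ → Γ → Fm Γ
    functionOnᶠ f A =
      andᶠ (all∈ᶠ f (ex∈ᶠ (s¹ A) (exᶠ (opairᶠ ν₂ ν₁ ν₀))))
      (andᶠ (all∈ᶠ A (exᶠ (mapsᶠ (s² f) ν₁ ν₀)))
      (allᶠ (allᶠ (allᶠ (impᶠ (mapsᶠ (s³ f) ν₂ ν₁) (impᶠ (mapsᶠ (s³ f) ν₂ ν₀) (eqᶠ ν₁ ν₀)))))))

    functionᶠ : Γ → Γ → Γ → Fm Γ
    functionᶠ f A B = andᶠ (functionOnᶠ f A) (allᶠ (allᶠ (impᶠ (mapsᶠ (s² f) ν₁ ν₀) (memᶠ ν₀ (s² B)))))

    transitiveᶠ ordinalᶠ limitᶠ omegaᶠ : Γ → Fm Γ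
    transitiveᶠ x = all∈ᶠ x (subᶠ ν₀ (s¹ x))
    ordinalᶠ x = andᶠ (transitiveᶠ x) (all∈ᶠ x (transitiveᶠ ν₀))
    limitᶠ x = andᶠ (ordinalᶠ x) (andᶠ (notᶠ (emptyᶠ x)) (all∈ᶠ x (ex∈ᶠ (s¹ x) (memᶠ ν₁ ν₀))))
    omegaᶠ w = andᶠ (limitᶠ w) (all∈ᶠ w (notᶠ (limitᶠ ν₀)))

    leᶠ unboundedᶠ isCofinalityᶠ clubᶠ stationaryᶠ reflectsᶠ : Γ → Γ → Fm Γ
    leᶠ a b = orᶠ (memᶠ a b) (eqᶠ a b)
    unboundedᶠ A δ = all∈ᶠ δ (ex∈ᶠ (s¹ A) (andᶠ (memᶠ ν₀ (s² δ)) (leᶠ ν₁ ν₀)))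

    cofinalMapᶠ : Γ → Γ → Γ → Fm Γ
    cofinalMapᶠ f μ δ = andᶠ (functionᶠ f μ δ)
      (all∈ᶠ δ (ex∈ᶠ (s¹ μ) (ex∈ᶠ (s² δ) (andᶠ (mapsᶠ (s³ f) ν₁ ν₀) (leᶠ ν₂ ν₀)))))

    isCofinalityᶠ δ μ = andᶠ (ordinalᶠ μ) (andᶠ (exᶠ (cofinalMapᶠ ν₀ (s¹ μ) (s¹ δ)))
      (all∈ᶠ μ (notᶠ (exᶠ (cofinalMapᶠ ν₀ ν₁ (s² δ))))))

    uncountableCofinalityᶠ : Γ → Fm Γ
    uncountableCofinalityᶠ γ =
      exᶠ (exᶠ (andᶠ (isCofinalityᶠ (s² γ) ν₁) (andᶠ (omegaᶠ ν₀) (memᶠ ν₀ ν₁))))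

    clubᶠ C δ = andᶠ (subᶠ C δ) (andᶠ (unboundedᶠ C δ)
      (all∈ᶠ δ (impᶠ (limitᶠ ν₀) (impᶠ (unboundedᶠ (s¹ C) ν₀) (memᶠ ν₀ (s¹ C))))))
    stationaryᶠ T δ = allᶠ (impᶠ (clubᶠ ν₀ (s¹ δ)) (ex∈ᶠ ν₀ (memᶠ ν₀ (s² T))))
    reflectsᶠ T γ = andᶠ (uncountableCofinalityᶠ γ) (stationaryᶠ T γ)

    stationarySubsetᶠ : Γ → Γ → Γ → Fm Γ
    stationarySubsetᶠ Λ S T = andᶠ (subᶠ T S) (stationaryᶠ T Λ)

  -- Ordinals and cofinalities of V, stated outside the formal language

  infix 4 _≤V_
  _≤V_ : V → V → Set
  x ≤V y = x ∊ y ⊎ x ≋ y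

  TransV OrdV LimV OmegaV : V → Set₁
  TransV x = ∀ y z → y ∊ x → z ∊ y → z ∊ x
  OrdV x = TransV x × (∀ y → y ∊ x → TransV y)
  LimV x = OrdV x × (Σ[ y ∈ V ] y ∊ x) × (∀ y → y ∊ x → Σ[ z ∈ V ] (z ∊ x) × (y ∊ z))
  OmegaV w = LimV w × (∀ n → n ∊ w → LimV n → ⊥)

  ord-elem : ∀ {x y} → OrdV x → y ∊ x → OrdV y
  ord-elem {x} {y} (t , t′) y∊x = t′ y y∊x , λ z z∊y → t′ z (t y z y∊x z∊y)

  -- A function between index types that respects `_≋_`, in place of a function coded as a set: it
  -- is small, and excluded middle can define it point by point.
  Cof : V → V → Set
  Cof μ δ = Σ[ F ∈ (Ix μ → Ix δ) ]
    (∀ a a′ → el μ a ≋ el μ a′ → el δ (F a) ≋ el δ (F a′)) ×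
    (∀ b → Σ[ a ∈ Ix μ ] el δ b ≤V el δ (F a))

  CofV : V → V → Set₁
  CofV δ μ = OrdV μ × Cof μ δ × (∀ ν → ν ∊ μ → Cof ν δ → ⊥)

  ix-≋ : ∀ x y → x ≋ y → Ix x → Ix y
  ix-≋ (sup A f) (sup B g) (h , _) a = proj₁ (h a)

  el-ix-≋ : ∀ x y (e : x ≋ y) a → el x a ≋ el y (ix-≋ x y e a)
  el-ix-≋ (sup A f) (sup B g) (h , _) a = proj₂ (h a)

  ≤V-cong : ∀ {x x′ y y′} → x ≋ x′ → y ≋ y′ → x ≤V y → x′ ≤V y′
  ≤V-cong {y = y} {y′} e e′ (inj₁ m) = inj₁ (∊-congʳ y y′ e′ (∊-congˡ y e m))
  ≤V-cong {x} {x′} {y} {y′} e e′ (inj₂ k) = inj₂ (≋-trans x′ y y′ (≋-trans x′ x y (≋-sym x x′ e) k) e′)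

  cof-cong : ∀ {μ μ′ δ δ′} → μ ≋ μ′ → δ ≋ δ′ → Cof μ δ → Cof μ′ δ′
  cof-cong {μ} {μ′} {δ} {δ′} e d (F , resp , cof) =
    F′ ,
    (λ a a′ k → ≋-trans _ _ _ (≋-sym _ _ (elF a)) (≋-trans _ _ _
       (resp (back a) (back a′) (≋-trans _ _ _ (≋-sym _ _ (elB a)) (≋-trans _ _ _ k (elB a′)))) (elF a′))) ,
    (λ b → let b₀ = ix-≋ δ′ δ d′ b ; (a , le) = cof b₀ in
       ix-≋ μ μ′ e a , ≤V-cong (≋-sym _ _ (el-ix-≋ δ′ δ d′ b))
         (≋-trans _ _ _ (resp a _ (≋-trans _ _ _ (el-ix-≋ μ μ′ e a) (elB _))) (elF _)) le)
    where
    e′ = ≋-sym μ μ′ e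
    d′ = ≋-sym δ δ′ d
    back = ix-≋ μ′ μ e′
    elB = el-ix-≋ μ′ μ e′
    F′ = λ a → ix-≋ δ δ′ d (F (back a))
    elF = λ a → el-ix-≋ δ δ′ d (F (back a))

  trans-cong : ∀ {x x′} → x ≋ x′ → TransV x → TransV x′
  trans-cong {x} {x′} e t y z m m′ = ∊-congʳ x x′ e (t y z (∊-congʳ x′ x (≋-sym x x′ e) m) m′)

  ord-cong : ∀ {x x′} → x ≋ x′ → OrdV x → OrdV x′
  ord-cong {x} {x′} e (t , h) = trans-cong e t , λ y m → h y (∊-congʳ x′ x (≋-sym x x′ e) m)

  cofV-cong : ∀ {δ μ μ′} → μ ≋ μ′ → CofV δ μ → CofV δ μ′
  cofV-cong {δ} {μ} {μ′} e (o , c , m) =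
    ord-cong e o , cof-cong e (≋-refl δ) c , λ ν ν∊μ′ → m ν (∊-congʳ μ′ μ (≋-sym μ μ′ e) ν∊μ′)

  -- Structural descent: excluded middle either finds an element of x satisfying Φ, where the search
  -- goes on, or shows x itself to be minimal.
  ∊-minimal : (Φ : V → Set₁) → (∀ {x y} → x ≋ y → Φ x → Φ y) → ∀ x → Φ x →
              Σ[ y ∈ V ] Φ y × (∀ z → z ∊ y → Φ z → ⊥)
  ∊-minimal Φ resp (sup A f) h with em {P = Σ[ a ∈ A ] Φ (f a)}
  ... | yes (a , k) = ∊-minimal Φ resp (f a) k
  ... | no k = sup A f , h , λ { z (a , e) φ → k (a , resp e φ) }

  cofinality-exists : ∀ {δ} → OrdV δ → Σ[ μ ∈ V ] CofV δ μ
  cofinality-exists {δ} o =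
    let (μ , (oμ , c) , m) = ∊-minimal (λ μ → OrdV μ × Cof μ δ)
          (λ { e (o , c) → ord-cong e o , cof-cong e (≋-refl δ) c })
          δ (o , (λ a → a) , (λ _ _ e → e) , λ b → b , inj₂ (≋-refl _))
    in μ , oμ , c , λ ν ν∊μ c′ → m ν ν∊μ (ord-elem oμ ν∊μ , c′)

  -- Set theory inside a model

  module Theory (M : Model) where
    open Model M public

    private variable
      ℓ ℓ′ : Level
      p q r : W
      x x′ y y′ z : X
      D : W → Set ℓ
      E : W → Set ℓ′

    now : Dense p D → Σ[ r ∈ W ] r ⊑ p × D r
    now d = d _ ⊑-refl

    here : Mono D → D p → Dense p D
    here m d q q⊑p = q , ⊑-refl , m q⊑p d

    dense-mono : Mono (λ p → Dense p D)
    dense-mono q⊑p d r r⊑q = d r (⊑-trans r⊑q q⊑p)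

    bind : Dense p D → (∀ {r} → r ⊑ p → D r → Dense r E) → Dense p E
    bind d f q q⊑p =
      let (r , r⊑q , x) = d q q⊑p ; (s , s⊑r , y) = now (f (⊑-trans r⊑q q⊑p) x) in
      s , ⊑-trans s⊑r r⊑q , y

    dmap : Dense p D → (∀ {r} → r ⊑ p → D r → E r) → Dense p E
    dmap d f q q⊑p = let (r , r⊑q , x) = d q q⊑p in r , r⊑q , f (⊑-trans r⊑q q⊑p) x

    sat-mono : ∀ φ → Mono (Sat φ)
    sat-mono (x ∈ y) q⊑p (lift h) = lift (mem-mono q⊑p h)
    sat-mono (x ≐ y) q⊑p (lift h) = lift (eq-mono q⊑p h)
    sat-mono (φ ∧ ψ) q⊑p (h , k) = sat-mono φ q⊑p h , sat-mono ψ q⊑p k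
    sat-mono (φ ∨ ψ) q⊑p h = dense-mono q⊑p h
    sat-mono (φ ⇒ ψ) q⊑p h r r⊑q = h r (⊑-trans r⊑q q⊑p)
    sat-mono (all φ) q⊑p h x = sat-mono (φ x) q⊑p (h x)
    sat-mono (ex φ) q⊑p h = dense-mono q⊑p h

    -- Atoms are local by the axioms of `Model`, disjunction and existence because they are defined
    -- densely. Through `sat-by`, witnesses may therefore be decided at stronger worlds.
    sat-dense : ∀ φ → Dense p (Sat φ) → Sat φ p
    sat-dense (x ∈ y) d = lift (mem-dense (dmap d λ _ → lower))
    sat-dense (x ≐ y) d = lift (eq-dense (dmap d λ _ → lower))
    sat-dense false d = proj₂ (proj₂ (now d))
    sat-dense (φ ∧ ψ) d = sat-dense φ (dmap d λ _ → proj₁) , sat-dense ψ (dmap d λ _ → proj₂)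
    sat-dense (φ ∨ ψ) d = bind d λ _ h → h
    sat-dense (φ ⇒ ψ) d q q⊑p h =
      sat-dense ψ λ r r⊑q → let (s , s⊑r , k) = d r (⊑-trans r⊑q q⊑p) in
        s , s⊑r , k s ⊑-refl (sat-mono φ (⊑-trans s⊑r r⊑q) h)
    sat-dense (all φ) d x = sat-dense (φ x) (dmap d λ _ h → h x)
    sat-dense (ex φ) d = bind d λ _ h → h

    sat-by : ∀ φ → Dense p D → (∀ {r} → r ⊑ p → D r → Sat φ r) → Sat φ p
    sat-by φ d f = sat-dense φ (dmap d f)

    mem-by : Dense p D → (∀ {r} → r ⊑ p → D r → Mem x y r) → Mem x y p
    mem-by d f = mem-dense (dmap d f)

    eq-by : Dense p D → (∀ {r} → r ⊑ p → D r → Eq x y r) → Eq x y p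
    eq-by d f = eq-dense (dmap d f)

    ⊥-by : Dense p D → (∀ {r} → r ⊑ p → D r → ⊥) → ⊥
    ⊥-by d f = let (_ , r⊑p , x) = now d in f r⊑p x

    sat-cong : ∀ {Γ} (φ : Fm Γ) {ρ σ : Γ → X} → (∀ v → Eq (ρ v) (σ v) p) →
               Sat (⟦ φ ⟧ ρ) p → Sat (⟦ φ ⟧ σ) p
    sat-cong (memᶠ u v) e (lift h) = lift (mem-cong (e u) (e v) h)
    sat-cong (eqᶠ u v) e (lift h) = lift (eq-trans (eq-sym (e u)) (eq-trans h (e v)))
    sat-cong (andᶠ φ ψ) e (h , k) = sat-cong φ e h , sat-cong ψ e k
    sat-cong (orᶠ φ ψ) e h = dmap h λ where
      r⊑p (inj₁ k) → inj₁ (sat-cong φ (λ v → eq-mono r⊑p (e v)) k)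
      r⊑p (inj₂ k) → inj₂ (sat-cong ψ (λ v → eq-mono r⊑p (e v)) k)
    sat-cong (impᶠ φ ψ) e h q q⊑p k =
      sat-cong ψ (λ v → eq-mono q⊑p (e v)) (h q q⊑p (sat-cong φ (λ v → eq-sym (eq-mono q⊑p (e v))) k))
    sat-cong (allᶠ φ) {ρ} {σ} e h x =
      sat-cong φ {ρ ▸ x} {σ ▸ x} (λ { nothing → eq-refl ; (just v) → e v }) (h x)
    sat-cong (exᶠ φ) {ρ} {σ} e h = dmap h λ { r⊑p (x , k) → x ,
      sat-cong φ {ρ ▸ x} {σ ▸ x} (λ { nothing → eq-refl ; (just v) → eq-mono r⊑p (e v) }) k }

    two : X → X → Bool → X
    two x y b = if b then x else y

    two-eq : Eq x x′ p → Eq y y′ p → ∀ b → Eq (two x y b) (two x′ y′ b) p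
    two-eq e e′ true = e
    two-eq e e′ ffalse = e′

    -- Kuratowski pairs

    pr : X → X → X
    pr x y = mk Bool (two x y) (λ _ _ → ⊤)

    pr-elim : Mem z (pr x y) p → Dense p (λ r → Eq z x r ⊎ Eq z y r)
    pr-elim m = dmap (mk-elim (λ _ _ _ → tt) m) λ where
      _ (true , _ , e) → inj₁ e
      _ (ffalse , _ , e) → inj₂ e

    pr-introˡ : Eq z x p → Mem z (pr x y) p
    pr-introˡ e = mk-intro λ q q⊑p → q , ⊑-refl , true , tt , eq-mono q⊑p e

    pr-introʳ : Eq z y p → Mem z (pr x y) p
    pr-introʳ e = mk-intro λ q q⊑p → q , ⊑-refl , ffalse , tt , eq-mono q⊑p e

    pr-intro : Dense p (λ r → Eq z x r ⊎ Eq z y r) → Mem z (pr x y) p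
    pr-intro d = mem-by d λ _ → [ pr-introˡ , pr-introʳ ]′

    isPair⇒eq : Sat (IsPair z x y) p → Eq z (pr x y) p
    isPair⇒eq h = extensionality
      (λ w {q} q⊑p m → pr-intro (dmap (proj₁ (h w) q q⊑p (lift m)) λ where
         _ (inj₁ (lift e)) → inj₁ e
         _ (inj₂ (lift e)) → inj₂ e))
      (λ w {q} q⊑p m → lower (proj₂ (h w) q q⊑p (dmap (pr-elim m) λ where
         _ (inj₁ e) → inj₁ (lift e)
         _ (inj₂ e) → inj₂ (lift e))))

    eq⇒isPair : Eq z (pr x y) p → Sat (IsPair z x y) p
    eq⇒isPair e w =
      (λ q q⊑p (lift m) → dmap (pr-elim (mem-cong eq-refl (eq-mono q⊑p e) m)) λ where
         _ (inj₁ e) → inj₁ (lift e)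
         _ (inj₂ e) → inj₂ (lift e)) ,
      (λ q q⊑p d → lift (mem-cong eq-refl (eq-sym (eq-mono q⊑p e)) (pr-intro (dmap d λ where
         _ (inj₁ (lift e)) → inj₁ e
         _ (inj₂ (lift e)) → inj₂ e))))

    pr-cong : Eq x x′ p → Eq y y′ p → Eq (pr x y) (pr x′ y′) p
    pr-cong e e′ = extensionality
      (λ w q⊑p m → mem-by (pr-elim m) λ where
        r⊑q (inj₁ k) → pr-introˡ (eq-trans k (eq-mono (⊑-trans r⊑q q⊑p) e))
        r⊑q (inj₂ k) → pr-introʳ (eq-trans k (eq-mono (⊑-trans r⊑q q⊑p) e′)))
      (λ w q⊑p m → mem-by (pr-elim m) λ where
        r⊑q (inj₁ k) → pr-introˡ (eq-trans k (eq-sym (eq-mono (⊑-trans r⊑q q⊑p) e)))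
        r⊑q (inj₂ k) → pr-introʳ (eq-trans k (eq-sym (eq-mono (⊑-trans r⊑q q⊑p) e′))))

    opair : X → X → X
    opair x y = pr (pr x x) (pr x y)

    opair-cong : Eq x x′ p → Eq y y′ p → Eq (opair x y) (opair x′ y′) p
    opair-cong e e′ = pr-cong (pr-cong e e) (pr-cong e e′)

    pr-member : Eq (pr x y) (pr x′ y′) p → Dense p (λ r → Eq x x′ r ⊎ Eq x y′ r)
    pr-member e = pr-elim (mem-cong eq-refl e (pr-introˡ eq-refl))

    pr-memberʳ : Eq (pr x y) (pr x′ y′) p → Dense p (λ r → Eq y x′ r ⊎ Eq y y′ r)
    pr-memberʳ e = pr-elim (mem-cong eq-refl e (pr-introʳ eq-refl))

    opair-injˡ : Eq (opair x y) (opair x′ y′) p → Eq x x′ p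
    opair-injˡ e = eq-by (bind (pr-member e) λ where
        _ (inj₁ k) → pr-member (eq-sym k)
        _ (inj₂ k) → pr-member (eq-sym k)) λ where
      _ (inj₁ k) → eq-sym k
      _ (inj₂ k) → eq-sym k

    opair-injʳ : Eq (opair x y) (opair x′ y′) p → Eq y y′ p
    opair-injʳ {x} {y} {x′} {y′} e = eq-by (bind (pr-memberʳ e) λ where
        r⊑p (inj₁ k) → bind (pr-memberʳ k) λ s⊑r h → main s⊑r r⊑p ([ (λ u → u) , (λ u → u) ]′ h)
        r⊑p (inj₂ k) → bind (pr-memberʳ k) λ where
          s⊑r (inj₁ h) → main s⊑r r⊑p h
          s⊑r (inj₂ h) → here eq-mono h)
      λ _ h → h
      where
      e₁ = opair-injˡ e
      -- The degenerate case y = x′. As x = x′, also y = x, so y′, which equals x or y, equals y in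
      -- either case.
      main : ∀ {r s} → s ⊑ r → r ⊑ _ → Eq y x′ s → Dense s (Eq y y′)
      main {s = s} s⊑r r⊑p h = bind (pr-memberʳ (eq-sym (eq-mono s⊑p e))) λ where
          t⊑s (inj₁ k) → dmap (pr-memberʳ k) λ where
            u⊑t (inj₁ g) → eq-trans (eq-mono (⊑-trans u⊑t t⊑s) y≐x) (eq-sym g)
            u⊑t (inj₂ g) → eq-trans (eq-mono (⊑-trans u⊑t t⊑s) y≐x) (eq-sym g)
          t⊑s (inj₂ k) → dmap (pr-memberʳ k) λ where
            u⊑t (inj₁ g) → eq-trans (eq-mono (⊑-trans u⊑t t⊑s) y≐x) (eq-sym g)
            u⊑t (inj₂ g) → eq-sym g
        where
        s⊑p = ⊑-trans s⊑r r⊑p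
        y≐x : Eq y x s
        y≐x = eq-trans h (eq-sym (eq-mono s⊑p e₁))

    isOrderedPair⇒eq : Sat (IsOrderedPair z x y) p → Eq z (opair x y) p
    isOrderedPair⇒eq h = eq-dense (bind h λ { _ (a , k) → dmap k λ { _ (b , u , v , w) →
      eq-trans (isPair⇒eq w) (pr-cong (isPair⇒eq u) (isPair⇒eq v)) } })

    eq⇒isOrderedPair : Eq z (opair x y) p → Sat (IsOrderedPair z x y) p
    eq⇒isOrderedPair {x = x} {y} e q q⊑p = q , ⊑-refl , pr x x , λ r r⊑q → r , ⊑-refl , pr x y ,
      eq⇒isPair eq-refl , eq⇒isPair eq-refl , eq⇒isPair (eq-mono (⊑-trans r⊑q q⊑p) e)

    Map : X → X → X → W → Set
    Map f x y = Mem (opair x y) f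

    maps⇒ : ∀ {f} → Sat (Maps f x y) p → Map f x y p
    maps⇒ h = mem-by h λ { _ (z , lift m , k) → mem-cong (isOrderedPair⇒eq k) eq-refl m }

    ⇒maps : ∀ {f} → Map f x y p → Sat (Maps f x y) p
    ⇒maps {x} {y} m q q⊑p = q , ⊑-refl , opair x y , lift (mem-mono q⊑p m) , eq⇒isOrderedPair eq-refl

    map-cong : ∀ {f} → Eq x x′ p → Eq y y′ p → Map f x y p → Map f x′ y′ p
    map-cong e e′ = mem-cong (opair-cong e e′) eq-refl

    module _ {f A : X} (h : Sat (FunctionOn f A) p) where
      fun-total : q ⊑ p → Mem x A q → Dense q (λ r → Σ[ y ∈ X ] Map f x y r)
      fun-total q⊑p m = dmap (proj₁ (proj₂ h) _ _ q⊑p (lift m)) λ { _ (y , k) → y , maps⇒ k }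

      fun-single : q ⊑ p → Map f x y q → Map f x y′ q → Eq y y′ q
      fun-single q⊑p m m′ =
        lower (proj₂ (proj₂ h) _ _ _ _ q⊑p (⇒maps m) _ ⊑-refl (⇒maps m′))

    graph : (A : Set) → (A → X) → (A → X) → (A → W → Set) → X
    graph A a b = mk A (λ i → opair (a i) (b i))

    module _ {A : Set} {a b : A → X} {N : A → W → Set} (N-mono : ∀ i → Mono (N i)) where
      graph-elim : Map (graph A a b N) x y p →
                   Dense p (λ r → Σ[ i ∈ A ] N i r × Eq x (a i) r × Eq y (b i) r)
      graph-elim m = dmap (mk-elim N-mono m) λ { _ (i , n , e) → i , n , opair-injˡ e , opair-injʳ e }

      graph-intro : ∀ i → N i p → Map (graph A a b N) (a i) (b i) p
      graph-intro i n = mk-intro λ q q⊑p → q , ⊑-refl , i , N-mono i q⊑p n , eq-refl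

      graph-functionOn : ∀ {B} →
        (∀ {z q} → q ⊑ p → Mem z B q → Dense q (λ r → Σ[ i ∈ A ] N i r × Eq z (a i) r)) →
        (∀ {i q} → q ⊑ p → N i q → Mem (a i) B q) →
        (∀ {i j q} → q ⊑ p → N i q → N j q → Eq (a i) (a j) q → Eq (b i) (b j) q) →
        Sat (FunctionOn (graph A a b N) B) p
      graph-functionOn {B = B} dom-elim dom-intro single =
        (λ z q q⊑p (lift m) → dmap (mk-elim N-mono m) λ { r⊑q (i , n , e) →
           a i , lift (dom-intro (⊑-trans r⊑q q⊑p) n) , λ s s⊑r → s , ⊑-refl , b i , eq⇒isOrderedPair (eq-mono s⊑r e) }) ,
        (λ x q q⊑p (lift m) → dmap (dom-elim q⊑p m) λ { r⊑q (i , n , e) →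
           b i , ⇒maps (map-cong (eq-sym e) eq-refl (graph-intro i n)) }) ,
        (λ x y y′ q q⊑p m r r⊑q m′ → lift (eq-dense
          (bind (graph-elim (mem-mono r⊑q (maps⇒ m))) λ { s⊑r (i , n , e , k) →
           dmap (graph-elim (mem-mono s⊑r (maps⇒ m′))) λ { t⊑s (j , n′ , e′ , k′) →
             eq-trans (eq-mono t⊑s k) (eq-trans
               (single (⊑-trans t⊑s (⊑-trans s⊑r (⊑-trans r⊑q q⊑p))) (N-mono i t⊑s n) n′
                 (eq-trans (eq-sym (eq-mono t⊑s e)) e′))
               (eq-sym k′)) } })))

    -- Ordinals

    Tr Ord : X → W → Set₁
    Tr x p = ∀ {y z q} → q ⊑ p → Mem y x q → Mem z y q → Mem z x q
    Ord x p = Tr x p × (∀ {y q} → q ⊑ p → Mem y x q → Tr y q)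

    transitive⇒ : Sat (Transitive x) p → Tr x p
    transitive⇒ h q⊑p m m′ = lower (h _ _ q⊑p (lift m) _ _ ⊑-refl (lift m′))

    ⇒transitive : Tr x p → Sat (Transitive x) p
    ⇒transitive t y q q⊑p (lift m) z r r⊑q (lift m′) = lift (t (⊑-trans r⊑q q⊑p) (mem-mono r⊑q m) m′)

    ordinal⇒ : Sat (Ordinal x) p → Ord x p
    ordinal⇒ (t , h) = transitive⇒ t , λ q⊑p m → transitive⇒ (h _ _ q⊑p (lift m))

    ⇒ordinal : Ord x p → Sat (Ordinal x) p
    ⇒ordinal (t , h) = ⇒transitive t , λ y q q⊑p (lift m) → ⇒transitive (h q⊑p m)

    ord-mono : Mono (Ord x)
    ord-mono q⊑p (t , h) = (λ r⊑q → t (⊑-trans r⊑q q⊑p)) , λ r⊑q → h (⊑-trans r⊑q q⊑p)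

    ord-mem : Ord x p → Mem y x p → Ord y p
    ord-mem (t , h) m = h ⊑-refl m , λ q⊑p m′ → h q⊑p (t q⊑p (mem-mono q⊑p m) m′)

    -- If x ∈ x, then some constituent y of x equals x at a stronger world, hence y ∈ y there,
    -- against the induction hypothesis at y.
    mem-irrefl : Mem x x p → ⊥
    mem-irrefl {x} = lower (◂-ind (λ x → Lift (lsuc 0ℓ) (∀ {p} → Mem x x p → ⊥))
      (λ x ih → lift λ m → ⊥-by (mem⇒◂ m) λ { r⊑p (y , y◂x , e) →
         lower (ih y y◂x) (mem-cong e e (mem-mono r⊑p m)) }) x)

    Tri : X → X → W → Set
    Tri x y r = Mem x y r ⊎ Eq x y r ⊎ Mem y x r

    -- Double induction on constituents. Excluded middle asks for a stronger world at which x has a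
    -- member equal to y or above it, or the same with x and y exchanged. If there is none, the
    -- induction hypotheses make x and y have the same members.
    trichotomy : Ord x p → Ord y p → Dense p (Tri x y)
    trichotomy {x} {y = y} = ◂-ind (λ x → ∀ {y p} → Ord x p → Ord y p → Dense p (Tri x y))
      (λ x ihx {y} → ◂-ind (λ y → ∀ {p} → Ord x p → Ord y p → Dense p (Tri x y))
        (λ y ihy {p} ox oy q q⊑p → step x ihx y ihy ox oy q⊑p) y) x
      where
      step : ∀ x → (∀ x′ → x′ ◂ x → ∀ {y p} → Ord x′ p → Ord y p → Dense p (Tri x′ y)) →
             ∀ y → (∀ y′ → y′ ◂ y → ∀ {p} → Ord x p → Ord y′ p → Dense p (Tri x y′)) →
             Ord x p → Ord y p → q ⊑ p → Σ[ r ∈ W ] r ⊑ q × Tri x y r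
      step {q = q} x ihx y ihy ox oy q⊑p
        with em {P = Σ[ r ∈ W ] r ⊑ q × Σ[ x′ ∈ X ] Mem x′ x r × (Mem y x′ r ⊎ Eq y x′ r)}
      ... | yes (r , r⊑q , x′ , m , inj₁ k) = r , r⊑q , inj₂ (inj₂ (proj₁ ox (⊑-trans r⊑q q⊑p) m k))
      ... | yes (r , r⊑q , x′ , m , inj₂ k) = r , r⊑q , inj₂ (inj₂ (mem-cong (eq-sym k) eq-refl m))
      ... | no ¬x with em {P = Σ[ r ∈ W ] r ⊑ q × Σ[ y′ ∈ X ] Mem y′ y r × (Mem x y′ r ⊎ Eq x y′ r)}
      ...   | yes (r , r⊑q , y′ , m , inj₁ k) = r , r⊑q , inj₁ (proj₁ oy (⊑-trans r⊑q q⊑p) m k)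
      ...   | yes (r , r⊑q , y′ , m , inj₂ k) = r , r⊑q , inj₁ (mem-cong (eq-sym k) eq-refl m)
      ...   | no ¬y = q , ⊑-refl , inj₂ (inj₁ (extensionality
        (λ z {r} r⊑q m → mem-dense (bind (mem⇒◂ m) λ { {s} s⊑r (x′ , x′◂x , e) →
          let m′ = mem-cong e eq-refl (mem-mono s⊑r m)
              s⊑p = ⊑-trans s⊑r (⊑-trans r⊑q q⊑p) in
          dmap (ihx x′ x′◂x (ord-mem (ord-mono s⊑p ox) m′) (ord-mono s⊑p oy)) λ where
            t⊑s (inj₁ k) → mem-cong (eq-sym (eq-mono t⊑s e)) eq-refl k
            t⊑s (inj₂ (inj₁ k)) → ⊥-elim (¬x (_ , ⊑-trans t⊑s (⊑-trans s⊑r r⊑q) , x′ , mem-mono t⊑s m′ , inj₂ (eq-sym k)))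
            t⊑s (inj₂ (inj₂ k)) → ⊥-elim (¬x (_ , ⊑-trans t⊑s (⊑-trans s⊑r r⊑q) , x′ , mem-mono t⊑s m′ , inj₁ k)) }))
        (λ z {r} r⊑q m → mem-dense (bind (mem⇒◂ m) λ { {s} s⊑r (y′ , y′◂y , e) →
          let m′ = mem-cong e eq-refl (mem-mono s⊑r m)
              s⊑p = ⊑-trans s⊑r (⊑-trans r⊑q q⊑p) in
          dmap (ihy y′ y′◂y (ord-mono s⊑p ox) (ord-mem (ord-mono s⊑p oy) m′)) λ where
            t⊑s (inj₂ (inj₂ k)) → mem-cong (eq-sym (eq-mono t⊑s e)) eq-refl k
            t⊑s (inj₂ (inj₁ k)) → ⊥-elim (¬y (_ , ⊑-trans t⊑s (⊑-trans s⊑r r⊑q) , y′ , mem-mono t⊑s m′ , inj₂ k))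
            t⊑s (inj₁ k) → ⊥-elim (¬y (_ , ⊑-trans t⊑s (⊑-trans s⊑r r⊑q) , y′ , mem-mono t⊑s m′ , inj₁ k)) }))))

    -- Absoluteness for checked ground-model sets

    chk-el : ∀ u (a : Ix u) → Mem (chk (el u a)) (chk u) p
    chk-el u a = chk-intro u λ q q⊑p → q , ⊑-refl , a , eq-refl

    chk-eq : ∀ u v → u ≋ v → Eq (chk u) (chk v) p
    chk-eq (sup A f) (sup B g) (h , k) = extensionality
      (λ z q⊑p m → mem-by (chk-elim (sup A f) m) λ { _ (a , e) → let (b , e′) = h a in
         mem-cong (eq-sym (eq-trans e (chk-eq (f a) (g b) e′))) eq-refl (chk-el (sup B g) b) })
      (λ z q⊑p m → mem-by (chk-elim (sup B g) m) λ { _ (b , e) → let (a , e′) = k b in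
         mem-cong (eq-sym (eq-trans e (eq-sym (chk-eq (f a) (g b) e′)))) eq-refl (chk-el (sup A f) a) })

    chk-mem : ∀ {u} v → u ∊ v → Mem (chk u) (chk v) p
    chk-mem {u = u} v m = let (a , e) = ∊⇒ix v m in
      mem-cong (eq-sym (chk-eq u (el v a) e)) eq-refl (chk-el v a)

    -- A witness found at any stronger world is a statement about V, so a single world suffices.
    chk-eq⁻¹ : ∀ u v → Eq (chk u) (chk v) p → u ≋ v
    chk-eq⁻¹ (sup A f) (sup B g) e =
      (λ a → let (_ , _ , b , e′) = now (chk-elim (sup B g) (mem-cong eq-refl e (chk-el (sup A f) a))) in
         b , chk-eq⁻¹ (f a) (g b) e′) ,
      (λ b → let (_ , _ , a , e′) = now (chk-elim (sup A f) (mem-cong eq-refl (eq-sym e) (chk-el (sup B g) b))) in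
         a , chk-eq⁻¹ (f a) (g b) (eq-sym e′))

    chk-mem⁻¹ : ∀ {u} v → Mem (chk u) (chk v) p → u ∊ v
    chk-mem⁻¹ {u = u} v m = let (_ , _ , a , e) = now (chk-elim v m) in
      ix⇒∊ v a (chk-eq⁻¹ u (el v a) e)

    chk-elim′ : ∀ v → Mem z (chk v) p → Dense p (λ r → Σ[ u ∈ V ] (u ∊ v) × Eq z (chk u) r)
    chk-elim′ v m = dmap (chk-elim v m) λ { _ (a , e) → el v a , el∊ v a , e }

    tr-chk : ∀ v → TransV v → Tr (chk v) p
    tr-chk v t q⊑p m m′ = mem-dense (bind (chk-elim′ v m) λ { r⊑q (u , u∊v , e) →
      dmap (chk-elim′ u (mem-cong eq-refl e (mem-mono r⊑q m′))) λ { _ (w , w∊u , e′) →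
        mem-cong (eq-sym e′) eq-refl (chk-mem v (t u w u∊v w∊u)) } })

    tr-cong : Eq x y p → Tr y p → Tr x p
    tr-cong e t q⊑p m m′ = mem-cong eq-refl (eq-sym (eq-mono q⊑p e))
      (t q⊑p (mem-cong eq-refl (eq-mono q⊑p e) m) m′)

    ord-chk : ∀ v → OrdV v → Ord (chk v) p
    ord-chk v (t , h) = tr-chk v t , λ q⊑p m r⊑q n n′ →
      mem-dense (dmap (chk-elim′ v (mem-mono r⊑q m)) λ { s⊑r (u , u∊v , e) →
        tr-cong e (tr-chk u (h u u∊v)) ⊑-refl (mem-mono s⊑r n) (mem-mono s⊑r n′) })

    ord-chk⁻¹ : ∀ v → Ord (chk v) p → OrdV v
    ord-chk⁻¹ v (t , h) =
      (λ y z m m′ → chk-mem⁻¹ v (t ⊑-refl (chk-mem v m) (chk-mem y m′))) ,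
      (λ y m z w m′ m″ → chk-mem⁻¹ y (h ⊑-refl (chk-mem v m) ⊑-refl (chk-mem y m′) (chk-mem z m″)))

    limit-chk : ∀ v → LimV v → Sat (Limit (chk v)) p
    limit-chk v (o , (u , u∊v) , h) = ⇒ordinal (ord-chk v o) ,
      (λ q _ k → k (chk u) q ⊑-refl (lift (chk-mem v u∊v))) ,
      (λ y q q⊑p (lift m) → dmap (chk-elim′ v m) λ { _ (w , w∊v , e) →
         let (w′ , w′∊v , w∊w′) = h w w∊v in
         chk w′ , lift (chk-mem v w′∊v) , lift (mem-cong (eq-sym e) eq-refl (chk-mem w′ w∊w′)) })

    limit-chk⁻¹ : ∀ v → Sat (Limit (chk v)) p → LimV v
    limit-chk⁻¹ v (o , n , h) = ord-chk⁻¹ v (ordinal⇒ o) , nonempty ,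
      (λ y y∊v → let (_ , _ , z , lift m , lift m′) = now (h (chk y) _ ⊑-refl (lift (chk-mem v y∊v)))
                     (_ , s⊑r , u , u∊v , e) = now (chk-elim′ v m) in
                 u , u∊v , chk-mem⁻¹ u (mem-cong eq-refl e (mem-mono s⊑r m′)))
      where
      nonempty : Σ[ y ∈ V ] y ∊ v
      nonempty with em {P = Σ[ y ∈ V ] y ∊ v}
      ... | yes k = k
      ... | no k = ⊥-elim (lower (n _ ⊑-refl λ z q _ (lift m) →
        ⊥-elim (⊥-by (chk-elim′ v m) λ { _ (u , u∊v , _) → k (u , u∊v) })))

    limit-cong : Eq x y p → Sat (Limit x) p → Sat (Limit y) p
    limit-cong e = sat-cong (limitᶠ tt) (λ _ → e)

    omega-chk : ∀ w → OmegaV w → Sat (IsOmega (chk w)) p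
    omega-chk w (l , h) = limit-chk w l , λ n q q⊑p (lift m) r r⊑q k →
      ⊥-elim (⊥-by (chk-elim′ w m) λ { _ _ → ⊥-by (chk-elim′ w (mem-mono r⊑q m)) λ { s⊑r (u , u∊w , e) →
        h u u∊w (limit-chk⁻¹ u (limit-cong e (sat-mono (Limit n) s⊑r k))) } })

    omega-chk⁻¹ : ∀ w → Sat (IsOmega (chk w)) p → OmegaV w
    omega-chk⁻¹ w (l , h) = limit-chk⁻¹ w l , λ n n∊w k →
      lower (h (chk n) _ ⊑-refl (lift (chk-mem w n∊w)) _ ⊑-refl (limit-chk n k))

    omega-unique : Sat (IsOmega x) p → Sat (IsOmega y) p → Eq x y p
    omega-unique {x} {y = y} hx hy =
      eq-by (trichotomy (ordinal⇒ (proj₁ (proj₁ hx))) (ordinal⇒ (proj₁ (proj₁ hy)))) λ where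
        r⊑p (inj₂ (inj₁ e)) → e
        {r} r⊑p (inj₁ m) → ⊥-elim (lower (proj₂ hy x r r⊑p (lift m) r ⊑-refl (sat-mono (Limit x) r⊑p (proj₁ hx))))
        {r} r⊑p (inj₂ (inj₂ m)) → ⊥-elim (lower (proj₂ hx y r r⊑p (lift m) r ⊑-refl (sat-mono (Limit y) r⊑p (proj₁ hy))))

    -- Cofinality

    isCofinality-unique : ∀ {δ} → Sat (IsCofinality δ x) p → Sat (IsCofinality δ y) p → Eq x y p
    isCofinality-unique {x} {y = y} {δ} (ox , cx , mx) (oy , cy , my) =
      eq-by (trichotomy (ordinal⇒ ox) (ordinal⇒ oy)) λ where
        r⊑p (inj₂ (inj₁ e)) → e
        {r} r⊑p (inj₁ m) → ⊥-elim (lower (my x r r⊑p (lift m) r ⊑-refl (dense-mono r⊑p cx)))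
        {r} r⊑p (inj₂ (inj₂ m)) → ⊥-elim (lower (mx y r r⊑p (lift m) r ⊑-refl (dense-mono r⊑p cy)))

    le-chk : ∀ {u v} → u ≤V v → Sat (chk u ≤ₒ chk v) p
    le-chk {v = v} (inj₁ m) q _ = q , ⊑-refl , inj₁ (lift (chk-mem v m))
    le-chk {u = u} {v} (inj₂ e) q _ = q , ⊑-refl , inj₂ (lift (chk-eq u v e))

    le-chk⁻¹ : ∀ {u v} → Sat (chk u ≤ₒ chk v) p → u ≤V v
    le-chk⁻¹ {u = u} {v} h with now h
    ... | _ , _ , inj₁ (lift m) = inj₁ (chk-mem⁻¹ v m)
    ... | _ , _ , inj₂ (lift e) = inj₂ (chk-eq⁻¹ u v e)

    le-cong : Eq x x′ p → Eq y y′ p → Sat (x ≤ₒ y) p → Sat (x′ ≤ₒ y′) p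
    le-cong {x} {x′} {p} {y} {y′} e e′ =
      sat-cong (leᶠ true ffalse) {two x y} {two x′ y′} (two-eq e e′)

    fullN : ∀ {A : Set} → A → W → Set
    fullN _ _ = ⊤

    module CofGraph {μ δ : V} (c : Cof μ δ) where
      F = proj₁ c
      F̂ = graph (Ix μ) (λ a → chk (el μ a)) (λ a → chk (el δ (F a))) fullN

      F̂-maps : ∀ a → Map F̂ (chk (el μ a)) (chk (el δ (F a))) p
      F̂-maps a = graph-intro (λ _ _ _ → tt) a tt

      F̂-functionOn : Sat (FunctionOn F̂ (chk μ)) p
      F̂-functionOn = graph-functionOn (λ _ _ _ → tt)
        (λ _ m → dmap (chk-elim μ m) λ { _ (a , e) → a , tt , e })
        (λ {a} _ _ → chk-el μ a)
        (λ {a} {a′} _ _ _ e → chk-eq (el δ (F a)) (el δ (F a′))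
          (proj₁ (proj₂ c) a a′ (chk-eq⁻¹ (el μ a) (el μ a′) e)))

      F̂-cofinal : Sat (CofinalMap F̂ (chk μ) (chk δ)) p
      F̂-cofinal =
        (F̂-functionOn , λ x y q _ m → lift (mem-by (graph-elim (λ _ _ _ → tt) (maps⇒ m))
          λ { _ (a , _ , _ , e) → mem-cong (eq-sym e) eq-refl (chk-el δ (F a)) })) ,
        λ β q q⊑p (lift m) → dmap (chk-elim δ m) λ { _ (b , e) →
          let (a , le) = proj₂ (proj₂ c) b in
          chk (el μ a) , lift (chk-el μ a) , λ s s⊑r → s , ⊑-refl , chk (el δ (F a)) ,
          lift (chk-el δ (F a)) , ⇒maps (F̂-maps a) ,
          le-cong (eq-sym (eq-mono s⊑r e)) eq-refl (le-chk {v = el δ (F a)} le) }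

    module _ {f : X} {μ δ : V} (h : Sat (CofinalMap f (chk μ) (chk δ)) p) where
      cofinalMap-total : ∀ a → Dense p (λ r → Σ[ b ∈ Ix δ ] Map f (chk (el μ a)) (chk (el δ b)) r)
      cofinalMap-total a = bind (fun-total (proj₁ (proj₁ h)) ⊑-refl (chk-el μ a)) λ { r⊑p (y , m) →
        dmap (chk-elim δ (lower (proj₂ (proj₁ h) _ _ _ r⊑p (⇒maps m)))) λ { s⊑r (b , e) →
          b , map-cong eq-refl e (mem-mono s⊑r m) } }

      cofinalMap-single : ∀ {u v v′} → q ⊑ p → Map f u (chk v) q → Map f u (chk v′) q → v ≋ v′
      cofinalMap-single {v = v} {v′} q⊑p m m′ = chk-eq⁻¹ v v′ (fun-single (proj₁ (proj₁ h)) q⊑p m m′)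

      cofinalMap-cofinal : ∀ b → Dense p (λ r → Σ[ a ∈ Ix μ ] Σ[ c ∈ Ix δ ]
                             Map f (chk (el μ a)) (chk (el δ c)) r × el δ b ≤V el δ c)
      cofinalMap-cofinal b = bind (proj₂ h _ _ ⊑-refl (lift (chk-el δ b))) λ { _ (ξ , lift mξ , d) →
        bind d λ { s⊑r (η , lift mη , m , le) →
          bind (chk-elim μ (mem-mono s⊑r mξ)) λ { t⊑s (a , e) →
            dmap (chk-elim δ (mem-mono t⊑s mη)) λ { u⊑t (c , e′) →
              let u⊑s = ⊑-trans u⊑t t⊑s in
              a , c , map-cong (eq-mono u⊑t e) e′ (mem-mono u⊑s (maps⇒ m)) ,
              le-chk⁻¹ (le-cong eq-refl e′ (sat-mono (chk (el δ b) ≤ₒ η) u⊑s le)) } } } }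

      -- Only a map all of whose values are decided yields a map of V.
      cofinalMap-decided : (∀ a → Σ[ b ∈ Ix δ ] Map f (chk (el μ a)) (chk (el δ b)) p) → Cof μ δ
      cofinalMap-decided dec =
        (λ a → proj₁ (dec a)) ,
        (λ a a′ e → cofinalMap-single ⊑-refl
          (map-cong (chk-eq (el μ a) (el μ a′) e) eq-refl (proj₂ (dec a))) (proj₂ (dec a′))) ,
        (λ b → let (_ , r⊑p , a , c , m , le) = now (cofinalMap-cofinal b) in
          a , ≤V-cong (≋-refl _) (cofinalMap-single r⊑p m (mem-mono r⊑p (proj₂ (dec a)))) le)

    cofinalMap-cong : ∀ {f μ μ′ δ δ′} → Eq μ μ′ p → Eq δ δ′ p →
                      Sat (CofinalMap f μ δ) p → Sat (CofinalMap f μ′ δ′) p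
    cofinalMap-cong {f = f} {μ} {μ′} {δ} {δ′} e d =
      sat-cong (cofinalMapᶠ nothing (just true) (just ffalse)) {two μ δ ▸ f} {two μ′ δ′ ▸ f}
        λ { nothing → eq-refl ; (just v) → two-eq e d v }

    isCofinality-cong : ∀ {δ δ′ μ μ′} → Eq δ δ′ p → Eq μ μ′ p →
                        Sat (IsCofinality δ μ) p → Sat (IsCofinality δ′ μ′) p
    isCofinality-cong {δ = δ} {δ′} {μ} {μ′} e d =
      sat-cong (isCofinalityᶠ true ffalse) {two δ μ} {two δ′ μ′} (two-eq e d)

    -- Only the minimality clause of a cofinality can fail in an extension, since a cofinal map of V
    -- yields a name of a cofinal map. Hence this is all that `isCofinality-chk` asks of a model.
    Preserves : Set₁
    Preserves = ∀ {δ μ ν f p} → OrdV δ → CofV δ μ → ν ∊ μ →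
                Sat (CofinalMap f (chk ν) (chk δ)) p → ⊥

    module _ (preserves : Preserves) where
      isCofinality-chk : ∀ {δ μ} → OrdV δ → CofV δ μ → Sat (IsCofinality (chk δ) (chk μ)) p
      isCofinality-chk {δ = δ} {μ} o c@(oμ , c′ , _) =
        ⇒ordinal (ord-chk μ oμ) ,
        (λ q _ → q , ⊑-refl , F̂ , F̂-cofinal) ,
        λ n q q⊑p (lift m) r r⊑q h → ⊥-elim (⊥-by (chk-elim′ μ (mem-mono r⊑q m)) λ { s⊑r (ν , ν∊μ , e) →
          ⊥-by (dense-mono s⊑r h) λ { t⊑s (f , k) →
            preserves {δ} {μ} {ν} o c ν∊μ (cofinalMap-cong (eq-mono t⊑s e) eq-refl k) } })
        where open CofGraph {μ} {δ} c′

      isCofinality-chk⁻¹ : ∀ {δ w} → OrdV δ → Sat (IsCofinality (chk δ) (chk w)) p → CofV δ w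
      isCofinality-chk⁻¹ {δ = δ} {w} o h = let (μ , c) = cofinality-exists o in
        cofV-cong {δ} (chk-eq⁻¹ μ w (isCofinality-unique (isCofinality-chk o c) h)) c

      module _ {ω : V} (ω-omega : OmegaV ω) where
        uncountable-chk : ∀ {γ μ} → OrdV γ → CofV γ μ → ω ∊ μ → Sat (UncountableCofinality (chk γ)) p
        uncountable-chk {γ = γ} {μ} o c ω∊μ q _ = q , ⊑-refl , chk μ , λ r _ → r , ⊑-refl , chk ω ,
          isCofinality-chk o c , omega-chk ω ω-omega , lift (chk-mem μ ω∊μ)

        uncountable-chk⁻¹ : ∀ {γ} → OrdV γ → Sat (UncountableCofinality (chk γ)) p →
                            Σ[ μ ∈ V ] CofV γ μ × ω ∊ μ
        uncountable-chk⁻¹ {γ = γ} o h =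
          let (μ , c) = cofinality-exists o
              (_ , _ , m , d) = now h
              (_ , _ , w , hm , hw , lift w∈m) = now d
          in μ , c , chk-mem⁻¹ μ (mem-cong (omega-unique hw (omega-chk ω ω-omega))
                       (isCofinality-unique hm (isCofinality-chk o c)) w∈m)

        -- Cofinalities are unique in the model, so an ordinal of V that has cofinality ω there
        -- already has it in V; hence the check name of S still denotes the set of all such points.
        isSω-chk : ∀ {Λ S} → (∀ {x} → x ∊ S → x ∊ Λ × LimV x × CofV x ω) →
                   (∀ {x} → x ∊ Λ → LimV x → CofV x ω → x ∊ S) → Sat (IsSω (chk Λ) (chk S)) p
        isSω-chk {Λ = Λ} {S} S-elim S-intro x =
          (λ q _ (lift m) →
            (sat-by (x ∈ chk Λ) (chk-elim′ S m) λ { _ (ξ , ξ∊S , e) →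
              lift (mem-cong (eq-sym e) eq-refl (chk-mem Λ (proj₁ (S-elim ξ∊S)))) }) ,
            (sat-by (Limit x) (chk-elim′ S m) λ { _ (ξ , ξ∊S , e) →
              limit-cong (eq-sym e) (limit-chk ξ (proj₁ (proj₂ (S-elim ξ∊S)))) }) ,
            dmap (chk-elim′ S m) λ { _ (ξ , ξ∊S , e) → let (_ , l , c) = S-elim ξ∊S in
              chk ω , omega-chk ω ω-omega , isCofinality-cong (eq-sym e) eq-refl (isCofinality-chk (proj₁ l) c) }) ,
          (λ q _ (lift m , l , d) → lift (mem-dense (bind (chk-elim′ Λ m) λ { r⊑q (ξ , ξ∊Λ , e) →
            dmap (dense-mono r⊑q d) λ { s⊑r (w , hw , hc) →
              let e′ = eq-mono s⊑r e
                  lξ = limit-chk⁻¹ ξ (limit-cong e′ (sat-mono (Limit x) (⊑-trans s⊑r r⊑q) l)) in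
              mem-cong (eq-sym e′) eq-refl (chk-mem S (S-intro ξ∊Λ lξ
                (isCofinality-chk⁻¹ (proj₁ lξ)
                  (isCofinality-cong e′ (omega-unique hw (omega-chk ω ω-omega)) hc)))) } })))

  module VT = Theory VM

  V-preserves : VT.Preserves
  V-preserves {δ} {μ} {ν} o (_ , _ , m) ν∊μ h =
    m ν ν∊μ (VT.cofinalMap-decided {μ = ν} {δ} h λ a → proj₂ (proj₂ (VT.now {p = tt} (VT.cofinalMap-total {μ = ν} {δ} h a))))

  isCofinality⇒cofV : ∀ {δ μ} → OrdV δ → V⊨ IsCofinality δ μ → CofV δ μ
  isCofinality⇒cofV {δ} {μ} o h = VT.isCofinality-chk⁻¹ V-preserves o (V⊨⇒sat (IsCofinality δ μ) h)

  cofV⇒isCofinality : ∀ {δ μ} → OrdV δ → CofV δ μ → V⊨ IsCofinality δ μ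
  cofV⇒isCofinality {δ} {μ} o c = sat⇒V⊨ (IsCofinality δ μ) (VT.isCofinality-chk V-preserves o c)

  ordinal⇒ordV : ∀ {x} → V⊨ Ordinal x → OrdV x
  ordinal⇒ordV {x} h = VT.ord-chk⁻¹ {p = tt} x (VT.ordinal⇒ (V⊨⇒sat (Ordinal x) h))

  trichotomyV : ∀ {x y} → OrdV x → OrdV y → x ∊ y ⊎ x ≋ y ⊎ y ∊ x
  trichotomyV {x} {y} o o′ = proj₂ (proj₂ (VT.now (VT.trichotomy {p = tt} (VT.ord-chk x o) (VT.ord-chk y o′))))

  ∊-irrefl : ∀ {x} → x ∊ x → ⊥
  ∊-irrefl = VT.mem-irrefl {p = tt}

  -- The ordinals below Λ

  -- The ordinal Λ as a type L of canonical representatives, on which the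
  -- equality of V is propositional equality.

  module Initial (Λ : V) (Λ-ord : OrdV Λ) where

    private
      A = Ix Λ

      -- A class of equal indices is a Boolean function, so that function extensionality makes the
      -- classes of equal elements propositionally equal and `choose` returns the same
      -- representative for both.
      cls : A → A → Bool
      cls a b = does (em {P = el Λ a ≋ el Λ b})

      choose : (A → Bool) → A → A
      choose P a with em {P = Σ[ b ∈ A ] P b ≡ true}
      ... | yes (b , _) = b
      ... | no _ = a

      choose-spec : ∀ (P : A → Bool) a → P a ≡ true → P (choose P a) ≡ true
      choose-spec P a h with em {P = Σ[ b ∈ A ] P b ≡ true}
      ... | yes (_ , k) = k
      ... | no _ = h

      choose-irr : ∀ (P : A → Bool) a a′ → P a ≡ true → choose P a ≡ choose P a′
      choose-irr P a a′ h with em {P = Σ[ b ∈ A ] P b ≡ true}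
      ... | yes _ = refl
      ... | no k = ⊥-elim (k (a , h))

      cls-intro : ∀ a b → el Λ a ≋ el Λ b → cls a b ≡ true
      cls-intro a b e = dec-true em e

      cls-elim : ∀ a b → cls a b ≡ true → el Λ a ≋ el Λ b
      cls-elim a b h with em {P = el Λ a ≋ el Λ b}
      cls-elim a b h | yes e = e
      cls-elim a b () | no _

      cls-cong : ∀ a a′ → el Λ a ≋ el Λ a′ → cls a ≡ cls a′
      cls-cong a a′ e = fe λ b → go b
        where
        go : ∀ b → cls a b ≡ cls a′ b
        go b with em {P = el Λ a′ ≋ el Λ b}
        ... | yes k = dec-true em (≋-trans (el Λ a) (el Λ a′) (el Λ b) e k)
        ... | no k = dec-false em λ k′ →
          k (≋-trans (el Λ a′) (el Λ a) (el Λ b) (≋-sym (el Λ a) (el Λ a′) e) k′)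

      rep : A → A
      rep a = choose (cls a) a

      rep-≋ : ∀ a → el Λ a ≋ el Λ (rep a)
      rep-≋ a = cls-elim a (rep a) (choose-spec (cls a) a (cls-intro a a (≋-refl (el Λ a))))

      rep-cong : ∀ a a′ → el Λ a ≋ el Λ a′ → rep a ≡ rep a′
      rep-cong a a′ e = trans (cong (λ P → choose P a) (cls-cong a a′ e))
        (choose-irr (cls a′) a a′ (cls-intro a′ a (≋-sym (el Λ a) (el Λ a′) e)))

    L : Set
    L = Σ[ a ∈ A ] rep a ≡ a

    elem : L → V
    elem l = el Λ (proj₁ l)

    elem∊ : ∀ l → elem l ∊ Λ
    elem∊ l = el∊ Λ (proj₁ l)

    elem-inj : ∀ {l m} → elem l ≋ elem m → l ≡ m
    elem-inj {a , u} {b , v} e with trans (sym u) (trans (rep-cong a b e) v)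
    ... | refl = cong (a ,_) (uip u v)

    private
      classOf : A → L
      classOf a = rep a , sym (rep-cong a (rep a) (rep-≋ a))

    abstract
      lab : ∀ {x} → x ∊ Λ → L
      lab h = classOf (proj₁ (∊⇒ix Λ h))

      lab-≋ : ∀ {x} (h : x ∊ Λ) → x ≋ elem (lab h)
      lab-≋ {x} h = let (a , e) = ∊⇒ix Λ h in ≋-trans x (el Λ a) (el Λ (rep a)) e (rep-≋ a)

    lab-≡ : ∀ {x} (h : x ∊ Λ) {l} → x ≋ elem l → lab h ≡ l
    lab-≡ {x} h {l} e = elem-inj (≋-trans (elem (lab h)) x (elem l) (≋-sym x (elem (lab h)) (lab-≋ h)) e)

    infix 4 _<_ _≤_
    record _<_ (l m : L) : Set where
      constructor ∊⇒<
      field <⇒∊ : elem l ∊ elem m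
    open _<_ public

    _≤_ : L → L → Set
    l ≤ m = l < m ⊎ l ≡ m

    elem-ord : ∀ l → OrdV (elem l)
    elem-ord l = ord-elem {Λ} Λ-ord (elem∊ l)

    ∊elem⇒∊Λ : ∀ l {x} → x ∊ elem l → x ∊ Λ
    ∊elem⇒∊Λ l {x} h = proj₁ Λ-ord (elem l) x (elem∊ l) h

    ≤⇒≤V : ∀ {l m} → l ≤ m → elem l ≤V elem m
    ≤⇒≤V (inj₁ h) = inj₁ (<⇒∊ h)
    ≤⇒≤V {l} (inj₂ refl) = inj₂ (≋-refl (elem l))

    ≤V⇒≤ : ∀ {l m} → elem l ≤V elem m → l ≤ m
    ≤V⇒≤ (inj₁ h) = inj₁ (∊⇒< h)
    ≤V⇒≤ {l} {m} (inj₂ e) = inj₂ (elem-inj {l} {m} e)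

    elem-cong : ∀ {l m} → l ≡ m → elem l ≋ elem m
    elem-cong {l} refl = ≋-refl (elem l)

    lab< : ∀ {x} l (h : x ∊ elem l) → lab (∊elem⇒∊Λ l h) < l
    lab< {x} l h = ∊⇒< (∊-congˡ (elem l) (lab-≋ (∊elem⇒∊Λ l h)) h)

    private variable
      ℓ : Level
      k l m : L

    <-trans : k < l → l < m → k < m
    <-trans {k} {l} {m} k<l l<m = ∊⇒< (proj₁ (elem-ord m) (elem l) (elem k) (<⇒∊ l<m) (<⇒∊ k<l))

    <-irrefl : l < l → ⊥
    <-irrefl {l} h = ∊-irrefl {elem l} (<⇒∊ h)

    ≤-refl : l ≤ l
    ≤-refl = inj₂ refl

    <-≤-trans : k < l → l ≤ m → k < m
    <-≤-trans h (inj₁ k) = <-trans h k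
    <-≤-trans h (inj₂ refl) = h

    ≤-<-trans : k ≤ l → l < m → k < m
    ≤-<-trans (inj₁ h) k = <-trans h k
    ≤-<-trans (inj₂ refl) k = k

    ≤-trans : k ≤ l → l ≤ m → k ≤ m
    ≤-trans (inj₁ h) k = inj₁ (<-≤-trans h k)
    ≤-trans (inj₂ refl) k = k

    compare : ∀ l m → l < m ⊎ l ≡ m ⊎ m < l
    compare l m with trichotomyV (elem-ord l) (elem-ord m)
    ... | inj₁ h = inj₁ (∊⇒< h)
    ... | inj₂ (inj₁ e) = inj₂ (inj₁ (elem-inj e))
    ... | inj₂ (inj₂ h) = inj₂ (inj₂ (∊⇒< h))

    <⊎≥ : ∀ l m → l < m ⊎ m ≤ l
    <⊎≥ l m with compare l m
    ... | inj₁ h = inj₁ h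
    ... | inj₂ (inj₁ e) = inj₂ (inj₂ (sym e))
    ... | inj₂ (inj₂ h) = inj₂ (inj₁ h)

    ≤⇒≯ : l ≤ m → m < l → ⊥
    ≤⇒≯ h k = <-irrefl (≤-<-trans h k)

    ≤-antisym : l ≤ m → m ≤ l → l ≡ m
    ≤-antisym h (inj₁ k) = ⊥-elim (≤⇒≯ h k)
    ≤-antisym h (inj₂ e) = sym e

    abstract
      upperBound : ∀ l m → Σ[ n ∈ L ] l ≤ n × m ≤ n × (∀ {j} → l < j → m < j → n < j)
      upperBound l m with <⊎≥ l m
      ... | inj₁ h = m , inj₁ h , ≤-refl , λ _ k → k
      ... | inj₂ h = l , ≤-refl , h , λ k _ → k

    infixl 6 _⊔ₗ_
    _⊔ₗ_ : L → L → L
    l ⊔ₗ m = proj₁ (upperBound l m)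

    ≤⊔ˡ : ∀ l m → l ≤ l ⊔ₗ m
    ≤⊔ˡ l m = proj₁ (proj₂ (upperBound l m))

    ≤⊔ʳ : ∀ l m → m ≤ l ⊔ₗ m
    ≤⊔ʳ l m = proj₁ (proj₂ (proj₂ (upperBound l m)))

    ⊔<  : ∀ l m {j} → l < j → m < j → l ⊔ₗ m < j
    ⊔< l m {j} h h′ = proj₂ (proj₂ (proj₂ (upperBound l m))) {j} h h′

    abstract
      <-wellFounded : WellFounded _<_
      <-wellFounded l = go (elem l) l (≋-refl (elem l))
        where
        go : ∀ x l → elem l ≋ x → Acc _<_ l
        go (sup B f) l e = acc λ {m} m<l →
          let (b , e′) = ∊-congʳ (elem l) (sup B f) e (<⇒∊ m<l) in go (f b) m e′

      least : (Φ : L → Set ℓ) → Σ L Φ → Σ[ l ∈ L ] Φ l × (∀ m → m < l → Φ m → ⊥)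
      least Φ (l , h) = go (<-wellFounded l) h
        where
        go : ∀ {l} → Acc _<_ l → Φ l → Σ[ l ∈ L ] Φ l × (∀ m → m < l → Φ m → ⊥)
        go {l} (acc rs) h with em {P = Σ[ m ∈ L ] m < l × Φ m}
        ... | yes (m , m<l , k) = go (rs m<l) k
        ... | no k = l , h , λ m m<l φ → k (m , m<l , φ)

      L-ind : (Φ : L → Set ℓ) → (∀ l → (∀ m → m < l → Φ m) → Φ l) → ∀ l → Φ l
      L-ind Φ h l = go (<-wellFounded l)
        where
        go : ∀ {l} → Acc _<_ l → Φ l
        go {l} (acc rs) = h l λ m m<l → go (rs m<l)

    abstract
      ixOf : ∀ l m → l < m → Ix (elem m)
      ixOf l m h = proj₁ (∊⇒ix (elem m) (<⇒∊ h))

      ixOf-≋ : ∀ l m (h : l < m) → elem l ≋ el (elem m) (ixOf l m h)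
      ixOf-≋ l m h = proj₂ (∊⇒ix (elem m) (<⇒∊ h))

    labOf : ∀ l → Ix (elem l) → L
    labOf l a = lab (∊elem⇒∊Λ l (el∊ (elem l) a))

    labOf-≋ : ∀ l a → el (elem l) a ≋ elem (labOf l a)
    labOf-≋ l a = lab-≋ (∊elem⇒∊Λ l (el∊ (elem l) a))

    labOf< : ∀ l a → labOf l a < l
    labOf< l a = lab< l (el∊ (elem l) a)

    cof⇒ : ∀ {ν ξ} → Cof (elem ν) (elem ξ) → Σ[ F ∈ (L → L) ] (∀ i → i < ν → F i < ξ) ×
           (∀ η → η < ξ → Σ[ i ∈ L ] i < ν × η ≤ F i)
    cof⇒ {ν} {ξ} (F , resp , cofinal) = G , G< , G-cofinal
      where
      G : L → L
      G i with em {P = i < ν}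
      ... | yes h = labOf ξ (F (ixOf i ν h))
      ... | no _ = i
      G< : ∀ i → i < ν → G i < ξ
      G< i i<ν with em {P = i < ν}
      ... | yes h = labOf< ξ (F (ixOf i ν h))
      ... | no h = ⊥-elim (h i<ν)
      G-≋ : ∀ a → el (elem ξ) (F a) ≋ elem (G (labOf ν a))
      G-≋ a with em {P = labOf ν a < ν}
      ... | yes h = ≋-trans (el (elem ξ) (F a)) (el (elem ξ) (F (ixOf (labOf ν a) ν h))) _
             (resp a (ixOf (labOf ν a) ν h) (≋-trans (el (elem ν) a) (elem (labOf ν a)) _
                (labOf-≋ ν a) (ixOf-≋ (labOf ν a) ν h)))
             (labOf-≋ ξ (F (ixOf (labOf ν a) ν h)))
      ... | no h = ⊥-elim (h (labOf< ν a))
      G-cofinal : ∀ η → η < ξ → Σ[ i ∈ L ] i < ν × η ≤ G i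
      G-cofinal η η<ξ = let (a , le) = cofinal (ixOf η ξ η<ξ) in
        labOf ν a , labOf< ν a , ≤V⇒≤ (≤V-cong {x′ = elem η} {y′ = elem (G (labOf ν a))}
          (≋-sym (elem η) _ (ixOf-≋ η ξ η<ξ)) (G-≋ a) le)

  -- Bounds, suprema and countable cofinality below a regular Λ

  module Regularity (Λ : V) (Λ-ord : OrdV Λ)
    (Λ-regular : ∀ ν → ν ∊ Λ → Cof ν Λ → ⊥)
    (ω : V) (ω-omega : OmegaV ω) (ω∊Λ : ω ∊ Λ) where

    open Initial Λ Λ-ord public

    private variable
      ℓ : Level
      k l m : L

    -- A maximum l would make the constant map from ω with value l cofinal in Λ.
    noMax : ∀ l → Σ[ m ∈ L ] l < m
    noMax l with em {P = Σ[ m ∈ L ] l < m}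
    ... | yes h = h
    ... | no h = ⊥-elim (Λ-regular ω ω∊Λ
      ((λ _ → proj₁ l) , (λ _ _ _ → ≋-refl (elem l)) , λ b → proj₁ (∊⇒ix ω (proj₂ (proj₁ (proj₂ (proj₁ ω-omega))))) , le b))
      where
      le : ∀ b → el Λ b ≤V elem l
      le b with <⊎≥ l (lab (el∊ Λ b))
      ... | inj₁ k = ⊥-elim (h (_ , k))
      ... | inj₂ k = ≤V-cong {x = elem (lab (el∊ Λ b))} (≋-sym (el Λ b) _ (lab-≋ (el∊ Λ b))) (≋-refl (elem l))
                       (≤⇒≤V k)

    suc : L → L
    suc l = proj₁ (least (l <_) (noMax l))

    <suc : ∀ l → l < suc l
    <suc l = proj₁ (proj₂ (least (l <_) (noMax l)))

    <⇒suc≤ : l < m → suc l ≤ m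
    <⇒suc≤ {l} {m} h with <⊎≥ m (suc l)
    ... | inj₁ k = ⊥-elim (proj₂ (proj₂ (least (l <_) (noMax l))) m k h)
    ... | inj₂ k = k

    <suc⇒≤ : l < suc m → l ≤ m
    <suc⇒≤ {l} {m} h with <⊎≥ m l
    ... | inj₁ k = ⊥-elim (≤⇒≯ (<⇒suc≤ k) h)
    ... | inj₂ k = k

    ≤⇒<suc : l ≤ m → l < suc m
    ≤⇒<suc h = ≤-<-trans h (<suc _)

    0ₗ : L
    0ₗ = proj₁ (least (λ _ → ⊤) (lab ω∊Λ , tt))

    0≤ : ∀ l → 0ₗ ≤ l
    0≤ l with <⊎≥ l 0ₗ
    ... | inj₁ h = ⊥-elim (proj₂ (proj₂ (least (λ _ → ⊤) (lab ω∊Λ , tt))) l h tt)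
    ... | inj₂ h = h

    Lim : L → Set
    Lim α = (Σ[ ξ ∈ L ] ξ < α) × (∀ ξ → ξ < α → suc ξ < α)

    limV⇒lim : ∀ α → LimV (elem α) → Lim α
    limV⇒lim α (_ , (y , y∊α) , h) = (_ , lab< α y∊α) , λ ξ ξ<α →
      let (z , z∊α , ξ∊z) = h (elem ξ) (<⇒∊ ξ<α) in
      ≤-<-trans (<⇒suc≤ (∊⇒< (∊-congʳ z _ (lab-≋ (∊elem⇒∊Λ α z∊α)) ξ∊z))) (lab< α z∊α)

    lim⇒limV : ∀ α → Lim α → LimV (elem α)
    lim⇒limV α ((ξ , ξ<α) , h) = elem-ord α , (elem ξ , <⇒∊ ξ<α) , λ y y∊α →
      elem (suc (lab (∊elem⇒∊Λ α y∊α))) , <⇒∊ (h _ (lab< α y∊α)) ,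
      ∊-congˡ (elem (suc (lab (∊elem⇒∊Λ α y∊α)))) (≋-sym y _ (lab-≋ (∊elem⇒∊Λ α y∊α))) (<⇒∊ (<suc _))

    -- Without a bound, F restricted to ν would be cofinal in Λ, against regularity.
    bounded : ∀ ν (F : L → L) → Σ[ β ∈ L ] (∀ ξ → ξ < ν → F ξ < β)
    bounded ν F with em {P = Σ[ β ∈ L ] (∀ ξ → ξ < ν → F ξ < β)}
    ... | yes h = h
    ... | no h = ⊥-elim (Λ-regular (elem ν) (elem∊ ν)
      ((λ a → proj₁ (F (labOf ν a))) , resp , cofinal))
      where
      resp : ∀ a a′ → el (elem ν) a ≋ el (elem ν) a′ → elem (F (labOf ν a)) ≋ elem (F (labOf ν a′))
      resp a a′ e rewrite lab-≡ (∊elem⇒∊Λ ν (el∊ (elem ν) a)) {labOf ν a′}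
        (≋-trans (el (elem ν) a) (el (elem ν) a′) _ e (labOf-≋ ν a′)) = ≋-refl _
      cofinal : ∀ b → Σ[ a ∈ Ix (elem ν) ] el Λ b ≤V elem (F (labOf ν a))
      cofinal b with em {P = Σ[ ξ ∈ L ] ξ < ν × lab (el∊ Λ b) ≤ F ξ}
      ... | no k = ⊥-elim (h (lab (el∊ Λ b) , λ ξ ξ<ν → [ (λ u → u) , (λ u → ⊥-elim (k (ξ , ξ<ν , u))) ]′ (<⊎≥ (F ξ) _)))
      ... | yes (ξ , ξ<ν , le) = ixOf ξ ν ξ<ν ,
        ≤V-cong {x = elem (lab (el∊ Λ b))} (≋-sym (el Λ b) _ (lab-≋ (el∊ Λ b)))
          (elem-cong (cong F (sym (lab-≡ (∊elem⇒∊Λ ν (el∊ (elem ν) (ixOf ξ ν ξ<ν))) {ξ}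
             (≋-sym (elem ξ) _ (ixOf-≋ ξ ν ξ<ν))))))
          (≤⇒≤V le)

    num : ℕ → L
    num zero = 0ₗ
    num (ℕ.suc n) = suc (num n)

    ωₗ : L
    ωₗ = lab ω∊Λ

    omega-lim : Lim ωₗ
    omega-lim = limV⇒lim ωₗ (VT.limit-chk⁻¹ {p = tt} (elem ωₗ)
      (VT.limit-cong (lab-≋ ω∊Λ) (VT.limit-chk ω (proj₁ ω-omega))))

    num<ω : ∀ n → num n < ωₗ
    num<ω zero = ≤-<-trans (0≤ _) (proj₂ (proj₁ omega-lim))
    num<ω (ℕ.suc n) = proj₂ omega-lim (num n) (num<ω n)

    -- A ξ < ω that is neither 0 nor a successor would be a limit below ω.
    num-surj : ∀ ξ → ξ < ωₗ → Σ[ n ∈ ℕ ] ξ ≡ num n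
    num-surj = L-ind _ step
      where
      step : ∀ ξ → (∀ η → η < ξ → η < ωₗ → Σ[ n ∈ ℕ ] η ≡ num n) → ξ < ωₗ → Σ[ n ∈ ℕ ] ξ ≡ num n
      step ξ ih ξ<ω with em {P = Σ[ η ∈ L ] η < ξ × (suc η < ξ → ⊥)}
      ... | yes (η , η<ξ , k) = let (n , e) = ih η η<ξ (<-trans η<ξ ξ<ω) in
        ℕ.suc n , trans (≤-antisym ([ (λ u → ⊥-elim (k u)) , (λ u → u) ]′ (<⊎≥ (suc η) ξ)) (<⇒suc≤ η<ξ)) (cong suc e)
      ... | no k with 0≤ ξ
      ...   | inj₂ e = zero , sym e
      ...   | inj₁ 0<ξ = ⊥-elim (proj₂ ω-omega (elem ξ)
              (∊-congʳ (elem ωₗ) ω (≋-sym ω (elem ωₗ) (lab-≋ ω∊Λ)) (<⇒∊ ξ<ω))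
              (lim⇒limV ξ ((0ₗ , 0<ξ) , λ η η<ξ → [ (λ u → u) , (λ u → ⊥-elim (k (η , η<ξ , ≤⇒≯ u))) ]′ (<⊎≥ (suc η) ξ))))

    mono-seq : (b : ℕ → L) → (∀ n → b n < b (ℕ.suc n)) → ∀ {i j} → i ℕ.< j → b i < b j
    mono-seq b h {i} {ℕ.suc j} (ℕ.s≤s i≤j) with ℕₚ.m≤n⇒m<n∨m≡n i≤j
    ... | inj₁ i<j = <-trans (mono-seq b h i<j) (h j)
    ... | inj₂ refl = h i

    mono-seq-≤ : (b : ℕ → L) → (∀ n → b n < b (ℕ.suc n)) → ∀ {i j} → i ℕ.≤ j → b i ≤ b j
    mono-seq-≤ b h i≤j with ℕₚ.m≤n⇒m<n∨m≡n i≤j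
    ... | inj₁ i<j = inj₁ (mono-seq b h i<j)
    ... | inj₂ refl = ≤-refl

    num-inj : ∀ {i j} → num i ≡ num j → i ≡ j
    num-inj {i} {j} e with ℕₚ.<-cmp i j
    ... | tri< h _ _ = ⊥-elim (<-irrefl (subst (num i <_) (sym e) (mono-seq num (λ n → <suc (num n)) h)))
    ... | tri≈ _ h _ = h
    ... | tri> _ _ h = ⊥-elim (<-irrefl (subst (_< num i) (sym e) (mono-seq num (λ n → <suc (num n)) h)))

    ω-supremum : (b : ℕ → L) → Σ[ ξ ∈ L ] (∀ n → b n < ξ) × (∀ η → η < ξ → Σ[ n ∈ ℕ ] η ≤ b n)
    ω-supremum b = let (ξ , h , k) = least (λ ξ → ∀ n → b n < ξ) (proj₁ bd , b<) in
      ξ , h , λ η η<ξ → approach (k η η<ξ)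
      where
      -- `bounded` speaks of maps on L, so the sequence is transported to the numerals; the value
      -- elsewhere is arbitrary.
      F : L → L
      F i with em {P = Σ[ n ∈ ℕ ] i ≡ num n}
      ... | yes (n , _) = b n
      ... | no _ = i
      F-num : ∀ n → F (num n) ≡ b n
      F-num n with em {P = Σ[ m ∈ ℕ ] num n ≡ num m}
      ... | yes (m , e) = cong b (sym (num-inj e))
      ... | no h = ⊥-elim (h (n , refl))
      bd = bounded ωₗ F
      b< : ∀ n → b n < proj₁ bd
      b< n = subst (_< proj₁ bd) (F-num n) (proj₂ bd (num n) (num<ω n))
      approach : ∀ {η} → ((∀ n → b n < η) → ⊥) → Σ[ n ∈ ℕ ] η ≤ b n
      approach {η} k with em {P = Σ[ n ∈ ℕ ] η ≤ b n}
      ... | yes h = h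
      ... | no h = ⊥-elim (k λ n → [ (λ u → u) , (λ u → ⊥-elim (h (n , u))) ]′ (<⊎≥ (b n) η))

    -- Countable cofinality, 0 and successors included
    Ctbl : L → Set
    Ctbl β = Σ[ s ∈ (ℕ → L) ] (∀ ξ → ξ < β → Σ[ n ∈ ℕ ] ξ ≤ s n × s n < β)

    ctbl-suc : ∀ β → Ctbl (suc β)
    ctbl-suc β = (λ _ → β) , λ ξ h → zero , <suc⇒≤ h , <suc β

    ¬ctbl⇒lim : ∀ β → (Ctbl β → ⊥) → Lim β
    ¬ctbl⇒lim β h = nonzero , λ ξ ξ<β → [ (λ u → u) , (λ u → ⊥-elim (h ((λ _ → ξ) , λ η η<β →
        zero , <suc⇒≤ (<-≤-trans η<β u) , ξ<β))) ]′ (<⊎≥ (suc ξ) β)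
      where
      nonzero : Σ[ ξ ∈ L ] ξ < β
      nonzero with em {P = Σ[ ξ ∈ L ] ξ < β}
      ... | yes k = k
      ... | no k = ⊥-elim (h ((λ _ → β) , λ ξ ξ<β → ⊥-elim (k (ξ , ξ<β))))

    cof-ω⇒ctbl : ∀ β → Cof ω (elem β) → Ctbl β
    cof-ω⇒ctbl β c = let (F , F< , F-cofinal) = cof⇒ {ωₗ} {β} (cof-cong (lab-≋ ω∊Λ) (≋-refl (elem β)) c) in
      (λ n → F (num n)) , λ ξ ξ<β →
        let (i , i<ω , le) = F-cofinal ξ ξ<β ; (n , e) = num-surj i i<ω in
        n , subst (λ j → ξ ≤ F j) e le , F< (num n) (num<ω n)

    private
      ω-num : ∀ a → Σ[ n ∈ ℕ ] el ω a ≋ elem (num n)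
      ω-num a = let h = proj₁ Λ-ord ω (el ω a) ω∊Λ (el∊ ω a)
                    (n , e) = num-surj (lab h) (∊⇒< (∊-congʳ ω (elem ωₗ) (lab-≋ ω∊Λ) (∊-congˡ ω (lab-≋ h) (el∊ ω a))))
                in n , subst (λ j → el ω a ≋ elem j) e (lab-≋ h)

      num-ω : ∀ n → Σ[ a ∈ Ix ω ] elem (num n) ≋ el ω a
      num-ω n = ∊⇒ix ω (∊-congʳ (elem ωₗ) ω (≋-sym ω (elem ωₗ) (lab-≋ ω∊Λ)) (<⇒∊ (num<ω n)))

    seq⇒cof-ω : ∀ β (s : ℕ → L) → (∀ n → s n < β) → (∀ ξ → ξ < β → Σ[ n ∈ ℕ ] ξ ≤ s n) → Cof ω (elem β)
    seq⇒cof-ω β s s< s-cofinal =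
      (λ a → ixOf (s (idx a)) β (s< (idx a))) ,
      (λ a a′ e → ≋-trans _ (elem (s (idx a))) _ (≋-sym (elem (s (idx a))) _ (ixOf-≋ (s (idx a)) β (s< (idx a))))
        (≋-trans (elem (s (idx a))) (elem (s (idx a′))) _
          (elem-cong (cong s (idx-cong a a′ e)))
          (ixOf-≋ (s (idx a′)) β (s< (idx a′))))) ,
      λ b → let (n , le) = s-cofinal (labOf β b) (labOf< β b)
                (a , e) = num-ω n
                n≡ : n ≡ idx a
                n≡ = num-inj (elem-inj (≋-trans (elem (num n)) (el ω a) _ e (proj₂ (ω-num a))))
            in a , ≤V-cong {x = elem (labOf β b)} {y = elem (s (idx a))}
                 (≋-sym (el (elem β) b) _ (labOf-≋ β b)) (ixOf-≋ (s (idx a)) β (s< (idx a)))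
                 (≤⇒≤V (subst (λ j → labOf β b ≤ s j) n≡ le))
      where
      idx : Ix ω → ℕ
      idx a = proj₁ (ω-num a)
      idx-cong : ∀ a a′ → el ω a ≋ el ω a′ → idx a ≡ idx a′
      idx-cong a a′ e = num-inj (elem-inj (≋-trans _ (el ω a) _ (≋-sym (el ω a) _ (proj₂ (ω-num a)))
        (≋-trans (el ω a) (el ω a′) _ e (proj₂ (ω-num a′)))))

    -- `Ctbl` lets s take values outside γ. These are first moved into γ, which gives a cofinal map
    -- from ω, an ordinal below the cofinality μ.
    uncountable⇒¬ctbl : ∀ {γ μ} → CofV (elem γ) μ → ω ∊ μ → Ctbl γ → ⊥
    uncountable⇒¬ctbl {γ} {μ} (oμ , _ , minimal) ω∊μ (s , h) with em {P = Σ[ ξ ∈ L ] ξ < γ}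
    -- For γ = 0 the empty map on 0 is already cofinal.
    ... | no k = minimal (elem 0ₗ) (proj₁ oμ ω (elem 0ₗ) ω∊μ (ix⇒∊ ω (proj₁ (num-ω 0)) (proj₂ (num-ω 0))))
      ((λ a → ⊥-elim (≤⇒≯ (0≤ _) (labOf< 0ₗ a))) , (λ a → ⊥-elim (≤⇒≯ (0≤ _) (labOf< 0ₗ a))) ,
       λ b → ⊥-elim (k (_ , labOf< γ b)))
    ... | yes (ξ₀ , ξ₀<γ) = minimal ω ω∊μ (seq⇒cof-ω γ t t< t-cofinal)
      where
      t : ℕ → L
      t n with em {P = s n < γ}
      ... | yes _ = s n
      ... | no _ = ξ₀
      t< : ∀ n → t n < γ
      t< n with em {P = s n < γ}
      ... | yes k = k
      ... | no _ = ξ₀<γ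
      t-cofinal : ∀ ξ → ξ < γ → Σ[ n ∈ ℕ ] ξ ≤ t n
      t-cofinal ξ ξ<γ with h ξ ξ<γ
      ... | n , le , sn<γ = n , le′
        where
        le′ : ξ ≤ t n
        le′ with em {P = s n < γ}
        ... | yes _ = le
        ... | no k = ⊥-elim (k sn<γ)

    -- Rules out finite cofinalities of a limit, which is the minimality half of `ω-limit⇒cofV`.
    finite-bounded : ∀ {ξ} → Lim ξ → ∀ n (F : L → L) → (∀ i → i < num n → F i < ξ) →
                     Σ[ β ∈ L ] β < ξ × (∀ i → i < num n → F i < β)
    finite-bounded ((ξ₀ , h) , _) zero F _ = ξ₀ , h , λ i i<0 → ⊥-elim (≤⇒≯ (0≤ _) i<0)
    finite-bounded {ξ} l (ℕ.suc n) F F< =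
      let (β , β<ξ , k) = finite-bounded l n F (λ i i<n → F< i (<-trans i<n (<suc _)))
          s = suc (F (num n))
          case : ∀ i → i < num (ℕ.suc n) → F i < β ⊔ₗ s
          case i i<sn = [ (λ i<n → <-≤-trans (k i i<n) (≤⊔ˡ β s))
                        , (λ { refl → <-≤-trans (<suc _) (≤⊔ʳ β s) }) ]′ (<suc⇒≤ i<sn)
      in β ⊔ₗ s , ⊔< β s β<ξ (proj₂ l (F (num n)) (F< (num n) (<suc _))) , case

    ω-limit⇒cofV : ∀ ξ (b : ℕ → L) → Lim ξ → (∀ n → b n < ξ) → (∀ η → η < ξ → Σ[ n ∈ ℕ ] η ≤ b n) → CofV (elem ξ) ω
    ω-limit⇒cofV ξ b l b< b-cofinal = proj₁ (proj₁ ω-omega) , seq⇒cof-ω ξ b b< b-cofinal ,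
      λ ν ν∊ω c →
        let (a , e) = ∊⇒ix ω ν∊ω
            (n , e′) = ω-num a
            (F , F< , F-cofinal) = cof⇒ {num n} {ξ}
              (cof-cong (≋-trans ν (el ω a) (elem (num n)) e e′) (≋-refl (elem ξ)) c)
            (β , β<ξ , k) = finite-bounded l n F F<
            (i , i<n , le) = F-cofinal β β<ξ
        in ≤⇒≯ le (k i i<n)

    -- Coding bounded sequences by ordinals below Λ

    module Coding (weakPower : V⊨ WeakPowerFixed Λ) where
      private
        H = proj₁ weakPower
        H-spec = proj₁ (proj₂ weakPower)
        g = proj₁ (proj₂ (proj₂ weakPower))
        g-bij = V⊨⇒sat (Bijection g H Λ) (proj₂ (proj₂ (proj₂ weakPower)))

        module _ (ν : L) (F : L → L) where
          private
            dom : L → ⊤ → Set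
            dom i _ = i < ν

          abstract
            fn : V
            fn = VT.graph L elem (λ i → elem (F i)) dom

            fn-function : V⊨ Function fn (elem ν) Λ
            fn-function = sat⇒V⊨ (Function fn (elem ν) Λ)
              (VT.graph-functionOn {A = L} {a = elem} {b = λ i → elem (F i)} {N = dom} (λ _ _ h → h) {B = elem ν}
                 (λ _ m _ _ → tt , tt , lab (∊elem⇒∊Λ ν m) , lab< ν m , lab-≋ (∊elem⇒∊Λ ν m))
                 (λ _ h → <⇒∊ h)
                 (λ { {i} {j} _ _ _ e → elem-cong (cong F (elem-inj e)) }) ,
               λ x y _ _ m → lift (let (_ , _ , i , _ , _ , e) = VT.now (VT.graph-elim {A = L} {a = elem} {b = λ i → elem (F i)} {N = dom} (λ _ _ h → h) (VT.maps⇒ m)) in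
                 ∊-congˡ Λ (≋-sym y (elem (F i)) e) (elem∊ (F i))))

            fn-intro : ∀ i → i < ν → VT.opair (elem i) (elem (F i)) ∊ fn
            fn-intro i i<ν = VT.graph-intro {A = L} {a = elem} {b = λ i → elem (F i)} {N = dom} (λ _ _ h → h) i i<ν

            fn-elim : ∀ {x y} → VT.opair x y ∊ fn → Σ[ j ∈ L ] j < ν × x ≋ elem j × y ≋ elem (F j)
            fn-elim {x} {y} m =
              let (_ , _ , d) = VT.now (VT.graph-elim {A = L} {a = elem} {b = λ i → elem (F i)} {N = dom}
                                          (λ _ _ h → h) {x = x} {y = y} m) in d

          fn∊H : fn ∊ H
          fn∊H = lower (proj₂ (H-spec fn) (elem ν , lift (elem∊ ν) , fn-function))

          value : Σ[ y ∈ V ] VT.Map g fn y tt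
          value = let (_ , _ , h) = VT.now (VT.fun-total (proj₁ (proj₁ g-bij)) tt fn∊H) in h

          value∊Λ : proj₁ value ∊ Λ
          value∊Λ = lower (proj₂ (proj₁ g-bij) fn (proj₁ value) tt tt (VT.⇒maps (proj₂ value)))

        transfer : ∀ ν F ν′ F′ → fn ν F ≋ fn ν′ F′ → ∀ i → i < ν → i < ν′ × F i ≡ F′ i
        transfer ν F ν′ F′ e i i<ν =
          let (j , j<ν′ , e₁ , e₂) = fn-elim ν′ F′ (∊-congʳ (fn ν F) (fn ν′ F′) e (fn-intro ν F i i<ν))
              i≡j = elem-inj {i} {j} e₁
          in subst (_< ν′) (sym i≡j) j<ν′ , trans (elem-inj {F i} {F′ j} e₂) (cong F′ (sym i≡j))

        value-inj : ∀ ν F ν′ F′ → proj₁ (value ν′ F′) ≋ proj₁ (value ν F) → fn ν F ≋ fn ν′ F′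
        value-inj ν F ν′ F′ e = lower (proj₁ (proj₂ g-bij) (fn ν F) (fn ν′ F′) (proj₁ (value ν F)) tt tt
          (VT.⇒maps (proj₂ (value ν F))) tt tt
          (VT.⇒maps (VT.map-cong (≋-refl (fn ν′ F′)) e (proj₂ (value ν′ F′)))))

      abstract
        code₀ : L → (L → L) → L
        code₀ ν F = lab (value∊Λ ν F)

        -- The graph remembers its domain, so equal codes give equal lengths as well as equal
        -- values.
        code₀-inj : ∀ {ν F ν′ F′} → code₀ ν F ≡ code₀ ν′ F′ → ν ≡ ν′ × (∀ i → i < ν → F i ≡ F′ i)
        code₀-inj {ν} {F} {ν′} {F′} e =
          ≤-antisym (le (λ i h → proj₁ (there i h))) (le (λ i h → proj₁ (back i h))) , λ i h → proj₂ (there i h)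
          where
          same : proj₁ (value ν′ F′) ≋ proj₁ (value ν F)
          same = ≋-trans (proj₁ (value ν′ F′)) (elem (code₀ ν′ F′)) (proj₁ (value ν F)) (lab-≋ (value∊Λ ν′ F′))
            (subst (λ c → elem c ≋ proj₁ (value ν F)) e
              (≋-sym (proj₁ (value ν F)) (elem (code₀ ν F)) (lab-≋ (value∊Λ ν F))))
          fn-eq : fn ν F ≋ fn ν′ F′
          fn-eq = value-inj ν F ν′ F′ same
          there : ∀ i → i < ν → i < ν′ × F i ≡ F′ i
          there = transfer ν F ν′ F′ fn-eq
          back : ∀ i → i < ν′ → i < ν × F′ i ≡ F i
          back = transfer ν′ F′ ν F (≋-sym (fn ν F) (fn ν′ F′) fn-eq)
          le : ∀ {l m} → (∀ i → i < l → i < m) → l ≤ m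
          le {l} {m} h = [ (λ m<l → ⊥-elim (<-irrefl (h m m<l))) , (λ l≤m → l≤m) ]′ (<⊎≥ m l)

      private
        -- With the values outside ν set to 0, sequences that agree below ν become equal functions
        -- by extensionality, which gives `code-cong`.
        clip : L → (L → L) → L → L
        clip ν F i = if does (em {P = i < ν}) then F i else 0ₗ

        clip-< : ∀ ν F {i} → i < ν → clip ν F i ≡ F i
        clip-< ν F {i} h = cong (λ b → if b then F i else 0ₗ) (dec-true em h)

      code : L → (L → L) → L
      code ν F = code₀ ν (clip ν F)

      code-inj : ∀ {ν F ν′ F′} → code ν F ≡ code ν′ F′ → ν ≡ ν′ × (∀ i → i < ν → F i ≡ F′ i)
      code-inj {ν} {F} {ν′} {F′} e =
        let (l , k) = code₀-inj {ν} {clip ν F} {ν′} {clip ν′ F′} e in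
        l , λ i h → trans (sym (clip-< ν F h)) (trans (k i h) (clip-< ν′ F′ (subst (i <_) l h)))

      code-cong : ∀ {ν F ν′ F′} → ν ≡ ν′ → (∀ i → i < ν → F i ≡ F′ i) → code ν F ≡ code ν′ F′
      code-cong {ν} {F} {.ν} {F′} refl h = cong (code₀ ν) (fe go)
        where
        go : ∀ i → clip ν F i ≡ clip ν F′ i
        go i with em {P = i < ν}
        ... | yes l = h i l
        ... | no _ = refl

      private
        entry : L → L → L → L
        entry a b i = if does (em {P = i ≡ 0ₗ}) then a else b

      pair : L → L → L
      pair a b = code (num 2) (entry a b)

      pair-inj : ∀ {a b a′ b′} → pair a b ≡ pair a′ b′ → a ≡ a′ × b ≡ b′
      pair-inj {a} {b} {a′} {b′} e =
        trans (sym (at0 a b)) (trans (proj₂ inj (num 0) (mono-seq num (λ n → <suc (num n)) {0} {2} (ℕ.s≤s ℕ.z≤n))) (at0 a′ b′)) ,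
        trans (sym (at1 a b)) (trans (proj₂ inj (num 1) (<suc _)) (at1 a′ b′))
        where
        inj = code-inj {num 2} {entry a b} {num 2} {entry a′ b′} e
        at0 : ∀ a b → entry a b (num 0) ≡ a
        at0 a b = cong (λ c → if c then a else b) (dec-true em refl)
        at1 : ∀ a b → entry a b (num 1) ≡ b
        at1 a b = cong (λ c → if c then a else b) (dec-false em λ h → <-irrefl (subst (0ₗ <_) h (<suc 0ₗ)))

  record Ground : Set₁ where
    field
      Λ ω S : V
      Λ-ord : OrdV Λ
      Λ-regular : ∀ ν → ν ∊ Λ → Cof ν Λ → ⊥
      ω-omega : OmegaV ω
      ω∊Λ : ω ∊ Λ
      weakPower : V⊨ WeakPowerFixed Λ
      S-elim : ∀ {x} → x ∊ S → x ∊ Λ × LimV x × CofV x ω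
      S-intro : ∀ {x} → x ∊ Λ → LimV x → CofV x ω → x ∊ S

  -- The conditions of ℙ and ℚ

  module Conditions (𝓖 : Ground) where
    open Ground 𝓖 public
    open Regularity Λ Λ-ord Λ-regular ω ω-omega ω∊Λ public
    open Coding weakPower public

    record Sₗ (ξ : L) : Set where
      constructor ∊⇒S
      field S⇒∊ : elem ξ ∊ S
    open Sₗ public

    S-lim : ∀ {ξ} → Sₗ ξ → Lim ξ
    S-lim {ξ} h = limV⇒lim ξ (proj₁ (proj₂ (S-elim (S⇒∊ h))))

    S-ctbl : ∀ {ξ} → Sₗ ξ → Ctbl ξ
    S-ctbl {ξ} h = cof-ω⇒ctbl ξ (proj₁ (proj₂ (proj₂ (proj₂ (S-elim (S⇒∊ h))))))

    ω-limit⇒S : ∀ ξ (b : ℕ → L) → Lim ξ → (∀ n → b n < ξ) → (∀ η → η < ξ → Σ[ n ∈ ℕ ] η ≤ b n) → Sₗ ξ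
    ω-limit⇒S ξ b l h k = ∊⇒S (S-intro (elem∊ ξ) (lim⇒limV ξ l) (ω-limit⇒cofV ξ b l h k))

    module _ {A : Set} (m : L) (f g : L → A) where
      splitAt : L → A
      splitAt ξ = if does (em {P = ξ < m}) then f ξ else g ξ

      splitAt-< : ∀ {ξ} → ξ < m → splitAt ξ ≡ f ξ
      splitAt-< {ξ} h = cong (λ b → if b then f ξ else g ξ) (dec-true em h)

      splitAt-≥ : ∀ {ξ} → m ≤ ξ → splitAt ξ ≡ g ξ
      splitAt-≥ {ξ} h = cong (λ b → if b then f ξ else g ξ) (dec-false em (≤⇒≯ h))

    only : L → L → Bool
    only l ξ = does (em {P = ξ ≡ l})

    only-self : ∀ l → only l l ≡ true
    only-self l = dec-true em refl

    only-elim : ∀ l ξ → only l ξ ≡ true → ξ ≡ l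
    only-elim l ξ h with em {P = ξ ≡ l}
    only-elim l ξ h | yes e = e
    only-elim l ξ () | no _

    decide : (P : L → Set) → L → Bool
    decide P ξ = does (em {P = P ξ})

    decide-intro : ∀ P {ξ} → P ξ → decide P ξ ≡ true
    decide-intro P h = dec-true em h

    decide-elim : ∀ P {ξ} → decide P ξ ≡ true → P ξ
    decide-elim P {ξ} h with em {P = P ξ}
    decide-elim P {ξ} h | yes k = k
    decide-elim P {ξ} () | no _

    bool-ext : ∀ {b b′ : Bool} → (b ≡ true → b′ ≡ true) → (b′ ≡ true → b ≡ true) → b ≡ b′
    bool-ext {true} {true} _ _ = refl
    bool-ext {ffalse} {ffalse} _ _ = refl
    bool-ext {true} {ffalse} h _ = sym (h refl)
    bool-ext {ffalse} {true} _ h = h refl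

    -- Conditions of ℙ: initial segments of a function g : Λ → Λ, of which
    -- S_α = {ξ ∈ S : g ξ = α} are the fibres, such that at each β of uncountable
    -- cofinality the regressive values of g are bounded on a club.

    Avoids : L → L → L → Set
    Avoids δ α ξ = Sₗ ξ → δ ≤ α → α < ξ → ⊥

    AccPoint : (L → Bool) → L → Set
    AccPoint c α = ∀ ξ → ξ < α → Σ[ η ∈ L ] ξ < η × η < α × c η ≡ true

    Closed : (L → Bool) → L → Set
    Closed c β = ∀ α → α < β → Lim α → AccPoint c α → c α ≡ true

    -- The strict inequality δ < β carries the content: for δ = β the last clause would hold of
    -- every `val`, as no regressive value at a point below β reaches β.
    Good : (L → L) → L → Set
    Good val β = Σ[ δ ∈ L ] δ < β × Σ[ c ∈ (L → Bool) ] AccPoint c β × Closed c β ×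
      (∀ ξ → ξ < β → c ξ ≡ true → Avoids δ (val ξ) ξ)

    record Cond : Set where
      field
        len : L
        val : L → L
        -- β = `len` is included: the requirement at β concerns only values below β, so a condition
        -- violating it at its own length would have no proper extension.
        good : ∀ β → β ≤ len → (Ctbl β → ⊥) → Good val β
    open Cond public

    infix 4 _≼_
    record _≼_ (p q : Cond) : Set where
      constructor mk≼
      field
        len≤ : len q ≤ len p
        agree : ∀ ξ → ξ < len q → val p ξ ≡ val q ξ
    open _≼_ public

    ≼-refl : ∀ {p} → p ≼ p
    ≼-refl = mk≼ ≤-refl λ _ _ → refl

    ≼-trans : ∀ {p q r} → p ≼ q → q ≼ r → p ≼ r
    ≼-trans (mk≼ h k) (mk≼ h′ k′) = mk≼ (≤-trans h′ h) λ ξ l → trans (k ξ (<-≤-trans l h′)) (k′ ξ l)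

    -- Both p and q are initial segments of r. Thus compatible conditions are comparable, and a
    -- condition that is long enough already decides which shorter ones belong to the generic
    -- filter.
    ≼-tree : ∀ {r p q} → r ≼ p → r ≼ q → len q ≤ len p → p ≼ q
    ≼-tree (mk≼ _ k) (mk≼ _ k′) l = mk≼ l λ ξ h → trans (sym (k ξ (<-≤-trans h l))) (k′ ξ h)

    avoids-cong : ∀ {δ α α′ ξ} → α ≡ α′ → Avoids δ α ξ → Avoids δ α′ ξ
    avoids-cong refl h = h

    good-cong : ∀ {v v′ β} → (∀ ξ → ξ < β → v ξ ≡ v′ ξ) → Good v β → Good v′ β
    good-cong e (δ , δ<β , c , near , closed , avoids) =
      δ , δ<β , c , near , closed , λ ξ l k → avoids-cong (e ξ l) (avoids ξ l k)

    root : Cond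
    root = record { len = 0ₗ ; val = λ ξ → ξ ; good = λ β β≤0 h →
      ⊥-elim (≤⇒≯ (0≤ _) (<-≤-trans (proj₂ (proj₁ (¬ctbl⇒lim β h))) β≤0)) }

    root-max : ∀ p → p ≼ root
    root-max p = mk≼ (0≤ _) λ ξ h → ⊥-elim (≤⇒≯ (0≤ _) h)

    -- Beyond len p the identity is used, whose values are never regressive.
    extend : (p : Cond) (ν : L) → len p ≤ ν → Cond
    extend p ν l = record { len = ν ; val = v ; good = g }
      where
      v = splitAt (len p) (val p) (λ ξ → ξ)
      g : ∀ β → β ≤ ν → (Ctbl β → ⊥) → Good v β
      g β β≤ν h with <⊎≥ (len p) β
      ... | inj₂ β≤p = good-cong (λ ξ k → sym (splitAt-< (len p) (val p) (λ ξ → ξ) (<-≤-trans k β≤p))) (good p β β≤p h)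
      ... | inj₁ p<β = len p , p<β , decide (len p <_) ,
        (λ ξ k → suc (ξ ⊔ₗ len p) , ≤⇒<suc (≤⊔ˡ ξ (len p)) ,
           proj₂ (¬ctbl⇒lim β h) _ (⊔< ξ (len p) k p<β) , decide-intro (len p <_) (≤⇒<suc (≤⊔ʳ ξ (len p)))) ,
        (λ α _ (( ξ , k) , _) near → let (η , _ , η<α , e) = near ξ k in
           decide-intro (len p <_) (<-trans (decide-elim (len p <_) e) η<α)) ,
        (λ ξ _ k _ _ reg → <-irrefl (subst (_< ξ) (splitAt-≥ (len p) (val p) (λ ξ → ξ)
           (inj₁ (decide-elim (len p <_) k))) reg))

    extend-≼ : ∀ p ν l → extend p ν l ≼ p
    extend-≼ p ν l = mk≼ l λ ξ h → splitAt-< (len p) (val p) (λ ξ → ξ) h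

    extend-id : ∀ p ν l {ξ} → len p ≤ ξ → val (extend p ν l) ξ ≡ ξ
    extend-id p ν l = splitAt-≥ (len p) (val p) (λ ξ → ξ)

    lengthen : ∀ p ν → Σ[ q ∈ Cond ] q ≼ p × ν ≤ len q
    lengthen p ν = extend p (len p ⊔ₗ ν) (≤⊔ˡ (len p) ν) , extend-≼ p _ (≤⊔ˡ (len p) ν) , ≤⊔ʳ (len p) ν

    -- The new length is a successor, hence `Ctbl`, so the last value is unconstrained. This freedom
    -- is what makes every fibre stationary.
    append : Cond → L → Cond
    append p α = record { len = suc (len p) ; val = v ; good = g }
      where
      v = splitAt (len p) (val p) (λ _ → α)
      g : ∀ β → β ≤ suc (len p) → (Ctbl β → ⊥) → Good v β
      g β (inj₂ refl) h = ⊥-elim (h (ctbl-suc (len p)))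
      g β (inj₁ l) h = good-cong (λ ξ k → sym (splitAt-< (len p) (val p) (λ _ → α) (<-≤-trans k (<suc⇒≤ l))))
        (good p β (<suc⇒≤ l) h)

    append-≼ : ∀ p α → append p α ≼ p
    append-≼ p α = mk≼ (inj₁ (<suc (len p))) λ ξ h → splitAt-< (len p) (val p) (λ _ → α) h

    append-val : ∀ p α → val (append p α) (len p) ≡ α
    append-val p α = splitAt-≥ (len p) (val p) (λ _ → α) ≤-refl

    descending : ∀ (s : ℕ → Cond) → (∀ n → s (ℕ.suc n) ≼ s n) → ∀ {i j} → i ℕ.≤ j → s j ≼ s i
    descending s d {i} {j} i≤j with ℕₚ.m≤n⇒m<n∨m≡n i≤j
    ... | inj₂ refl = ≼-refl
    descending s d {i} {ℕ.suc j} _ | inj₁ (ℕ.s≤s i≤j) = ≼-trans (d j) (descending s d i≤j)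

    module ω-Union (s : ℕ → Cond) (d : ∀ n → s (ℕ.suc n) ≼ s n) (ν : L)
      (below : ∀ n → len (s n) < ν) (cofinal : ∀ ξ → ξ < ν → Σ[ n ∈ ℕ ] ξ < len (s n)) where

      private
        v : L → L
        v ξ with em {P = Σ[ n ∈ ℕ ] ξ < len (s n)}
        ... | yes (n , _) = val (s n) ξ
        ... | no _ = ξ

        v-≡ : ∀ n ξ → ξ < len (s n) → v ξ ≡ val (s n) ξ
        v-≡ n ξ h with em {P = Σ[ n ∈ ℕ ] ξ < len (s n)}
        ... | no k = ⊥-elim (k (n , h))
        ... | yes (m , k) with ℕₚ.≤-total m n
        ...   | inj₁ m≤n = sym (agree (descending s d m≤n) ξ k)
        ...   | inj₂ n≤m = agree (descending s d n≤m) ξ h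

      union : Cond
      union = record { len = ν ; val = v ; good = g }
        where
        g : ∀ β → β ≤ ν → (Ctbl β → ⊥) → Good v β
        g β (inj₁ β<ν) h = let (n , k) = cofinal β β<ν in
          good-cong (λ ξ l → sym (v-≡ n ξ (<-trans l k))) (good (s n) β (inj₁ k) h)
        -- At the new length ν nothing is required: the lengths of the s n show it to have countable
        -- cofinality.
        g β (inj₂ refl) h = ⊥-elim (h ((λ n → len (s n)) , λ ξ l → let (n , k) = cofinal ξ l in n , inj₁ k , below n))

      union-≼ : ∀ n → union ≼ s n
      union-≼ n = mk≼ (inj₁ (below n)) (v-≡ n)

    -- Conditions of ℚ: a condition of ℙ together with a closed set, whose maximum
    -- is the last point of the domain, of points ξ > δ at which g does not take
    -- a value in [δ, ξ).  The condition of length 0 is the maximum of ℚ.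

    module _ (δ : L) where
      record QCond : Set where
        field
          base : Cond
          club : L → Bool
          shape : len base ≡ 0ₗ ⊎ Σ[ m ∈ L ] len base ≡ suc m × club m ≡ true
          -- This supplies the inequality δ < ν when the closed set has to witness `Good` at a limit
          -- ν of lengths.
          above : ∀ ξ → ξ < len base → club ξ ≡ true → δ < ξ
          closed : Closed club (len base)
          avoids : ∀ ξ → ξ < len base → club ξ ≡ true → Avoids δ (val base ξ) ξ

    module Q (δ : L) where
      open QCond public

      infix 4 _≼Q_
      record _≼Q_ (p q : QCond δ) : Set where
        constructor mk≼Q
        field
          base≼ : base p ≼ base q
          agreeQ : ∀ ξ → ξ < len (base q) → club p ξ ≡ club q ξ
      open _≼Q_ public

      ≼Q-refl : ∀ {p} → p ≼Q p
      ≼Q-refl = mk≼Q ≼-refl λ _ _ → refl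

      ≼Q-trans : ∀ {p q r} → p ≼Q q → q ≼Q r → p ≼Q r
      ≼Q-trans (mk≼Q h k) (mk≼Q h′ k′) = mk≼Q (≼-trans h h′) λ ξ l → trans (k ξ (<-≤-trans l (len≤ h′))) (k′ ξ l)

      rootQ : QCond δ
      rootQ = record
        { base = root ; club = λ _ → true ; shape = inj₁ refl
        ; above = λ ξ h → ⊥-elim (≤⇒≯ (0≤ _) h)
        ; closed = λ _ _ _ _ → refl
        ; avoids = λ ξ h → ⊥-elim (≤⇒≯ (0≤ _) h) }

      rootQ-max : ∀ p → p ≼Q rootQ
      rootQ-max p = mk≼Q (root-max (base p)) λ ξ h → ⊥-elim (≤⇒≯ (0≤ _) h)

      -- Only the point len r is added, with the identity as its value, which is not regressive. All
      -- points strictly between m and len r are left out, so the values of r there are irrelevant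
      -- and r can be any condition that respects c up to m.
      cap : (r : Cond) (m : L) (c : L → Bool) → m < len r → c m ≡ true →
            (∀ ξ → ξ < suc m → c ξ ≡ true → δ < ξ) → Closed c (suc m) →
            (∀ ξ → ξ < suc m → c ξ ≡ true → Avoids δ (val r ξ) ξ) →
            Σ[ q ∈ QCond δ ] base q ≼ r × (∀ ξ → ξ < suc m → club q ξ ≡ c ξ)
      cap r m c m<r cm above closed avoids = q , extend-≼ r _ r≤ , λ ξ → lo
        where
        r≤ : len r ≤ suc (len r)
        r≤ = inj₁ (<suc (len r))
        b = extend r (suc (len r)) r≤
        c′ = splitAt (suc m) c (only (len r))
        lo : ∀ {ξ} → ξ < suc m → c′ ξ ≡ c ξ
        lo = splitAt-< (suc m) c (only (len r))
        hi : ∀ {ξ} → suc m ≤ ξ → c′ ξ ≡ only (len r) ξ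
        hi = splitAt-≥ (suc m) c (only (len r))
        c′r : c′ (len r) ≡ true
        c′r = trans (hi (<⇒suc≤ m<r)) (only-self (len r))
        c′-cases : ∀ ξ → c′ ξ ≡ true → (ξ < suc m × c ξ ≡ true) ⊎ ξ ≡ len r
        c′-cases ξ h with <⊎≥ ξ (suc m)
        ... | inj₁ l = inj₁ (l , trans (sym (lo l)) h)
        ... | inj₂ l = inj₂ (only-elim (len r) ξ (trans (sym (hi l)) h))
        ab : ∀ ξ → c′ ξ ≡ true → δ < ξ
        ab ξ h with c′-cases ξ h
        ... | inj₁ (l , k) = above ξ l k
        ... | inj₂ refl = <-trans (above m (<suc m) cm) m<r
        cl : Closed c′ (suc (len r))
        cl α α<sr lim@((ξ₀ , ξ₀<α) , _) near with <⊎≥ α (suc m)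
        ... | inj₁ l = trans (lo l) (closed α l lim λ ξ k → let (η , ξ<η , η<α , e) = near ξ k in
                η , ξ<η , η<α , trans (sym (lo (<-trans η<α l))) e)
        ... | inj₂ l with near m (<-≤-trans (<suc m) l)
        ...   | η , m<η , η<α , e with c′-cases η e
        ...     | inj₁ (k , _) = ⊥-elim (≤⇒≯ (<suc⇒≤ k) m<η)
        ...     | inj₂ refl = ⊥-elim (≤⇒≯ (<suc⇒≤ α<sr) η<α)
        av : ∀ ξ → c′ ξ ≡ true → Avoids δ (val b ξ) ξ
        av ξ h with c′-cases ξ h
        ... | inj₁ (l , k) = avoids-cong (sym (agree (extend-≼ r _ r≤) ξ (≤-<-trans (<suc⇒≤ l) m<r))) (avoids ξ l k)
        ... | inj₂ refl = λ _ _ reg → <-irrefl (subst (_< len r) (extend-id r _ r≤ ≤-refl) reg)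
        q : QCond δ
        q = record { base = b ; club = c′ ; shape = inj₂ (len r , refl , c′r)
                   ; above = λ ξ _ → ab ξ ; closed = cl ; avoids = λ ξ _ → av ξ }

      start : ∀ p → Σ[ q ∈ QCond δ ] base q ≼ p
      start p = let (q , h , _) = cap r m (only m) (<suc m) (only-self m)
                                    (λ ξ _ k → subst (δ <_) (sym (only-elim m ξ k)) δ<m) cl av
                in q , ≼-trans h (extend-≼ p _ (inj₁ (≤⇒<suc p≤m)))
        where
        -- m exceeds δ and lies outside the domain of p, so its value in the extension is the
        -- identity.
        m = len p ⊔ₗ suc δ
        δ<m : δ < m
        δ<m = <-≤-trans (<suc δ) (≤⊔ʳ (len p) (suc δ))
        p≤m : len p ≤ m
        p≤m = ≤⊔ˡ (len p) (suc δ)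
        r = extend p (suc m) (inj₁ (≤⇒<suc p≤m))
        cl : Closed (only m) (suc m)
        cl α α<sm ((ξ₀ , ξ₀<α) , _) near with near ξ₀ ξ₀<α
        ... | η , _ , η<α , e = ⊥-elim (≤⇒≯ (<suc⇒≤ α<sm) (subst (_< α) (only-elim m η e) η<α))
        av : ∀ ξ → ξ < suc m → only m ξ ≡ true → Avoids δ (val r ξ) ξ
        av ξ _ k _ _ reg with only-elim m ξ k
        ... | refl = <-irrefl (subst (_< m) (extend-id p _ (inj₁ (≤⇒<suc p≤m)) p≤m) reg)

      -- q ↦ base q is a projection from ℚ to ℙ.
      lift≼ : ∀ q r → r ≼ base q → Σ[ q′ ∈ QCond δ ] q′ ≼Q q × base q′ ≼ r
      lift≼ q r r≼q with shape q
      ... | inj₁ e = let (q′ , h) = start r in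
        q′ , mk≼Q (≼-trans h r≼q) (λ ξ k → ⊥-elim (≤⇒≯ (0≤ _) (subst (ξ <_) e k))) , h
      ... | inj₂ (m , e , cm) =
        let to : ∀ ξ → ξ < suc m → ξ < len (base q)
            to ξ = subst (ξ <_) (sym e)
            (q′ , h , k) = cap r m (club q) (<-≤-trans (to m (<suc m)) (len≤ r≼q)) cm
              (λ ξ l → above q ξ (to ξ l))
              (λ α l → closed q α (to α l))
              (λ ξ l x → avoids-cong (sym (agree r≼q ξ (to ξ l))) (avoids q ξ (to ξ l) x))
        in q′ , mk≼Q (≼-trans h r≼q) (λ ξ l → k ξ (subst (ξ <_) e l)) , h

      -- If some member of D attains the supremum ν of the lengths, directedness puts it below all
      -- the others. Otherwise the union of D has length ν, and the point ν is put on top. The union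
      -- of the closed sets is unbounded in ν, so it witnesses `Good` there whatever the cofinality
      -- of ν is.
      module LowerBound (D : QCond δ → Set) (q₀ : QCond δ) (Dq₀ : D q₀)
        (directed : ∀ p q → D p → D q → Σ[ r ∈ QCond δ ] D r × r ≼Q p × r ≼Q q)
        (β : L) (bound : ∀ q → D q → len (base q) ≤ β) where

        private
          lub = least (λ ν → ∀ q → D q → len (base q) ≤ ν) (β , bound)
          ν = proj₁ lub
          ≤ν = proj₁ (proj₂ lub)

          approach : ∀ {ξ} → ξ < ν → Σ[ q ∈ QCond δ ] D q × ξ < len (base q)
          approach {ξ} ξ<ν with em {P = Σ[ q ∈ QCond δ ] D q × ξ < len (base q)}
          ... | yes h = h
          ... | no h = ⊥-elim (proj₂ (proj₂ lub) ξ ξ<ν λ q Dq →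
            [ (λ k → ⊥-elim (h (q , Dq , k))) , (λ k → k) ]′ (<⊎≥ ξ (len (base q))))

          attained : ∀ d → D d → len (base d) ≡ ν → ∀ q → D q → d ≼Q q
          attained d Dd e q Dq with directed d q Dd Dq
          ... | r , Dr , r≼d , r≼q = mk≼Q (≼-tree (base≼ r≼d) (base≼ r≼q) q≤d)
                λ ξ h → trans (sym (agreeQ r≼d ξ (<-≤-trans h q≤d))) (agreeQ r≼q ξ h)
            where
            q≤d : len (base q) ≤ len (base d)
            q≤d = subst (len (base q) ≤_) (sym e) (≤ν q Dq)

          module Unattained (un : ∀ d → D d → len (base d) ≡ ν → ⊥) where
            <ν : ∀ d → D d → len (base d) < ν
            <ν d Dd = [ (λ h → h) , (λ e → ⊥-elim (un d Dd e)) ]′ (≤ν d Dd)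

            piece : ∀ {A : Set} → (QCond δ → L → A) → (L → A) → L → A
            piece f g ξ with em {P = Σ[ q ∈ QCond δ ] D q × ξ < len (base q)}
            ... | yes (q , _) = f q ξ
            ... | no _ = g ξ

            piece-≡ : ∀ {A : Set} (f : QCond δ → L → A) (g : L → A) →
                      (∀ {p q ξ} → p ≼Q q → ξ < len (base q) → f p ξ ≡ f q ξ) →
                      ∀ {q ξ} → D q → ξ < len (base q) → piece f g ξ ≡ f q ξ
            piece-≡ f g f-agree {q} {ξ} Dq h with em {P = Σ[ q ∈ QCond δ ] D q × ξ < len (base q)}
            ... | no k = ⊥-elim (k (q , Dq , h))
            ... | yes (p , Dp , k) with directed p q Dp Dq
            ...   | r , Dr , r≼p , r≼q = trans (sym (f-agree r≼p k)) (f-agree r≼q h)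

            piece-ν : ∀ {A : Set} (f : QCond δ → L → A) (g : L → A) → piece f g ν ≡ g ν
            piece-ν f g with em {P = Σ[ q ∈ QCond δ ] D q × ν < len (base q)}
            ... | yes (q , Dq , h) = ⊥-elim (≤⇒≯ (≤ν q Dq) h)
            ... | no _ = refl

            v : L → L
            -- The defaults, the identity here and `true` for c, take effect at ν: they make the new
            -- top a non-regressive point of the closed set.
            v = piece (λ q → val (base q)) (λ ξ → ξ)
            c : L → Bool
            c = piece club (λ _ → true)
            v-≡ : ∀ {q ξ} → D q → ξ < len (base q) → v ξ ≡ val (base q) ξ
            v-≡ = piece-≡ (λ q → val (base q)) (λ ξ → ξ) (λ h k → agree (base≼ h) _ k)
            c-≡ : ∀ {q ξ} → D q → ξ < len (base q) → c ξ ≡ club q ξ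
            c-≡ = piece-≡ club (λ _ → true) (λ h k → agreeQ h _ k)

            top : ∀ {ξ} → ξ < ν → Σ[ η ∈ L ] ξ < η × η < ν × c η ≡ true × δ < η
            top ξ<ν =
              let (q , Dq , ξ<q) = approach ξ<ν
                  -- Going past suc ξ makes the maximum of the closed set of q′ exceed ξ; past ξ
                  -- alone, it might equal ξ.
                  (q′ , Dq′ , sξ<q′) = approach (≤-<-trans (<⇒suc≤ ξ<q) (<ν q Dq))
              in go q′ Dq′ sξ<q′ (shape q′)
              where
              go : ∀ {ξ} q → D q → suc ξ < len (base q) →
                   len (base q) ≡ 0ₗ ⊎ Σ[ m ∈ L ] len (base q) ≡ suc m × club q m ≡ true →
                   Σ[ η ∈ L ] ξ < η × η < ν × c η ≡ true × δ < η
              go {ξ} q Dq h (inj₁ e) = ⊥-elim (≤⇒≯ (0≤ _) (subst (suc ξ <_) e h))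
              go {ξ} q Dq h (inj₂ (m , e , k)) =
                let m<q = subst (m <_) (sym e) (<suc m) in
                m , <-≤-trans (<suc ξ) (<suc⇒≤ (subst (suc ξ <_) e h)) , <-trans m<q (<ν q Dq) ,
                trans (c-≡ Dq m<q) k , above q m m<q k

            0<ν : 0ₗ < ν
            0<ν = ≤-<-trans (0≤ _) (<ν q₀ Dq₀)

            δ<ν : δ < ν
            δ<ν = let (_ , _ , h , _ , k) = top 0<ν in <-trans k h

            acc-ν : AccPoint c ν
            acc-ν ξ h = let (η , k , k′ , e , _) = top h in η , k , k′ , e

            closed-ν : Closed c ν
            closed-ν α α<ν lim near = let (q , Dq , α<q) = approach α<ν in
              trans (c-≡ Dq α<q) (closed q α α<q lim λ ξ h → let (η , ξ<η , η<α , e) = near ξ h in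
                η , ξ<η , η<α , trans (sym (c-≡ Dq (<-trans η<α α<q))) e)

            avoids-ν : ∀ ξ → ξ < ν → c ξ ≡ true → Avoids δ (v ξ) ξ
            avoids-ν ξ ξ<ν h = let (q , Dq , ξ<q) = approach ξ<ν in
              avoids-cong (sym (v-≡ Dq ξ<q)) (avoids q ξ ξ<q (trans (sym (c-≡ Dq ξ<q)) h))

            b : Cond
            b = record { len = suc ν ; val = v ; good = g }
              where
              g : ∀ γ → γ ≤ suc ν → (Ctbl γ → ⊥) → Good v γ
              g γ (inj₂ refl) h = ⊥-elim (h (ctbl-suc ν))
              g γ (inj₁ l) h with <suc⇒≤ l
              -- The one length at which goodness is not inherited from a member of D.
              ... | inj₂ refl = δ , δ<ν , c , acc-ν , closed-ν , avoids-ν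
              ... | inj₁ γ<ν = let (q , Dq , γ<q) = approach γ<ν in
                good-cong (λ ξ k → sym (v-≡ Dq (<-trans k γ<q))) (good (base q) γ (inj₁ γ<q) h)

            upto : ∀ {ℓ} (Φ : L → Set ℓ) → (∀ ξ → ξ < ν → Φ ξ) → Φ ν → ∀ ξ → ξ < suc ν → Φ ξ
            upto Φ h k ξ l with <suc⇒≤ l
            ... | inj₁ ξ<ν = h ξ ξ<ν
            ... | inj₂ refl = k

            c-ν : c ν ≡ true
            c-ν = piece-ν club (λ _ → true)

            lb : QCond δ
            lb = record
              { base = b ; club = c ; shape = inj₂ (ν , refl , c-ν)
              ; above = upto (λ ξ → c ξ ≡ true → δ < ξ)
                  (λ ξ ξ<ν h → let (q , Dq , ξ<q) = approach ξ<ν in above q ξ ξ<q (trans (sym (c-≡ Dq ξ<q)) h))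
                  (λ _ → δ<ν)
              ; closed = upto (λ α → Lim α → AccPoint c α → c α ≡ true) closed-ν (λ _ _ → c-ν)
              ; avoids = upto (λ ξ → c ξ ≡ true → Avoids δ (v ξ) ξ) avoids-ν
                  (λ _ _ _ reg → <-irrefl (subst (_< ν) (piece-ν (λ q → val (base q)) (λ ξ → ξ)) reg))
              }

            lb-≼ : ∀ q → D q → lb ≼Q q
            lb-≼ q Dq = mk≼Q (mk≼ (inj₁ (<-trans (<ν q Dq) (<suc ν))) λ ξ h → v-≡ Dq h) λ ξ h → c-≡ Dq h

        lowerBound : Σ[ r ∈ QCond δ ] (∀ q → D q → r ≼Q q)
        lowerBound with em {P = Σ[ d ∈ QCond δ ] D d × len (base d) ≡ ν}
        ... | yes (d , Dd , e) = d , attained d Dd e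
        ... | no h = let open Unattained (λ d Dd e → h (d , Dd , e)) in lb , lb-≼

      bit : Bool → L
      bit b = if b then suc 0ₗ else 0ₗ

      bit-inj : ∀ {b b′} → bit b ≡ bit b′ → b ≡ b′
      bit-inj {true} {true} _ = refl
      bit-inj {ffalse} {ffalse} _ = refl
      bit-inj {true} {ffalse} e = ⊥-elim (<-irrefl (subst (0ₗ <_) e (<suc 0ₗ)))
      bit-inj {ffalse} {true} e = ⊥-elim (<-irrefl (subst (0ₗ <_) (sym e) (<suc 0ₗ)))

      codeQ : QCond δ → L
      codeQ q = code (len (base q)) (λ ξ → pair (val (base q) ξ) (bit (club q ξ)))

      codeQ-inj : ∀ {p q} → codeQ p ≡ codeQ q → p ≼Q q
      codeQ-inj {p} {q} e =
        let (l , k) = code-inj {len (base p)} {λ ξ → pair (val (base p) ξ) (bit (club p ξ))}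
                        {len (base q)} {λ ξ → pair (val (base q) ξ) (bit (club q ξ))} e
            at : ∀ ξ → ξ < len (base q) → val (base p) ξ ≡ val (base q) ξ × bit (club p ξ) ≡ bit (club q ξ)
            at ξ h = pair-inj (k ξ (subst (ξ <_) (sym l) h))
        in mk≼Q (mk≼ (inj₂ (sym l)) λ ξ h → proj₁ (at ξ h)) λ ξ h → bit-inj (proj₂ (at ξ h))

      codeQ-cong : ∀ {p q} → p ≼Q q → q ≼Q p → codeQ p ≡ codeQ q
      codeQ-cong {p} {q} h k = code-cong (≤-antisym (len≤ (base≼ k)) (len≤ (base≼ h))) λ ξ l →
        let l′ = <-≤-trans l (len≤ (base≼ k)) in
        trans (cong (λ a → pair a (bit (club p ξ))) (agree (base≼ h) ξ l′))
              (cong (λ a → pair (val (base q) ξ) (bit a)) (agreeQ h ξ l′))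

    codeP : Cond → L
    codeP p = code (len p) (val p)

    codeP-inj : ∀ {p q} → codeP p ≡ codeP q → p ≼ q
    codeP-inj {p} {q} e = let (l , k) = code-inj {len p} {val p} {len q} {val q} e in
      mk≼ (inj₂ (sym l)) λ ξ h → k ξ (subst (ξ <_) (sym l) h)

  mkInjection : ∀ (S : Setoid 0ℓ 0ℓ) x (f : Setoid.Carrier S → Ix x) →
    (∀ {a b} → Setoid._≈_ S a b → el x (f a) ≋ el x (f b)) →
    (∀ {a b} → el x (f a) ≋ el x (f b) → Setoid._≈_ S a b) → Injection S (Elements x)
  mkInjection S (sup A g) f c i = record { to = f ; cong = c ; injective = i }

  unInjection : ∀ (S : Setoid 0ℓ 0ℓ) x → Injection S (Elements x) →
    Σ[ f ∈ (Setoid.Carrier S → Ix x) ] (∀ {a b} → el x (f a) ≋ el x (f b) → Setoid._≈_ S a b)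
  unInjection S (sup A g) i = Injection.to i , Injection.injective i

  -- `chain` below recurses on accessibility proofs; this makes its values independent of them.
  Acc-irrelevant : ∀ {A : Set} {_<_ : A → A → Set} {x} (a b : Acc _<_ x) → a ≡ b
  Acc-irrelevant (acc r) (acc s) =
    cong acc (implicit-extensionality fe (fe λ h → Acc-irrelevant (r h) (s h)))

  -- Preservation of cofinalities by small distributive forcings

  module Extension (𝓖 : Ground) where
    open Conditions 𝓖 public

    -- Distributivity says that no sequences of length less than Λ are added.
    record Nice (M : Model) : Set₂ where
      open Model M
      field
        codeW : W → L
        codeW-inj : ∀ {p q} → codeW p ≡ codeW q → p ⊑ q
        distributive : ∀ p ν (D : L → W → Set₁) → (∀ η → Mono (D η)) →
          (∀ η q → q ⊑ p → Σ[ r ∈ W ] r ⊑ q × D η r) →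
          Σ[ r ∈ W ] r ⊑ p × (∀ η → η < ν → D η r)

    module _ (M : Model) (nice : Nice M) where
      open Theory M
      open Nice nice

      module _ {δ μ ν : V} {f : X} {p : W} (δ-ord : OrdV δ) (μ-cof : CofV δ μ) (ν∊μ : ν ∊ μ)
        (h : Sat (CofinalMap f (chk ν) (chk δ)) p) where

        private
          minimal : ∀ ν → ν ∊ μ → Cof ν δ → ⊥
          minimal = proj₂ (proj₂ μ-cof)

          total : ∀ {q} → q ⊑ p → ∀ a → Σ[ r ∈ W ] r ⊑ q × Σ[ b ∈ Ix δ ] Map f (chk (el ν a)) (chk (el δ b)) r
          total q⊑p a = now (cofinalMap-total (sat-mono (CofinalMap f (chk ν) (chk δ)) q⊑p h) a)

        -- By distributivity one condition decides all the fewer than Λ values of f, which yields a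
        -- cofinal map in V, against the minimality of μ.
        short : ν ∊ Λ → ⊥
        short ν∊Λ = minimal ν ν∊μ (cofinalMap-decided (sat-mono (CofinalMap f (chk ν) (chk δ)) r⊑p h) λ a →
            lower (decided (lab (in-Λ a)) (∊⇒< (∊-congʳ ν (elem νₗ) (lab-≋ ν∊Λ)
               (∊-congˡ ν (lab-≋ (in-Λ a)) (el∊ ν a)))) a (lab-≋ (in-Λ a))))
          where
          νₗ = lab ν∊Λ
          in-Λ : ∀ a → el ν a ∊ Λ
          in-Λ a = proj₁ Λ-ord ν (el ν a) ν∊Λ (el∊ ν a)
          D : L → W → Set₁
          D η r = ∀ a → el ν a ≋ elem η → Lift (lsuc 0ℓ) (Σ[ b ∈ Ix δ ] Map f (chk (el ν a)) (chk (el δ b)) r)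
          dense : ∀ η q → q ⊑ p → Σ[ r ∈ W ] r ⊑ q × D η r
          dense η q q⊑p with em {P = Σ[ a ∈ Ix ν ] el ν a ≋ elem η}
          ... | no k = q , ⊑-refl , λ a e → ⊥-elim (k (a , e))
          ... | yes (a , e) = let (r , r⊑q , b , m) = total q⊑p a in
            r , r⊑q , λ a′ e′ → lift (b , map-cong (chk-eq (el ν a) (el ν a′)
              (≋-trans (el ν a) (elem η) (el ν a′) e (≋-sym (el ν a′) (elem η) e′))) eq-refl m)
          met = distributive p νₗ D (λ η q⊑p k a e → lift (proj₁ (lower (k a e)) , mem-mono q⊑p (proj₂ (lower (k a e))))) dense
          r⊑p = proj₁ (proj₂ met)
          decided = proj₂ (proj₂ met)

        -- There are at most Λ many possibilities for each value of f.
        long : Λ ∊ μ → ⊥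
        long Λ∊μ = let (b* , top) = bounding ν ν∊μ H H-resp
                       (r , r⊑p , a , c , m , le) = now (cofinalMap-cofinal h b*)
                       c∊b* = proj₁ (ord-elem δ-ord (el∊ δ b*)) (bound a) (el δ c)
                                (∊-congˡ (el δ b*) (≋-sym (bound a) (el δ (H a)) (H-≋ a)) (top a)) (possible a r⊑p m)
                   in ∊-irrefl ([ (λ b*∊c → proj₁ (ord-elem δ-ord (el∊ δ b*)) (el δ c) (el δ b*) c∊b* b*∊c)
                                          , (λ e → ∊-congˡ (el δ b*) (≋-sym (el δ b*) (el δ c) e) c∊b*) ]′ le)
          where
          -- An unbounded map would be cofinal, against the minimality of μ. It is applied to Λ, to
          -- bound the possible values of f at one argument, and to ν, to bound these bounds.
          bounding : ∀ κ → κ ∊ μ → (F : Ix κ → Ix δ) → (∀ a a′ → el κ a ≋ el κ a′ → el δ (F a) ≋ el δ (F a′)) →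
                     Σ[ b ∈ Ix δ ] (∀ a → el δ (F a) ∊ el δ b)
          bounding κ κ∊μ F resp with em {P = Σ[ b ∈ Ix δ ] (∀ a → el δ (F a) ∊ el δ b)}
          ... | yes k = k
          ... | no k = ⊥-elim (minimal κ κ∊μ (F , resp , cofinal))
            where
            cofinal : ∀ b → Σ[ a ∈ Ix κ ] el δ b ≤V el δ (F a)
            cofinal b with em {P = Σ[ a ∈ Ix κ ] el δ b ≤V el δ (F a)}
            ... | yes j = j
            ... | no j = ⊥-elim (k (b , λ a → below a (trichotomyV
                    (ord-elem δ-ord (el∊ δ (F a))) (ord-elem δ-ord (el∊ δ b)))))
              where
              below : ∀ a → el δ (F a) ∊ el δ b ⊎ el δ (F a) ≋ el δ b ⊎ el δ b ∊ el δ (F a) → el δ (F a) ∊ el δ b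
              below a (inj₁ i) = i
              below a (inj₂ (inj₁ i)) = ⊥-elim (j (a , inj₂ (≋-sym (el δ (F a)) (el δ b) i)))
              below a (inj₂ (inj₂ i)) = ⊥-elim (j (a , inj₁ i))

          Bounds : Ix ν → V → Set₁
          Bounds a y = Lift (lsuc 0ℓ) (y ∊ δ × (∀ {r b} → r ⊑ p → Map f (chk (el ν a)) (chk (el δ b)) r → el δ b ∊ y))

          Bounds-resp : ∀ a {x y} → x ≋ y → Bounds a x → Bounds a y
          Bounds-resp a {x} {y} e (lift (m , k)) = lift (∊-congˡ δ e m , λ r⊑p n → ∊-congʳ x y e (k r⊑p n))

          bounds-exist : ∀ a → Σ[ y ∈ V ] Bounds a y
          bounds-exist a =
            let (b* , top) = bounding Λ Λ∊μ (λ c → G (lab (el∊ Λ c)))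
                  (λ c c′ e → G-cong (lab-≡ (el∊ Λ c) (≋-trans (el Λ c) (el Λ c′) _ e (lab-≋ (el∊ Λ c′)))))
            in el δ b* , lift (el∊ δ b* , λ {r} r⊑p m →
                 let (c , e) = ∊⇒ix Λ (elem∊ (codeW r))
                     lab≡ : lab (el∊ Λ c) ≡ codeW r
                     lab≡ = lab-≡ (el∊ Λ c) (≋-sym (elem (codeW r)) (el Λ c) e)
                 in ∊-congˡ (el δ b*) (≋-trans _ (el δ (G (codeW r))) _
                      (G-cong lab≡)
                      (G-spec r⊑p m)) (top c))
            where
            -- The codes of conditions enumerate the possible values: a condition deciding the value
            -- contributes it at its code. Conditions with the same code are equivalent and decide
            -- alike.
            Value : L → Set
            Value l = Σ[ r ∈ W ] codeW r ≡ l × r ⊑ p × Σ[ b ∈ Ix δ ] Map f (chk (el ν a)) (chk (el δ b)) r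
            default : Ix δ
            default = proj₁ (proj₂ (proj₂ (total ⊑-refl a)))
            G : L → Ix δ
            G l with em {P = Value l}
            ... | yes (_ , _ , _ , b , _) = b
            ... | no _ = default
            G-cong : ∀ {l m} → l ≡ m → el δ (G l) ≋ el δ (G m)
            G-cong {l} refl = ≋-refl (el δ (G l))
            G-spec : ∀ {r b} → r ⊑ p → Map f (chk (el ν a)) (chk (el δ b)) r → el δ (G (codeW r)) ≋ el δ b
            G-spec {r} {b} r⊑p m with em {P = Value (codeW r)}
            ... | no k = ⊥-elim (k (r , refl , r⊑p , b , m))
            ... | yes (r′ , e , r′⊑p , b′ , m′) =
              cofinalMap-single {f = f} h r⊑p (mem-mono (codeW-inj (sym e)) m′) m

          -- The least bound does not depend on the index a of the argument.
          least-bound : ∀ a → Σ[ y ∈ V ] Bounds a y × (∀ z → z ∊ y → Bounds a z → ⊥)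
          least-bound a = let (y , k) = bounds-exist a in ∊-minimal (Bounds a) (Bounds-resp a) y k

          bound : Ix ν → V
          bound a = proj₁ (least-bound a)

          bound∊ : ∀ a → bound a ∊ δ
          bound∊ a = proj₁ (lower (proj₁ (proj₂ (least-bound a))))

          possible : ∀ a {r b} → r ⊑ p → Map f (chk (el ν a)) (chk (el δ b)) r → el δ b ∊ bound a
          possible a = proj₂ (lower (proj₁ (proj₂ (least-bound a))))

          H : Ix ν → Ix δ
          H a = proj₁ (∊⇒ix δ (bound∊ a))

          H-≋ : ∀ a → bound a ≋ el δ (H a)
          H-≋ a = proj₂ (∊⇒ix δ (bound∊ a))

          H-resp : ∀ a a′ → el ν a ≋ el ν a′ → el δ (H a) ≋ el δ (H a′)
          H-resp a a′ e = ≋-trans (el δ (H a)) (bound a) (el δ (H a′)) (≋-sym (bound a) (el δ (H a)) (H-≋ a))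
                              (≋-trans (bound a) (bound a′) (el δ (H a′)) same (H-≋ a′))
            where
            move : ∀ {a a′} → el ν a ≋ el ν a′ → ∀ {z} → Bounds a z → Bounds a′ z
            move {a} {a′} e (lift (m , k)) = lift (m , λ r⊑p n →
              k r⊑p (map-cong (chk-eq (el ν a′) (el ν a) (≋-sym (el ν a) (el ν a′) e)) eq-refl n))
            cases : bound a ∊ bound a′ ⊎ bound a ≋ bound a′ ⊎ bound a′ ∊ bound a → bound a ≋ bound a′
            cases (inj₁ k) = ⊥-elim (proj₂ (proj₂ (least-bound a′)) (bound a) k
                               (move e (proj₁ (proj₂ (least-bound a)))))
            cases (inj₂ (inj₁ k)) = k
            cases (inj₂ (inj₂ k)) = ⊥-elim (proj₂ (proj₂ (least-bound a)) (bound a′) k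
                                      (move (≋-sym (el ν a) (el ν a′) e) (proj₁ (proj₂ (least-bound a′)))))
            same : bound a ≋ bound a′
            same = cases (trichotomyV (ord-elem δ-ord (bound∊ a)) (ord-elem δ-ord (bound∊ a′)))

      nice⇒preserves : Preserves
      nice⇒preserves {δ} {μ} {ν} o c ν∊μ h with trichotomyV (proj₁ c) Λ-ord
      ... | inj₁ μ∊Λ = short o c ν∊μ h (proj₁ Λ-ord μ ν μ∊Λ ν∊μ)
      ... | inj₂ (inj₁ e) = short o c ν∊μ h (∊-congʳ μ Λ e ν∊μ)
      ... | inj₂ (inj₂ Λ∊μ) = long o c ν∊μ h Λ∊μ

    -- The two forcings, their closure and distributivity

    ℙ : Forcing
    ℙ = record
      { preorder = record
        { Carrier = Cond ; _≈_ = λ p q → p ≼ q × q ≼ p ; _≲_ = _≼_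
        ; isPreorder = record
          { isEquivalence = record
            { refl = ≼-refl , ≼-refl
            ; sym = λ { (h , k) → k , h }
            ; trans = λ { (h , k) (h′ , k′) → ≼-trans h h′ , ≼-trans k′ k } }
          ; reflexive = proj₁ ; trans = ≼-trans } }
      ; 𝟙 = root ; 𝟙-max = root-max }

    module Quotient (δ : L) where
      open Q δ public

      ℚ : Forcing
      ℚ = record
        { preorder = record
          { Carrier = QCond δ ; _≈_ = λ p q → p ≼Q q × q ≼Q p ; _≲_ = _≼Q_
          ; isPreorder = record
            { isEquivalence = record
              { refl = ≼Q-refl , ≼Q-refl
              ; sym = λ { (h , k) → k , h }
              ; trans = λ { (h , k) (h′ , k′) → ≼Q-trans h h′ , ≼Q-trans k′ k } }
            ; reflexive = proj₁ ; trans = ≼Q-trans } }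
        ; 𝟙 = rootQ ; 𝟙-max = rootQ-max }

      ℚ-size : SizeAtMost ℚ Λ
      ℚ-size = mkInjection _ Λ (λ q → proj₁ (codeQ q))
        (λ { (h , k) → elem-cong (codeQ-cong h k) })
        (λ {p} {q} e → let e′ = elem-inj e in codeQ-inj e′ , codeQ-inj (sym e′))

      ℚ-closed : DirectedClosed ℚ Λ
      ℚ-closed D ((q₀ , Dq₀) , dir) (α , α∊Λ , inj) = lowerBound
        where
        i = unInjection _ α inj
        -- The lengths of the members of D, indexed by the ordinals below α that the injection
        -- assigns to them; elsewhere the value is arbitrary.
        F : L → L
        F ξ with em {P = Σ[ d ∈ Σ (QCond δ) D ] el α (proj₁ i d) ≋ elem ξ}
        ... | yes ((q , _) , _) = len (base q)
        ... | no _ = ξ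
        β = bounded (lab α∊Λ) F
        bound : ∀ q → D q → len (base q) ≤ proj₁ β
        bound q Dq = inj₁ (subst (_< proj₁ β) F≡ (proj₂ β ξ (∊⇒< (∊-congʳ α _ (lab-≋ α∊Λ) (∊-congˡ α (lab-≋ m) (el∊ α a))))))
          where
          a = proj₁ i (q , Dq)
          m : el α a ∊ Λ
          m = proj₁ Λ-ord α (el α a) α∊Λ (el∊ α a)
          ξ = lab m
          F≡ : F ξ ≡ len (base q)
          F≡ with em {P = Σ[ d ∈ Σ (QCond δ) D ] el α (proj₁ i d) ≋ elem ξ}
          ... | no k = ⊥-elim (k ((q , Dq) , lab-≋ m))
          ... | yes (d , e) with proj₂ i (≋-trans (el α (proj₁ i d)) (elem ξ) (el α a) e (≋-sym (el α a) (elem ξ) (lab-≋ m)))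
          ...   | h , k = ≤-antisym (len≤ (base≼ k)) (len≤ (base≼ h))
        open LowerBound D q₀ Dq₀ dir (proj₁ β) bound

      -- A descending sequence that enters D η at stage η and takes a lower bound of all previous
      -- stages before that. `meet` and `step` fall back to default values, so the sequence can be
      -- defined before `spec` shows, by the same recursion, that the lower bounds exist.
      module Chain (q₀ : QCond δ) (D : L → QCond δ → Set₁)
        (D-mono : ∀ η {p q} → q ≼Q p → D η p → D η q)
        (D-dense : ∀ η q → q ≼Q q₀ → Σ[ r ∈ QCond δ ] r ≼Q q × D η r) where

        private
          meet : (QCond δ → Set) → QCond δ
          meet E with em {P = Σ[ r ∈ QCond δ ] (∀ q → E q → r ≼Q q)}
          ... | yes (r , _) = r
          ... | no _ = q₀

          meet-≼ : ∀ E → Σ[ r ∈ QCond δ ] (∀ q → E q → r ≼Q q) → ∀ q → E q → meet E ≼Q q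
          meet-≼ E h with em {P = Σ[ r ∈ QCond δ ] (∀ q → E q → r ≼Q q)}
          ... | yes (_ , k) = k
          ... | no k = ⊥-elim (k h)

          step : L → QCond δ → QCond δ
          step η q with em {P = Σ[ r ∈ QCond δ ] r ≼Q q × D η r}
          ... | yes (r , _) = r
          ... | no _ = q

          step-spec : ∀ η q → q ≼Q q₀ → step η q ≼Q q × D η (step η q)
          step-spec η q h with em {P = Σ[ r ∈ QCond δ ] r ≼Q q × D η r}
          ... | yes (_ , k) = k
          ... | no k = ⊥-elim (k (D-dense η q h))

          chain : ∀ η → Acc _<_ η → QCond δ
          chain η (acc rs) = step η (meet λ q → q ≡ q₀ ⊎ Σ[ ζ ∈ L ] Σ[ h ∈ ζ < η ] q ≡ chain ζ (rs h))

          Spec : ∀ η → Acc _<_ η → Set₁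
          Spec η a = (chain η a ≼Q q₀ × (∀ ζ b → ζ < η → chain η a ≼Q chain ζ b)) × D η (chain η a)

          spec : ∀ η a → Spec η a
          spec η (acc rs) = (≼Q-trans c≼m m≼q₀ , λ ζ b h → subst (λ b → _ ≼Q chain ζ b) (Acc-irrelevant (rs h) b)
                               (≼Q-trans c≼m (m≼ _ (inj₂ (ζ , h , refl))))) , dd
            where
            E : QCond δ → Set
            E q = q ≡ q₀ ⊎ Σ[ ζ ∈ L ] Σ[ h ∈ ζ < η ] q ≡ chain ζ (rs h)
            directed : ∀ p q → E p → E q → Σ[ r ∈ QCond δ ] E r × r ≼Q p × r ≼Q q
            directed p q (inj₁ refl) (inj₁ refl) = q₀ , inj₁ refl , ≼Q-refl , ≼Q-refl
            directed p q (inj₁ refl) (inj₂ (ζ , h , refl)) =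
              q , inj₂ (ζ , h , refl) , proj₁ (proj₁ (spec ζ (rs h))) , ≼Q-refl
            directed p q (inj₂ (ζ , h , refl)) (inj₁ refl) =
              p , inj₂ (ζ , h , refl) , ≼Q-refl , proj₁ (proj₁ (spec ζ (rs h)))
            directed p q (inj₂ (ζ , h , refl)) (inj₂ (ζ′ , h′ , refl)) with compare ζ ζ′
            ... | inj₁ l = q , inj₂ (ζ′ , h′ , refl) , proj₂ (proj₁ (spec ζ′ (rs h′))) ζ (rs h) l , ≼Q-refl
            ... | inj₂ (inj₂ l) = p , inj₂ (ζ , h , refl) , ≼Q-refl , proj₂ (proj₁ (spec ζ (rs h))) ζ′ (rs h′) l
            ... | inj₂ (inj₁ refl) = p , inj₂ (ζ , h , refl) , ≼Q-refl ,
                    subst (λ b → chain ζ (rs h) ≼Q chain ζ b) (Acc-irrelevant (rs h) (rs h′)) ≼Q-refl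
            F : L → L
            F ζ = len (base (chain ζ (<-wellFounded ζ)))
            β = bounded η F
            bound : ∀ q → E q → len (base q) ≤ len (base q₀) ⊔ₗ proj₁ β
            bound q (inj₁ refl) = ≤⊔ˡ _ _
            bound q (inj₂ (ζ , h , refl)) = ≤-trans (inj₁ (subst (λ b → len (base (chain ζ b)) < proj₁ β)
              (Acc-irrelevant (<-wellFounded ζ) (rs h)) (proj₂ β ζ h))) (≤⊔ʳ _ _)
            open LowerBound E q₀ (inj₁ refl) directed _ bound
            m≼ : ∀ q → E q → meet E ≼Q q
            m≼ = meet-≼ E lowerBound
            m≼q₀ = m≼ q₀ (inj₁ refl)
            c≼m = proj₁ (step-spec η (meet E) m≼q₀)
            dd = proj₂ (step-spec η (meet E) m≼q₀)

        result : ∀ ν → Σ[ r ∈ QCond δ ] r ≼Q q₀ × (∀ η → η < ν → D η r)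
        result ν = let a = <-wellFounded ν in chain ν a , proj₁ (proj₁ (spec ν a)) , λ η h →
          D-mono η (proj₂ (proj₁ (spec ν a)) η (<-wellFounded η) h) (proj₂ (spec η (<-wellFounded η)))

      ℚ-nice : Nice (FM ℚ)
      ℚ-nice = record { codeW = codeQ ; codeW-inj = codeQ-inj ; distributive = λ p ν D mono dense →
        Chain.result p D (λ η h → mono η h) dense ν }

    ℙ-nice : Nice (FM ℙ)
    ℙ-nice = record { codeW = codeP ; codeW-inj = codeP-inj ; distributive = dist }
      where
      -- Any δ would do: for each of them ℚ projects to ℙ, and distributivity passes along the
      -- projection.
      open Quotient 0ₗ
      dist : ∀ p ν (D : L → Cond → Set₁) → (∀ η → Model.Mono (FM ℙ) (D η)) →
             (∀ η q → q ≼ p → Σ[ r ∈ Cond ] r ≼ q × D η r) → Σ[ r ∈ Cond ] r ≼ p × (∀ η → η < ν → D η r)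
      dist p ν D mono dense =
        let (q₀ , h) = start p
            (q , k , d) = Chain.result q₀ (λ η q → D η (base q)) (λ η l → mono η (base≼ l))
              (λ η q l → let (r , r≼q , d) = dense η (base q) (≼-trans (base≼ l) h)
                             (q′ , m , n) = lift≼ q r r≼q in q′ , m , mono η n d) ν
        in base q , ≼-trans (base≼ k) h , d

    -- R β s β′ stands for one round of a construction: s decides what is required of the ordinals
    -- below β, with all witnesses below β′. The two closure properties let the outcome survive
    -- later rounds and larger bounds.
    record Step (R : L → Cond → L → Set₁) : Set₁ where
      field
        step-mono : ∀ {β s r β′} → r ≼ s → R β s β′ → R β r β′
        step-up : ∀ {β s β′ β″} → β′ ≤ β″ → R β s β′ → R β s β″

    record Iterate (R : L → Cond → L → Set₁) (p : Cond) (β₀ : L) : Set₁ where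
      field
        limit : Cond
        limit≼ : limit ≼ p
        seq : ℕ → L
        seq-zero : β₀ ≤ seq 0
        seq-< : ∀ n → seq n < seq (ℕ.suc n)
        seq-below : ∀ n → seq n < len limit
        seq-cofinal : ∀ ξ → ξ < len limit → Σ[ n ∈ ℕ ] ξ ≤ seq n
        seq-step : ∀ n → R (seq n) limit (seq (ℕ.suc n))

      len-lim : Lim (len limit)
      len-lim = (seq 0 , seq-below 0) , λ ξ h → let (n , le) = seq-cofinal ξ h in
        ≤-<-trans (<⇒suc≤ (≤-<-trans le (seq-< n))) (seq-below (ℕ.suc n))

      len-S : Sₗ (len limit)
      len-S = ω-limit⇒S (len limit) seq len-lim seq-below seq-cofinal

      seq-above : ∀ ξ → ξ < len limit → Σ[ n ∈ ℕ ] ξ < seq n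
      seq-above ξ h = let (n , le) = seq-cofinal ξ h in ℕ.suc n , ≤-<-trans le (seq-< n)

    -- Lengths and bounds are interleaved, so both sequences have the same supremum. It is the
    -- length of the union and has cofinality ω; therefore the union is a condition, and its length
    -- lies in S.
    iterate : ∀ {R} → Step R → ∀ {p} → (∀ β s → s ≼ p → Σ[ s′ ∈ Cond ] s′ ≼ s × Σ[ β′ ∈ L ] R β s′ β′) →
              ∀ β₀ → Iterate R p β₀
    iterate {R} R-step {p} h β₀ = record
      { limit = union
      ; limit≼ = ≼-trans (union-≼ 0) (sub 0)
      ; seq = b ; seq-zero = ≤-refl
      ; seq-< = λ n → ≤-<-trans (proj₁ (facts n)) (proj₁ (proj₂ (facts n)))
      ; seq-below = b<ξ ; seq-cofinal = proj₂ (proj₂ sup-b)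
      ; seq-step = λ n → step-mono (union-≼ (ℕ.suc n)) (proj₂ (proj₂ (facts n))) }
      where
      open Step R-step
      State : Set
      State = Σ[ s ∈ Cond ] s ≼ p × L
      next : (x : State) → Σ[ y ∈ State ] proj₁ y ≼ proj₁ x ×
             (proj₂ (proj₂ x) ≤ len (proj₁ y) × len (proj₁ y) < proj₂ (proj₂ y) ×
              R (proj₂ (proj₂ x)) (proj₁ y) (proj₂ (proj₂ y)))
      next (s , s≼p , β) =
        let (s₁ , s₁≼s , β≤) = lengthen s β
            (s₂ , s₂≼s₁ , β′ , r) = h β s₁ (≼-trans s₁≼s s≼p)
            s₂≼s = ≼-trans s₂≼s₁ s₁≼s
        in (s₂ , ≼-trans s₂≼s s≼p , suc (len s₂ ⊔ₗ β′)) , s₂≼s ,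
           ≤-trans β≤ (len≤ s₂≼s₁) , ≤⇒<suc (≤⊔ˡ (len s₂) β′) ,
           step-up (≤-trans (≤⊔ʳ (len s₂) β′) (inj₁ (<suc _))) r
      state : ℕ → State
      state zero = p , ≼-refl , β₀
      state (ℕ.suc n) = proj₁ (next (state n))
      s : ℕ → Cond
      s n = proj₁ (state n)
      b : ℕ → L
      b n = proj₂ (proj₂ (state n))
      sub : ∀ n → s n ≼ p
      sub n = proj₁ (proj₂ (state n))
      facts : ∀ n → b n ≤ len (s (ℕ.suc n)) × len (s (ℕ.suc n)) < b (ℕ.suc n) × R (b n) (s (ℕ.suc n)) (b (ℕ.suc n))
      facts n = proj₂ (proj₂ (next (state n)))
      desc : ∀ n → s (ℕ.suc n) ≼ s n
      desc n = proj₁ (proj₂ (next (state n)))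
      sup-b = ω-supremum b
      ξ = proj₁ sup-b
      b<ξ : ∀ n → b n < ξ
      b<ξ = proj₁ (proj₂ sup-b)
      below : ∀ n → len (s n) < ξ
      below n = <-trans (≤-<-trans (len≤ (desc n)) (proj₁ (proj₂ (facts n)))) (b<ξ (ℕ.suc n))
      cofinal : ∀ η → η < ξ → Σ[ n ∈ ℕ ] η < len (s n)
      cofinal η η<ξ = let (n , le) = proj₂ (proj₂ sup-b) η η<ξ in
        ℕ.suc (ℕ.suc n) , ≤-<-trans le (<-≤-trans (≤-<-trans (proj₁ (facts n)) (proj₁ (proj₂ (facts n)))) (proj₁ (facts (ℕ.suc n))))
      open ω-Union s desc ξ below cofinal

  -- Clubs and stationary sets through forced membership

  module Stationarity (𝓖 : Ground) where
    open Extension 𝓖 public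

    module Stat (M : Model) where
      open Theory M public

      ě : L → X
      ě ξ = chk (elem ξ)

      ě-inj : ∀ {ξ η p} → Eq (ě ξ) (ě η) p → ξ ≡ η
      ě-inj {ξ} {η} e = elem-inj (chk-eq⁻¹ (elem ξ) (elem η) e)

      elimΛ : ∀ {x p} → Mem x (chk Λ) p → Dense p (λ r → Σ[ ξ ∈ L ] Eq x (ě ξ) r)
      elimΛ m = dmap (chk-elim′ Λ m) λ { _ (u , u∊Λ , e) →
        lab u∊Λ , eq-trans e (chk-eq u (elem (lab u∊Λ)) (lab-≋ u∊Λ)) }

      module At (g : V) (g-ord : OrdV g) (g⊆Λ : ∀ y → y ∊ g → y ∊ Λ) where

        elim-g : ∀ {x p} → Mem x (chk g) p → Dense p (λ r → Σ[ ξ ∈ L ] (elem ξ ∊ g) × Eq x (ě ξ) r)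
        elim-g m = dmap (chk-elim′ g m) λ { _ (u , u∊g , e) → let u∊Λ = g⊆Λ u u∊g in
          lab u∊Λ , ∊-congˡ g (lab-≋ u∊Λ) u∊g , eq-trans e (chk-eq u (elem (lab u∊Λ)) (lab-≋ u∊Λ)) }

        -- N ξ r is read as r putting ξ into the club. N need not be local, which is why `closed`
        -- only asks for N α densely. Clubs in this form can be moved between ℙ and ℚ without
        -- translating names.
        record ClubSem (N : L → W → Set) (p : W) : Set where
          field
            unbounded : ∀ β → elem β ∊ g → Dense p (λ r → Σ[ η ∈ L ] (elem η ∊ g) × β ≤ η × N η r)
            closed : ∀ α → elem α ∊ g → Lim α → ∀ {q} → q ⊑ p →
              (∀ β → β < α → Dense q (λ r → Σ[ η ∈ L ] η < α × β ≤ η × N η r)) → Dense q (N α)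
        open ClubSem public

        clubSem-mono : ∀ {N} → Mono (ClubSem N)
        clubSem-mono q⊑p c = record
          { unbounded = λ β h → dense-mono q⊑p (unbounded c β h)
          ; closed = λ α h l r⊑q → closed c α h l (⊑-trans r⊑q q⊑p) }

        StatSem : (L → W → Set) → W → Set₁
        StatSem T p = ∀ (N : L → W → Set) → (∀ ξ → Mono (N ξ)) → ∀ {q} → q ⊑ p → ClubSem N q →
          Dense q (λ r → Σ[ ξ ∈ L ] (elem ξ ∊ g) × N ξ r × T ξ r)

        statSem-mono : ∀ {T} → Mono (StatSem T)
        statSem-mono q⊑p s N mono r⊑q = s N mono (⊑-trans r⊑q q⊑p)

        unbounded-elim : ∀ {C p} → Sat (Unbounded C (chk g)) p → ∀ β → elem β ∊ g →
                         Dense p (λ r → Σ[ η ∈ L ] (elem η ∊ g) × β ≤ η × Mem (ě η) C r)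
        unbounded-elim h β β∊g = bind (h (ě β) _ ⊑-refl (lift (chk-mem g β∊g))) λ { _ (η , lift m , lift n , le) →
          dmap (elim-g n) λ { s⊑r (ξ , ξ∊g , e) →
            ξ , ξ∊g , ≤V⇒≤ (le-chk⁻¹ (le-cong eq-refl e (sat-mono (ě β ≤ₒ η) s⊑r le))) ,
            mem-cong e eq-refl (mem-mono s⊑r m) } }

        unbounded-intro : ∀ {C p} → (∀ β → elem β ∊ g →
                          Dense p (λ r → Σ[ η ∈ L ] (elem η ∊ g) × β ≤ η × Mem (ě η) C r)) →
                          Sat (Unbounded C (chk g)) p
        unbounded-intro h x q q⊑p (lift m) = bind (elim-g m) λ { r⊑q (β , β∊g , e) →
          dmap (dense-mono (⊑-trans r⊑q q⊑p) (h β β∊g)) λ { s⊑r (η , η∊g , le , k) →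
            ě η , lift k , lift (chk-mem g η∊g) ,
            le-cong (eq-sym (eq-mono s⊑r e)) eq-refl (le-chk (≤⇒≤V le)) } }

      module AtL (γ : L) = At (elem γ) (elem-ord γ) (λ y → ∊elem⇒∊Λ γ {y})
      module AtΛ = At Λ Λ-ord (λ y h → h)

      unbounded-cong : ∀ {C C′ δ δ′ p} → Eq C C′ p → Eq δ δ′ p → Sat (Unbounded C δ) p → Sat (Unbounded C′ δ′) p
      unbounded-cong {C} {C′} {δ} {δ′} e d = sat-cong (unboundedᶠ true ffalse) (two-eq e d)

      stationary-cong : ∀ {C C′ δ δ′ p} → Eq C C′ p → Eq δ δ′ p → Sat (Stationary C δ) p → Sat (Stationary C′ δ′) p
      stationary-cong {C} {C′} {δ} {δ′} e d = sat-cong (stationaryᶠ true ffalse) (two-eq e d)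

      reflects-cong : ∀ {C C′ δ δ′ p} → Eq C C′ p → Eq δ δ′ p → Sat (Reflects C δ) p → Sat (Reflects C′ δ′) p
      reflects-cong {C} {C′} {δ} {δ′} e d = sat-cong (reflectsᶠ true ffalse) (two-eq e d)

      uncountable-cong : ∀ {γ γ′ p} → Eq γ γ′ p → Sat (UncountableCofinality γ) p → Sat (UncountableCofinality γ′) p
      uncountable-cong {γ} {γ′} e = sat-cong (uncountableCofinalityᶠ tt) (λ _ → e)

      stationarySubset-cong : ∀ {Λ S T T′ p} → Eq T T′ p → Sat (StationarySubset Λ S T) p → Sat (StationarySubset Λ S T′) p
      stationarySubset-cong {Λ} {S} {T} {T′} e =
        sat-cong (stationarySubsetᶠ nothing (just true) (just ffalse)) {two S T ▸ Λ} {two S T′ ▸ Λ}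
          λ { nothing → eq-refl ; (just v) → two-eq eq-refl e v }

      module StatAt (g : V) (g-ord : OrdV g) (g⊆Λ : ∀ y → y ∊ g → y ∊ Λ) where
        open At g g-ord g⊆Λ

        -- A monotone family N of predicates plays the role of a name of a subset of g.
        module _ (N : L → W → Set) (N-mono : ∀ ξ → Mono (N ξ)) where
          private
            C : X
            C = mk L ě (λ ξ r → (elem ξ ∊ g) × N ξ r)

            C-elim : ∀ {z p} → Mem z C p → Dense p (λ r → Σ[ ξ ∈ L ] ((elem ξ ∊ g) × N ξ r) × Eq z (ě ξ) r)
            C-elim = mk-elim λ ξ q⊑p (m , n) → m , N-mono ξ q⊑p n

            C-intro : ∀ {z p} → Dense p (λ r → Σ[ ξ ∈ L ] ((elem ξ ∊ g) × N ξ r) × Eq z (ě ξ) r) → Mem z C p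
            C-intro = mk-intro

            C-ě : ∀ {ξ p} → Mem (ě ξ) C p → Dense p (N ξ)
            C-ě m = dmap (C-elim m) λ { {r} _ (η , (_ , n) , e) → subst (λ ζ → N ζ r) (sym (ě-inj e)) n }

          club-name : ∀ {p} → ClubSem N p → Sat (Club C (chk g)) p
          club-name c =
            (λ z q q⊑p (lift m) → lift (mem-by (C-elim m) λ { _ (ξ , (ξ∊g , _) , e) →
               mem-cong (eq-sym e) eq-refl (chk-mem g ξ∊g) })) ,
            unbounded-intro {C = C} (λ β β∊g → dmap (unbounded c β β∊g) λ { _ (η , η∊g , le , n) →
               η , η∊g , le , C-intro λ s s⊑r → s , ⊑-refl , η , (η∊g , N-mono η s⊑r n) , eq-refl }) ,
            (λ x q q⊑p (lift m) r r⊑q l s s⊑r u → lift (mem-dense (bind (elim-g (mem-mono (⊑-trans s⊑r r⊑q) m))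
               λ { t⊑s (α , α∊g , e) →
               let lim = limV⇒lim α (limit-chk⁻¹ (elem α) (limit-cong e (sat-mono (Limit x) (⊑-trans t⊑s s⊑r) l)))
                   u′ = unbounded-cong eq-refl e (sat-mono (Unbounded C x) t⊑s u)
                   t⊑p = ⊑-trans t⊑s (⊑-trans s⊑r (⊑-trans r⊑q q⊑p))
               in here mem-mono (C-intro (dmap (closed c α α∊g lim t⊑p λ β β<α →
                    bind (AtL.unbounded-elim α {C = C} u′ β (<⇒∊ β<α)) λ { _ (η , η<α , le , m′) →
                      dmap (C-ě m′) λ _ n → η , ∊⇒< η<α , le , n })
                    λ a⊑t n → α , (α∊g , n) , eq-mono a⊑t e)) })))

          stationary-elim : ∀ {T p q} → Sat (Stationary T (chk g)) p → q ⊑ p → ClubSem N q →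
                            Dense q (λ r → Σ[ ξ ∈ L ] (elem ξ ∊ g) × N ξ r × Mem (ě ξ) T r)
          stationary-elim h q⊑p c = bind (h C _ q⊑p (club-name c)) λ { _ (x , lift m , lift k) →
            dmap (C-elim m) λ { s⊑r (ξ , (ξ∊g , n) , e) →
              ξ , ξ∊g , n , mem-cong e eq-refl (mem-mono s⊑r k) } }

        stationary⇒ : ∀ {T p} → Sat (Stationary T (chk g)) p → StatSem (λ ξ → Mem (ě ξ) T) p
        stationary⇒ h N mono q⊑p c = stationary-elim N mono h q⊑p c

        ⇒stationary : ∀ {T p} → StatSem (λ ξ → Mem (ě ξ) T) p → Sat (Stationary T (chk g)) p
        ⇒stationary h C q q⊑p (_ , u , k) =
          dmap (h (λ ξ → Mem (ě ξ) C) (λ ξ → mem-mono) q⊑p club) λ { _ (ξ , _ , m , n) → ě ξ , lift m , lift n }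
          where
          club : ClubSem (λ ξ → Mem (ě ξ) C) q
          club = record
            { unbounded = λ β β∊g → unbounded-elim u β β∊g
            ; closed = λ α α∊g lim {r} r⊑q hyp → here mem-mono (lower (k (ě α) r r⊑q (lift (chk-mem g α∊g))
                r ⊑-refl (limit-chk (elem α) (lim⇒limV α lim)) r ⊑-refl
                (AtL.unbounded-intro α {C = C} λ β β<α → dmap (hyp β (∊⇒< β<α)) λ { _ (η , η<α , le , m) →
                   η , <⇒∊ η<α , le , m }))) }

    -- Failure of uDSR(1,S) in the extension by ℙ

    module MP = Stat (FM ℙ)
    module PΛ = MP.AtΛ
    module PSΛ = MP.StatAt Λ Λ-ord (λ y h → h)

    module _ where
      open MP

      inFibre : L → L → Cond → Set
      inFibre α ξ p = Sₗ ξ × ξ < len p × val p ξ ≡ α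

      inFibre-mono : ∀ α ξ → Mono (inFibre α ξ)
      inFibre-mono α ξ q≼p (s , l , e) = s , <-≤-trans l (len≤ q≼p) , trans (agree q≼p ξ l) e

      fibre : L → X
      fibre α = mk L ě (inFibre α)

      fibre-elim : ∀ {α ξ p} → Mem (ě ξ) (fibre α) p → Dense p (inFibre α ξ)
      fibre-elim {α} m = dmap (mk-elim (inFibre-mono α) m) λ { {r} _ (η , h , e) →
        subst (λ ζ → inFibre α ζ r) (sym (ě-inj e)) h }

      fibre-intro : ∀ {α ξ p} → inFibre α ξ p → Mem (ě ξ) (fibre α) p
      fibre-intro {α} {ξ} h = mk-intro λ q q≼p → q , ⊑-refl , ξ , inFibre-mono α ξ q≼p h , eq-refl

      -- In ω steps a condition is reached whose length ξ is a limit of points forced into the club,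
      -- and lies in S. The value at ξ is still free, so `append` can make it α.
      fibre-stationary : ∀ α {p} → Sat (StationarySubset (chk Λ) (chk S) (fibre α)) p
      fibre-stationary α =
        (λ z q _ (lift m) → lift (mem-by (mk-elim (inFibre-mono α) m) λ { _ (ξ , (s , _) , e) →
           mem-cong (eq-sym e) eq-refl (chk-mem S (S⇒∊ s)) })) ,
        PSΛ.⇒stationary stat
        where
        stat : ∀ {p} → PΛ.StatSem (λ ξ → Mem (ě ξ) (fibre α)) p
        stat N N-mono _ club q₁ q₁≼q =
          let (r′ , r′≼ , n) = PΛ.closed club ξ (elem∊ ξ) (len-lim it) (≼-trans (limit≼ it) q₁≼q) approach
                                 (append r α) (append-≼ r α)
          in r′ , ≼-trans r′≼ (≼-trans (append-≼ r α) (limit≼ it)) , ξ , elem∊ ξ , n ,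
             fibre-intro (inFibre-mono α ξ r′≼ (len-S it , <suc ξ , append-val r α))
          where
          R : L → Cond → L → Set₁
          R β s β′ = Lift (lsuc 0ℓ) (Σ[ η ∈ L ] β ≤ η × η < β′ × N η s)
          R-step : Step R
          R-step = record
            { step-mono = λ { r≼s (lift (η , a , b , n)) → lift (η , a , b , N-mono η r≼s n) }
            ; step-up = λ { le (lift (η , a , b , n)) → lift (η , a , <-≤-trans b le , n) } }
          it : Iterate R q₁ 0ₗ
          it = iterate R-step (λ β s s≼ →
            let (s′ , s′≼s , η , _ , le , n) = PΛ.unbounded club β (elem∊ β) s (≼-trans s≼ q₁≼q) in
            s′ , s′≼s , suc η , lift (η , le , <suc η , n)) 0ₗ
          open Iterate
          r = limit it
          ξ = len r
          approach : ∀ β → β < ξ → Dense r (λ s → Σ[ η ∈ L ] η < ξ × β ≤ η × N η s)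
          approach β β<ξ s s≼r =
            let (n , le) = seq-cofinal it β β<ξ
                (η , a , b , k) = lower (seq-step it n)
            in s , ≼-refl , η , <-trans b (seq-below it (ℕ.suc n)) , ≤-trans le a , N-mono η s≼r k

      fibres : X
      fibres = graph L ě fibre fullN

      fibres-functionOn : ∀ {p} → Sat (FunctionOn fibres (chk Λ)) p
      fibres-functionOn = graph-functionOn (λ _ _ _ → tt)
        (λ _ m → dmap (elimΛ m) λ { _ (ξ , e) → ξ , tt , e })
        (λ {ξ} _ _ → chk-mem Λ (elem∊ ξ))
        (λ {ξ} {η} {q} _ _ _ e → subst (λ ζ → Eq (fibre ξ) (fibre ζ) q) (ě-inj e) eq-refl)

      fibres-maps : ∀ α {p} → Sat (Maps fibres (ě α) (fibre α)) p
      fibres-maps α = ⇒maps (graph-intro (λ _ _ _ → tt) α tt)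

      ℙ-preserves : Preserves
      ℙ-preserves = nice⇒preserves (FM ℙ) ℙ-nice

      -- Suppose that unboundedly many fibres reflect at γ, and let δ < γ and c witness goodness at
      -- γ. Take one of their indices η with δ ≤ η. The points of c above η form a club of γ, which
      -- meets the fibre of η in some ξ; the value at ξ is η, with δ ≤ η < ξ, which c was to avoid.
      ¬uDSR : ∀ {p} → Sat (Defs.¬ uDSR₁ (chk Λ) (chk S)) p
      ¬uDSR q _ h = ⊥-elim (⊥-by (h fibres q ⊑-refl fibres-functionOn q ⊑-refl stat) λ { r≼q (γ , lift m , u , d) →
        ⊥-by (elimΛ m) λ { s≼r (g , e) →
          ⊥-by (dense-mono s≼r d) λ { t≼s (F , _ , F-unb , refl-F) →
            contra g (eq-mono t≼s e) (sat-mono (UncountableCofinality γ) (⊑-trans t≼s s≼r) u) F F-unb refl-F } } })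
        where
        stat : ∀ {q} → Sat (all λ α → all λ T → Maps fibres α T ⇒ StationarySubset (chk Λ) (chk S) T) q
        stat x T r _ m = sat-by (StationarySubset (chk Λ) (chk S) T) (graph-elim (λ _ _ _ → tt) (maps⇒ m))
          λ { _ (α , _ , _ , e) → stationarySubset-cong (eq-sym e) (fibre-stationary α) }

        contra : ∀ {γ t} g → Eq γ (ě g) t → Sat (UncountableCofinality γ) t → ∀ F → Sat (Unbounded F γ) t →
                 Sat (all∈ F λ α → all λ T → Maps fibres α T ⇒ Reflects T γ) t → ⊥
        contra {γ} {t} g e u F F-unb refl-F =
          ⊥-by (AtL.unbounded-elim g {C = F} (unbounded-cong eq-refl e′ (sat-mono (Unbounded F γ) r≼t F-unb)) δ (<⇒∊ δ<g))
            λ { {s} s≼r (η , η∊g , δ≤η , m) → at-stage s s≼r η (∊⇒< η∊g) δ≤η m }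
          where
          -- The condition must reach the length g before its goodness at g can be used.
          longer = lengthen t g
          r = proj₁ longer
          r≼t = proj₁ (proj₂ longer)
          g≤r = proj₂ (proj₂ longer)
          e′ = eq-mono r≼t e
          uncountable : Ctbl g → ⊥
          uncountable = let (μ , cof , ω∊μ) = uncountable-chk⁻¹ ℙ-preserves ω-omega (elem-ord g)
                                                (uncountable-cong e u)
                        in uncountable⇒¬ctbl cof ω∊μ
          witness = good r g g≤r uncountable
          δ = proj₁ witness
          δ<g = proj₁ (proj₂ witness)
          c = proj₁ (proj₂ (proj₂ witness))
          c-acc = proj₁ (proj₂ (proj₂ (proj₂ witness)))
          c-closed = proj₁ (proj₂ (proj₂ (proj₂ (proj₂ witness))))
          avoids = proj₂ (proj₂ (proj₂ (proj₂ (proj₂ witness))))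
          -- Only points above η are kept, so that the value η is regressive at the point found.
          club : ∀ η {s} → η < g → AtL.ClubSem g (λ ξ _ → c ξ ≡ true × η < ξ) s
          club η η<g = record
            { unbounded = λ β β∊g s s≼ →
                let (ξ , l , ξ<g , cξ) = c-acc (β ⊔ₗ η) (⊔< β η (∊⇒< β∊g) η<g) in
                s , ≼-refl , ξ , <⇒∊ ξ<g , inj₁ (≤-<-trans (≤⊔ˡ β η) l) , cξ , ≤-<-trans (≤⊔ʳ β η) l
            ; closed = λ { α α∊g lim@((ξ₀ , ξ₀<α) , suc<) _ hyp →
                let cα = c-closed α (∊⇒< α∊g) lim λ ξ ξ<α →
                          let (_ , _ , ζ , ζ<α , le , cζ , _) = now (hyp (suc ξ) (suc< ξ ξ<α)) in
                          ζ , <-≤-trans (<suc ξ) le , ζ<α , cζ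
                    (_ , _ , ζ , ζ<α , _ , _ , η<ζ) = now (hyp ξ₀ ξ₀<α)
                in λ s _ → s , ≼-refl , cα , <-trans η<ζ ζ<α } }
          met : ∀ s → s ≼ r → ∀ η → η < g → Mem (ě η) F s →
                Dense s (λ w → Σ[ ξ ∈ L ] (elem ξ ∊ elem g) × (c ξ ≡ true × η < ξ) × Mem (ě ξ) (fibre η) w)
          met s s≼r η η<g m =
            StatAt.stationary⇒ (elem g) (elem-ord g) (λ y → ∊elem⇒∊Λ g)
              (stationary-cong eq-refl (eq-mono s≼r e′) (proj₂ rf))
              (λ ξ _ → c ξ ≡ true × η < ξ) (λ _ _ h → h) ⊑-refl (club η η<g)
            where
            rf : Sat (Reflects (fibre η) γ) s
            rf = refl-F (ě η) s (≼-trans s≼r r≼t) (lift m) (fibre η) s ≼-refl (fibres-maps η)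
          at-stage : ∀ s → s ≼ r → ∀ η → η < g → δ ≤ η → Mem (ě η) F s → ⊥
          at-stage s s≼r η η<g δ≤η m =
            let (s′ , s′≼s , ξ , ξ∊g , (cξ , η<ξ) , n) = now (met s s≼r η η<g m)
                (w , w≼s′ , sξ , _ , v) = now (fibre-elim n)
                ξ<g = ∊⇒< ξ∊g
                v≡ = trans (sym (agree (≼-trans w≼s′ (≼-trans s′≼s s≼r)) ξ (<-≤-trans ξ<g g≤r))) v
            in avoids ξ ξ<g cξ sξ (subst (δ ≤_) (sym v≡) δ≤η) (subst (_< ξ) (sym v≡) η<ξ)

  -- Names are made from small predicates, so propositions are resized.
  Small : ∀ {ℓ} → Set ℓ → Set
  Small P = does (em {P = P}) ≡ true

  small : ∀ {ℓ} {P : Set ℓ} → P → Small P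
  small = dec-true em

  unsmall : ∀ {ℓ} {P : Set ℓ} → Small P → P
  unsmall {P = P} h with em {P = P}
  unsmall h | yes p = p
  unsmall () | no _

  -- A pressing-down argument in the extension by ℙ

  module Combinatorics (𝓖 : Ground) where
    open Stationarity 𝓖 public

    GoodAt : L → L → Cond → Set
    GoodAt δ ξ r = ξ < len r × Avoids δ (val r ξ) ξ

    goodAt-mono : ∀ δ ξ {p q} → q ≼ p → GoodAt δ ξ p → GoodAt δ ξ q
    goodAt-mono δ ξ q≼p (l , h) = <-≤-trans l (len≤ q≼p) , avoids-cong (sym (agree q≼p ξ l)) h

    -- Fodor's lemma in V^ℙ, for the regressive part of the generic function

    module Fodor (T : L → Cond → Set) (T-mono : ∀ ξ {p q} → q ≼ p → T ξ p → T ξ q) (p : Cond)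
      (T-S : ∀ {ξ r} → r ≼ p → T ξ r → Sₗ ξ) (T-stat : PΛ.StatSem T p) where

      Restricted : L → L → Cond → Set
      Restricted δ ξ r = T ξ r × GoodAt δ ξ r

      Conclusion : Set₁
      Conclusion = Σ[ δ ∈ L ] Σ[ r ∈ Cond ] r ≼ p × PΛ.StatSem (Restricted δ) r

      private
        Predicate : Set₁
        Predicate = L → Cond → Set

        record Bad (δ : L) (q : Cond) (N : Predicate) : Set where
          field
            mono : ∀ ξ {a b} → b ≼ a → N ξ a → N ξ b
            club : PΛ.ClubSem N q
            disjoint : ∀ {r ξ} → r ≼ q → N ξ r → Restricted δ ξ r → ⊥
        open Bad

        module Contradiction (¬conclusion : Conclusion → ⊥) where
          bad-dense : ∀ δ r → r ≼ p → Σ[ q ∈ Cond ] q ≼ r × Σ[ N ∈ Predicate ] Bad δ q N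
          bad-dense δ r r≼p with em {P = Σ[ q ∈ Cond ] q ≼ r × Σ[ N ∈ Predicate ] Bad δ q N}
          ... | yes h = h
          ... | no ¬bad = ⊥-elim (¬conclusion (δ , r , r≼p , stat))
            where
            stat : PΛ.StatSem (Restricted δ) r
            stat N N-mono q≼r club q′ q′≼q
              with em {P = Σ[ s ∈ Cond ] s ≼ q′ × Σ[ ξ ∈ L ] (elem ξ ∊ Λ) × N ξ s × Restricted δ ξ s}
            ... | yes h = h
            ... | no k = ⊥-elim (¬bad (q′ , ≼-trans q′≼q q≼r , N , record
              { mono = N-mono ; club = PΛ.clubSem-mono q′≼q club
              ; disjoint = λ {s} {ξ} s≼q′ n t → k (s , s≼q′ , ξ , elem∊ ξ , n , t) }))

          -- The clubs found below various conditions are mixed into one, using for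
          -- each s the one of the least code compatible with s, if it lies above s.
          module Mix (δ : L) where
            Source : L → Set₁
            Source l = Σ[ q ∈ Cond ] codeP q ≡ l × q ≼ p × Σ[ N ∈ Predicate ] Bad δ q N

            source : ∀ l → Dec (Source l)
            source l = em

            cond : ∀ {l} → Source l → Cond
            cond = proj₁

            pred : ∀ {l} → Source l → Predicate
            pred h = proj₁ (proj₂ (proj₂ (proj₂ h)))

            bad : ∀ {l} (h : Source l) → Bad δ (cond h) (pred h)
            bad h = proj₂ (proj₂ (proj₂ (proj₂ h)))

            -- Many pairs of a condition and a club may share the code l. Requiring
            -- `source l ≡ yes h` fixes one of them, and the last clause makes l the least relevant
            -- code, so the predicate used at s is unique and does not change below s.
            Selects : L → Cond → Set₁
            Selects l s = Σ[ h ∈ Source l ] source l ≡ yes h × s ≼ cond h ×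
              (∀ l′ → l′ < l → (h′ : Source l′) → ∀ t → t ≼ s → t ≼ cond h′ → ⊥)

            selects-mono : ∀ {l s t} → t ≼ s → Selects l s → Selects l t
            selects-mono t≼s (h , e , s≼ , least) = h , e , ≼-trans t≼s s≼ ,
              λ l′ k h′ u u≼t → least l′ k h′ u (≼-trans u≼t t≼s)

            selects-unique : ∀ {l l′ s} → Selects l s → Selects l′ s → l ≡ l′
            selects-unique {l} {l′} (h , _ , s≼h , least₁) (h′ , _ , s≼h′ , least₂) with compare l l′
            ... | inj₁ k = ⊥-elim (least₂ l k h _ ≼-refl s≼h)
            ... | inj₂ (inj₁ e) = e
            ... | inj₂ (inj₂ k) = ⊥-elim (least₁ l′ k h′ _ ≼-refl s≼h′)

            source-unique : ∀ {l} {h h′ : Source l} → source l ≡ yes h → source l ≡ yes h′ → h ≡ h′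
            source-unique e e′ with trans (sym e) e′
            ... | refl = refl

            selects-dense : ∀ s → s ≼ p → Σ[ t ∈ Cond ] t ≼ s × Σ[ l ∈ L ] Selects l t
            selects-dense s s≼p =
              let (q , q≼s , N , b) = bad-dense δ s s≼p
                  (l , (h , t , t≼s , t≼h) , min) = least Compatible
                    (codeP q , (q , refl , ≼-trans q≼s s≼p , N , b) , q , q≼s , ≼-refl)
              in t , t≼s , l , go l h t t≼s t≼h min (source l) refl
              where
              Compatible : L → Set₁
              Compatible l = Σ[ h ∈ Source l ] Σ[ t ∈ Cond ] t ≼ s × t ≼ cond h
              go : ∀ l (h : Source l) t → t ≼ s → t ≼ cond h → (∀ m → m < l → Compatible m → ⊥) →
                   (d : Dec (Source l)) → source l ≡ d → Selects l t
              go l h t t≼s t≼h min (no k) _ = ⊥-elim (k h)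
              go l h t t≼s t≼h min (yes h₀) e = h₀ , e ,
                -- The fixed source h₀ has the same code as h, so t lies below its condition too.
                ≼-trans t≼h (codeP-inj (trans (proj₁ (proj₂ h)) (sym (proj₁ (proj₂ h₀))))) ,
                λ l′ l′<l h′ u u≼t u≼h′ → min l′ l′<l (h′ , u , ≼-trans u≼t t≼s , u≼h′)

            Mixed : L → Cond → Set
            Mixed ξ s = Small (Σ[ l ∈ L ] Σ[ a ∈ Selects l s ] pred (proj₁ a) ξ s)

            mixed-intro : ∀ {l s ξ} (a : Selects l s) → pred (proj₁ a) ξ s → Mixed ξ s
            mixed-intro {l} a n = small (l , a , n)

            mixed-elim : ∀ {l s t ξ} (a : Selects l s) → t ≼ s → Mixed ξ t → pred (proj₁ a) ξ t
            mixed-elim {l} {s} {t} {ξ} a t≼s m = go (unsmall m)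
              where
              go : Σ[ l′ ∈ L ] Σ[ a′ ∈ Selects l′ t ] pred (proj₁ a′) ξ t → pred (proj₁ a) ξ t
              go (l′ , a′ , n) with selects-unique (selects-mono t≼s a) a′
              ... | refl = subst (λ h → pred h ξ t) (source-unique (proj₁ (proj₂ a′)) (proj₁ (proj₂ a))) n

            mixed-mono : ∀ ξ {s t} → t ≼ s → Mixed ξ s → Mixed ξ t
            mixed-mono ξ t≼s m = let (l , a , n) = unsmall m in
              mixed-intro (selects-mono t≼s a) (mono (bad (proj₁ a)) ξ t≼s n)

            mixed-club : PΛ.ClubSem Mixed p
            mixed-club = record
              { unbounded = λ β β∊Λ s s≼p →
                  let (t , t≼s , l , a) = selects-dense s s≼p
                      (u , u≼t , η , η∊Λ , le , n) = PΛ.unbounded (club (bad (proj₁ a))) β β∊Λ t (proj₁ (proj₂ (proj₂ a)))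
                  in u , ≼-trans u≼t t≼s , η , η∊Λ , le , mixed-intro (selects-mono u≼t a) n
              ; closed = λ α α∊Λ lim q≼p hyp s s≼q →
                  let (t , t≼s , l , a) = selects-dense s (≼-trans s≼q q≼p)
                      (u , u≼t , n) = PΛ.closed (club (bad (proj₁ a))) α α∊Λ lim (proj₁ (proj₂ (proj₂ a)))
                        (λ β β<α v v≼t → let (w , w≼v , η , η<α , le , m) = hyp β β<α v (≼-trans v≼t (≼-trans t≼s s≼q)) in
                           w , w≼v , η , η<α , le , mixed-elim a (≼-trans w≼v v≼t) m)
                        t ≼-refl
                  in u , ≼-trans u≼t t≼s , mixed-intro (selects-mono u≼t a) n }

            mixed-disjoint : ∀ {r ξ} → Mixed ξ r → Restricted δ ξ r → ⊥
            mixed-disjoint m t = let (l , a , n) = unsmall m in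
              disjoint (bad (proj₁ a)) (proj₁ (proj₂ (proj₂ a))) n t

          N : L → Predicate
          N δ = Mix.Mixed δ

          Diagonal : Predicate
          Diagonal ξ s = ∀ δ → δ < ξ → MP.Dense s (N δ ξ)

          diagonal-mono : ∀ ξ {s t} → t ≼ s → Diagonal ξ s → Diagonal ξ t
          diagonal-mono ξ t≼s d δ l = MP.dense-mono t≼s (d δ l)

          -- For each β, distributivity finds one condition that decides a member of N δ above β for
          -- every δ < β, and regularity bounds these members. After ω rounds the length ξ is a
          -- limit of N δ for each δ < ξ.
          diagonal-unbounded : ∀ β → elem β ∊ Λ → MP.Dense p (λ r → Σ[ η ∈ L ] (elem η ∊ Λ) × β ≤ η × Diagonal η r)
          diagonal-unbounded β _ s s≼p = limit it , limit≼ it , ξ , elem∊ ξ ,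
            inj₁ (≤-<-trans (seq-zero it) (seq-below it 0)) , λ δ δ<ξ →
              PΛ.closed (Mix.mixed-club δ) ξ (elem∊ ξ) (len-lim it) (≼-trans (limit≼ it) s≼p) λ β′ β′<ξ t t≼r →
                let (n₁ , a) = seq-above it δ δ<ξ
                    (n₂ , b) = seq-cofinal it β′ β′<ξ
                    -- A round late enough to treat δ and to lie above β′.
                    n = n₁ ℕ.+ n₂
                    (η , le , η< , k) = lower (seq-step it n) δ
                      (<-≤-trans a (mono-seq-≤ (seq it) (seq-< it) (ℕₚ.m≤m+n n₁ n₂)))
                in t , ≼-refl , η , <-trans η< (seq-below it (ℕ.suc n)) ,
                   ≤-trans b (≤-trans (mono-seq-≤ (seq it) (seq-< it) (ℕₚ.m≤n+m n₂ n₁)) le) ,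
                   Mix.mixed-mono δ η t≼r k
            where
            R : L → Cond → L → Set₁
            R β s β′ = Lift (lsuc 0ℓ) (∀ δ → δ < β → Σ[ η ∈ L ] β ≤ η × η < β′ × N δ η s)
            R-step : Step R
            R-step = record
              { step-mono = λ { r≼s (lift h) → lift λ δ l → let (η , a , b , n) = h δ l in η , a , b , Mix.mixed-mono δ η r≼s n }
              ; step-up = λ { le (lift h) → lift λ δ l → let (η , a , b , n) = h δ l in η , a , <-≤-trans b le , n } }
            next : ∀ β s₁ → s₁ ≼ s → Σ[ s₂ ∈ Cond ] s₂ ≼ s₁ × Σ[ β′ ∈ L ] R β s₂ β′
            next β s₁ s₁≼s =
              let (s₂ , s₂≼s₁ , h) = Nice.distributive ℙ-nice s₁ β D
                    (λ δ q≼p d → lift (proj₁ (lower d) , proj₁ (proj₂ (lower d)) , Mix.mixed-mono δ _ q≼p (proj₂ (proj₂ (lower d)))))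
                    (λ δ q q≼s₁ → let (r , r≼q , η , _ , le , n) =
                                        PΛ.unbounded (Mix.mixed-club δ) β (elem∊ β) q (≼-trans q≼s₁ (≼-trans s₁≼s s≼p)) in
                       r , r≼q , lift (η , le , n))
                  (β′ , b) = bounded β (F s₂)
              in s₂ , s₂≼s₁ , β′ , lift λ δ l →
                   let (le , n) = F-spec s₂ δ (lower (h δ l)) in F s₂ δ , le , b δ l , n
              where
              D : L → Cond → Set₁
              D δ r = Lift (lsuc 0ℓ) (Σ[ η ∈ L ] β ≤ η × N δ η r)
              F : Cond → L → L
              F r δ with em {P = Σ[ η ∈ L ] β ≤ η × N δ η r}
              ... | yes (η , _) = η
              ... | no _ = δ
              F-spec : ∀ r δ → Σ[ η ∈ L ] β ≤ η × N δ η r → β ≤ F r δ × N δ (F r δ) r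
              F-spec r δ h with em {P = Σ[ η ∈ L ] β ≤ η × N δ η r}
              ... | yes (_ , k) = k
              ... | no k = ⊥-elim (k h)
            it : Iterate R s β
            it = iterate R-step next β
            open Iterate
            ξ = len (limit it)

          diagonal-club : PΛ.ClubSem Diagonal p
          diagonal-club = record
            { unbounded = diagonal-unbounded
            ; closed = λ α α∊Λ lim q≼p hyp s s≼q → s , ≼-refl , λ δ δ<α →
                MP.dense-mono {D = N δ α} s≼q (PΛ.closed (Mix.mixed-club δ) α α∊Λ lim q≼p λ β β<α t t≼q →
                  let (u , u≼t , η , η<α , le , d) = hyp (β ⊔ₗ suc δ) (⊔< β (suc δ) β<α (proj₂ lim δ δ<α)) t t≼q
                      (v , v≼u , n) = d δ (<-≤-trans (<suc δ) (≤-trans (≤⊔ʳ β (suc δ)) le)) u ≼-refl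
                  in v , ≼-trans v≼u u≼t , η , η<α , ≤-trans (≤⊔ˡ β (suc δ)) le , n) }

          -- A regressive value α leaves room for suc α below the limit ξ; a non-regressive one is
          -- harmless for every δ.
          choose-δ : ∀ {ξ} → Lim ξ → ∀ α → Σ[ δ ∈ L ] δ < ξ × Avoids δ α ξ
          choose-δ {ξ} lim α with <⊎≥ α ξ
          ... | inj₁ α<ξ = suc α , proj₂ lim α α<ξ , λ _ le _ → ≤⇒≯ le (<suc α)
          ... | inj₂ ξ≤α = proj₁ (proj₁ lim) , proj₂ (proj₁ lim) , λ _ _ l → ≤⇒≯ ξ≤α l

          -- T meets the diagonal intersection of the clubs `N δ` in some ξ. Once its value is
          -- decided, ξ is good for some δ < ξ, although it belongs to the club `N δ`, which avoids
          -- all such points of T.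
          contradiction : ⊥
          contradiction =
            let (r , r≼p , ξ , _ , d , t) = T-stat Diagonal diagonal-mono ≼-refl diagonal-club p ≼-refl
                (r₁ , r₁≼r , le) = lengthen r (suc ξ)
                ξ<r₁ = <-≤-trans (<suc ξ) le
                (δ , δ<ξ , av) = choose-δ (S-lim (T-S r≼p t)) (val r₁ ξ)
                (r₂ , r₂≼r₁ , n) = d δ δ<ξ r₁ r₁≼r
            in Mix.mixed-disjoint δ n (T-mono ξ (≼-trans r₂≼r₁ r₁≼r) t , goodAt-mono δ ξ r₂≼r₁ (ξ<r₁ , av))

      fodor : Conclusion
      fodor with em {P = Conclusion}
      ... | yes h = h
      ... | no k = ⊥-elim (Contradiction.contradiction k)

    -- Preservation of stationarity by ℚ

    module Preservation (δ : L) where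
      open Quotient δ public
      module MQ = Stat (FM ℚ)
      module QΛ = MQ.AtΛ

      module _ (T : L → Cond → Set) (T-mono : ∀ ξ {p q} → q ≼ p → T ξ p → T ξ q) (q₀ : QCond δ)
        (T-S : ∀ {ξ r} → r ≼ base q₀ → T ξ r → Sₗ ξ)
        (T-stat : PΛ.StatSem (λ ξ r → T ξ r × GoodAt δ ξ r) (base q₀)) where

        private
          module Meet (N : L → QCond δ → Set) (N-mono : ∀ ξ {p q} → q ≼Q p → N ξ p → N ξ q)
            {q : QCond δ} (q≼q₀ : q ≼Q q₀) (N-club : QΛ.ClubSem N q) (q₁ : QCond δ) (q₁≼q : q₁ ≼Q q) where

            lenQ : QCond δ → L
            lenQ q = len (base q)

            -- The clause r ≼ base q′ keeps q′ in the quotient by the generic of ℙ. Bounding codes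
            -- by ξ does the work of an elementary submodel: the new condition is again one to which
            -- the closure of ξ applies.
            Next : L → L → QCond δ → Cond → Set
            Next ξ β q̂ r = Σ[ q′ ∈ QCond δ ] q′ ≼Q q̂ × codeQ q′ < ξ × β < lenQ q′ × lenQ q′ < ξ × r ≼ base q′ ×
              Σ[ ζ ∈ L ] β < ζ × ζ < ξ × N ζ q′

            next-widen : ∀ {ξ ξ′ β β′ q̂ r r′} → ξ ≤ ξ′ → β′ ≤ β → (∀ q′ → lenQ q′ < ξ → r ≼ base q′ → r′ ≼ base q′) →
                         Next ξ β q̂ r → Next ξ′ β′ q̂ r′
            next-widen le le′ f (q′ , a , b , c , d , e , ζ , g , h , n) =
              q′ , a , <-≤-trans b le , ≤-<-trans le′ c , <-≤-trans d le , f q′ d e , ζ , ≤-<-trans le′ g , <-≤-trans h le , n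

            -- ξ is closed, relative to the generic of ℙ below r, under extending
            -- conditions of ℚ to decide members of N.
            ClosedUnder : L → Cond → Set
            ClosedUnder ξ r = ∀ q̂ β → q̂ ≼Q q₁ → codeQ q̂ < ξ → lenQ q̂ < ξ → β < ξ → r ≼ base q̂ → Next ξ β q̂ r

            E : L → Cond → Set
            E ξ r = codeQ q₁ < ξ × lenQ q₁ < ξ × ξ ≤ len r × ClosedUnder ξ r

            E-mono : ∀ ξ {r r′} → r′ ≼ r → E ξ r → E ξ r′
            E-mono ξ r′≼r (a , b , c , k) = a , b , ≤-trans c (len≤ r′≼r) , λ q̂ β q̂≼ cd l β<ξ r′≼q̂ →
              next-widen {q̂ = q̂} ≤-refl ≤-refl (λ q′ _ → ≼-trans r′≼r)
                (k q̂ β q̂≼ cd l β<ξ (≼-tree r′≼r r′≼q̂ (≤-trans (inj₁ l) c)))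

            -- In each round distributivity treats all codes below the current bound at once, and
            -- regularity bounds the outcomes; ω rounds then close off.
            E-unbounded : ∀ β → elem β ∊ Λ → MP.Dense (base q₁) (λ r → Σ[ ξ ∈ L ] (elem ξ ∊ Λ) × β ≤ ξ × E ξ r)
            E-unbounded β₀ _ s s≼q₁ = r , limit≼ it , ξ , elem∊ ξ ,
              inj₁ (≤-<-trans (≤-trans (≤⊔ˡ β₀ _) (≤-trans (≤⊔ˡ _ _) (seq-zero it))) (seq-below it 0)) ,
              ≤-<-trans (≤-trans (≤⊔ʳ β₀ _) (≤-trans (≤⊔ˡ _ _) (seq-zero it))) (seq-below it 0) ,
              ≤-<-trans (≤-trans (≤⊔ʳ _ _) (seq-zero it)) (seq-below it 0) , ≤-refl , closedUnder
              where
              R : L → Cond → L → Set₁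
              -- With s of length at least β, a stronger condition extends no further base of length
              -- below β, by `≼-tree`. This makes the step monotone.
              R β s β′ = Lift (lsuc 0ℓ) (β ≤ len s ×
                (∀ q̂ → q̂ ≼Q q₁ → codeQ q̂ < β → lenQ q̂ < β → s ≼ base q̂ → Next β′ β q̂ s))
              R-step : Step R
              R-step = record
                { step-mono = λ { r≼s (lift (l , h)) → lift (≤-trans l (len≤ r≼s) , λ q̂ a b c d →
                    next-widen {q̂ = q̂} ≤-refl ≤-refl (λ _ _ → ≼-trans r≼s) (h q̂ a b c (≼-tree r≼s d (≤-trans (inj₁ c) l)))) }
                ; step-up = λ { le (lift (l , h)) → lift (l , λ q̂ a b c d →
                    next-widen {q̂ = q̂} le ≤-refl (λ _ _ k → k) (h q̂ a b c d)) } }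
              next : ∀ β s₁ → s₁ ≼ s → Σ[ s₂ ∈ Cond ] s₂ ≼ s₁ × Σ[ β′ ∈ L ] R β s₂ β′
              next β s₁ s₁≼s =
                let (s₂ , s₂≼s₁ , β≤s₂) = lengthen s₁ β
                    (s₃ , s₃≼s₂ , h) = Nice.distributive ℙ-nice s₂ β D D-mono (λ η u u≼s₂ → dense η u (≤-trans β≤s₂ (len≤ u≼s₂)))
                    (β′ , bd) = bounded β (F s₃)
                in s₃ , ≼-trans s₃≼s₂ s₂≼s₁ , β′ , lift (≤-trans β≤s₂ (len≤ s₃≼s₂) , λ q̂ a b c d →
                     next-widen {q̂ = q̂} (inj₁ (bd (codeQ q̂) b)) ≤-refl (λ _ _ k → k)
                       (proj₂ (F-spec s₃ (codeQ q̂) (lower (h (codeQ q̂) b))) q̂ a refl c d))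
                where
                D₀ : L → Cond → L → Set
                D₀ η r b = β ≤ len r × (∀ q̂ → q̂ ≼Q q₁ → codeQ q̂ ≡ η → lenQ q̂ < β → r ≼ base q̂ → Next b β q̂ r)
                D : L → Cond → Set₁
                D η r = Lift (lsuc 0ℓ) (Σ[ b ∈ L ] D₀ η r b)
                D-mono : ∀ η {r r′} → r′ ≼ r → D η r → D η r′
                D-mono η r′≼r (lift (b , l , h)) = lift (b , ≤-trans l (len≤ r′≼r) , λ q̂ a e c d →
                  next-widen {q̂ = q̂} ≤-refl ≤-refl (λ _ _ → ≼-trans r′≼r) (h q̂ a e c (≼-tree r′≼r d (≤-trans (inj₁ c) l))))
                dense : ∀ η u → β ≤ len u → Σ[ r ∈ Cond ] r ≼ u × D η r
                dense η u β≤u with em {P = Σ[ q̂ ∈ QCond δ ] q̂ ≼Q q₁ × codeQ q̂ ≡ η × u ≼ base q̂}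
                -- Here u extends the base of no such q̂ with code η. As u has length at least β, no
                -- stronger condition changes this for the q̂ of length below β.
                ... | no k = u , ≼-refl , lift (β , β≤u , λ q̂ a e c d → ⊥-elim (k (q̂ , a , e , d)))
                ... | yes (q̂ , q̂≼q₁ , e , u≼q̂) =
                  let (q₂ , q₂≼q̂ , q₂≼u) = lift≼ q̂ u u≼q̂
                      (v , v≼q₂ , sβ≤v) = lengthen (base q₂) (suc β)
                      (q₃ , q₃≼q₂ , q₃≼v) = lift≼ q₂ v v≼q₂
                      (q₄ , q₄≼q₃ , ζ , _ , sβ≤ζ , n) = QΛ.unbounded N-club (suc β) (elem∊ (suc β)) q₃
                        (≼Q-trans q₃≼q₂ (≼Q-trans q₂≼q̂ (≼Q-trans q̂≼q₁ q₁≼q)))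
                      q₄≼q̂ = ≼Q-trans q₄≼q₃ (≼Q-trans q₃≼q₂ q₂≼q̂)
                      q₄≼v = ≼-trans (base≼ q₄≼q₃) q₃≼v
                      q₄≼u = ≼-trans q₄≼v (≼-trans v≼q₂ q₂≼u)
                      b₁ = codeQ q₄ ⊔ₗ lenQ q₄
                      b = suc (b₁ ⊔ₗ ζ)
                  in base q₄ , q₄≼u , lift (b , ≤-trans β≤u (len≤ q₄≼u) , λ q̂′ _ e′ _ _ →
                       q₄ , ≼Q-trans q₄≼q̂ (codeQ-inj (trans e (sym e′))) ,
                       ≤⇒<suc (≤-trans (≤⊔ˡ _ _) (≤⊔ˡ b₁ ζ)) ,
                       <-≤-trans (<suc β) (≤-trans sβ≤v (len≤ q₄≼v)) ,
                       ≤⇒<suc (≤-trans (≤⊔ʳ _ _) (≤⊔ˡ b₁ ζ)) , ≼-refl ,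
                       ζ , <-≤-trans (<suc β) sβ≤ζ , ≤⇒<suc (≤⊔ʳ b₁ ζ) , n)
                F : Cond → L → L
                F r η with em {P = Σ[ b ∈ L ] D₀ η r b}
                ... | yes (b , _) = b
                ... | no _ = η
                F-spec : ∀ r η → Σ[ b ∈ L ] D₀ η r b → D₀ η r (F r η)
                F-spec r η h with em {P = Σ[ b ∈ L ] D₀ η r b}
                ... | yes (_ , k) = k
                ... | no k = ⊥-elim (k h)
              it : Iterate R s (β₀ ⊔ₗ codeQ q₁ ⊔ₗ lenQ q₁)
              it = iterate R-step next _
              open Iterate
              r = limit it
              ξ = len r
              closedUnder : ClosedUnder ξ r
              closedUnder q̂ β a cd l β<ξ d =
                let (n₁ , k₁) = seq-above it (codeQ q̂ ⊔ₗ lenQ q̂ ⊔ₗ β) (⊔< _ β (⊔< _ _ cd l) β<ξ)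
                    β≤ = ≤-trans (≤⊔ʳ (codeQ q̂ ⊔ₗ lenQ q̂) β) (inj₁ k₁)
                    c≤ = ≤-<-trans (≤-trans (≤⊔ˡ (codeQ q̂) (lenQ q̂)) (≤⊔ˡ _ β)) k₁
                    l≤ = ≤-<-trans (≤-trans (≤⊔ʳ (codeQ q̂) (lenQ q̂)) (≤⊔ˡ _ β)) k₁
                in next-widen {q̂ = q̂} (inj₁ (seq-below it (ℕ.suc n₁))) β≤ (λ _ _ k → k)
                     (proj₂ (lower (seq-step it n₁)) q̂ a c≤ l≤ d)

            E-club : PΛ.ClubSem E (base q₁)
            E-club = record { unbounded = E-unbounded ; closed = cl }
              where
              cl : ∀ α → elem α ∊ Λ → Lim α → ∀ {s} → s ≼ base q₁ →
                   (∀ β → β < α → MP.Dense s (λ r → Σ[ η ∈ L ] η < α × β ≤ η × E η r)) → MP.Dense s (E α)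
              cl α _ lim _ hyp t t≼s =
                let (t′ , t′≼t , α≤t′) = lengthen t α
                    t′≼s = ≼-trans t′≼t t≼s
                    (_ , _ , η , η<α , _ , a , b , _) = hyp (proj₁ (proj₁ lim)) (proj₂ (proj₁ lim)) t t≼s
                in t′ , t′≼t , <-trans a η<α , <-trans b η<α , α≤t′ , λ q̂ β q̂≼ cd l β<α t′≼q̂ →
                  let m = codeQ q̂ ⊔ₗ lenQ q̂ ⊔ₗ β
                      (u , u≼t′ , η , η<α , sm≤η , _ , _ , _ , k) = hyp (suc m) (proj₂ lim m (⊔< _ β (⊔< _ _ cd l) β<α)) t′ t′≼s
                      m<η = <-≤-trans (<suc m) sm≤η
                      c< = ≤-<-trans (≤-trans (≤⊔ˡ (codeQ q̂) (lenQ q̂)) (≤⊔ˡ _ β)) m<η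
                      l< = ≤-<-trans (≤-trans (≤⊔ʳ (codeQ q̂) (lenQ q̂)) (≤⊔ˡ _ β)) m<η
                  in next-widen {q̂ = q̂} (inj₁ η<α) ≤-refl
                       -- It is u that extends the base of q′, but q′ is shorter than α ≤ len t′, so
                       -- t′ extends it already.
                       (λ q′ l′ u≼q′ → ≼-tree u≼t′ u≼q′ (≤-trans (inj₁ (<-trans l′ η<α)) α≤t′))
                       (k q̂ β q̂≼ c< l< (≤-<-trans (≤⊔ʳ (codeQ q̂ ⊔ₗ lenQ q̂) β) m<η) (≼-trans u≼t′ t′≼q̂))

            -- An ω-sequence below q₁ whose lengths converge to a point ξ of T, all of
            -- whose terms are compatible with r; capping it off by ξ yields a condition.
            module Capping (ξ : L) (r : Cond) (r≼q₁ : r ≼ base q₁) (e : E ξ r) (t : T ξ r) (good : GoodAt δ ξ r)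
              (sξ : Sₗ ξ) where
              s : ℕ → L
              s = proj₁ (S-ctbl sξ)

              State : Set
              State = Σ[ q̂ ∈ QCond δ ] q̂ ≼Q q₁ × codeQ q̂ < ξ × lenQ q̂ < ξ × r ≼ base q̂

              -- `Ctbl` allows terms of s outside ξ; these are replaced by some point below ξ.
              target : L → L
              target β with em {P = β < ξ}
              ... | yes _ = β
              ... | no _ = proj₁ (proj₁ (S-lim sξ))

              target< : ∀ β → target β < ξ
              target< β with em {P = β < ξ}
              ... | yes h = h
              ... | no _ = proj₂ (proj₁ (S-lim sξ))

              target-id : ∀ {β} → β < ξ → target β ≡ β
              target-id {β} h with em {P = β < ξ}
              ... | yes _ = refl
              ... | no k = ⊥-elim (k h)

              advance : (x : State) (β : L) → Next ξ (target β) (proj₁ x) r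
              advance (q̂ , a , b , c , d) β = proj₂ (proj₂ (proj₂ e)) q̂ (target β) a b c (target< β) d

              state : ℕ → State
              state zero = q₁ , ≼Q-refl , proj₁ e , proj₁ (proj₂ e) , r≼q₁
              state (ℕ.suc n) = let (q′ , a , b , _ , d , g , _) = advance (state n) (s n)
                                    (_ , a′ , _) = state n
                                in q′ , ≼Q-trans a a′ , b , d , g

              qs : ℕ → QCond δ
              qs n = proj₁ (state n)

              qs-≼ : ∀ n → qs n ≼Q q₁
              qs-≼ n = proj₁ (proj₂ (state n))

              qs< : ∀ n → lenQ (qs n) < ξ
              qs< n = proj₁ (proj₂ (proj₂ (proj₂ (state n))))

              r≼qs : ∀ n → r ≼ base (qs n)
              r≼qs n = proj₂ (proj₂ (proj₂ (proj₂ (state n))))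

              desc : ∀ n → qs (ℕ.suc n) ≼Q qs n
              desc n = proj₁ (proj₂ (advance (state n) (s n)))

              descend : ∀ {i j} → i ℕ.≤ j → qs j ≼Q qs i
              descend i≤j with ℕₚ.m≤n⇒m<n∨m≡n i≤j
              ... | inj₂ refl = ≼Q-refl
              descend {i} {ℕ.suc j} _ | inj₁ (ℕ.s≤s i≤j) = ≼Q-trans (desc j) (descend i≤j)

              len-above : ∀ n → target (s n) < lenQ (qs (ℕ.suc n))
              len-above n = proj₁ (proj₂ (proj₂ (proj₂ (advance (state n) (s n)))))

              member : ∀ n → Σ[ ζ ∈ L ] target (s n) < ζ × ζ < ξ × N ζ (qs (ℕ.suc n))
              member n = proj₂ (proj₂ (proj₂ (proj₂ (proj₂ (proj₂ (advance (state n) (s n)))))))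

              reach : ∀ η → η < ξ → Σ[ n ∈ ℕ ] η ≤ target (s n)
              reach η η<ξ = let (n , le , l) = proj₂ (S-ctbl sξ) η η<ξ in n , subst (η ≤_) (sym (target-id l)) le

              covers : ∀ η → η < ξ → Σ[ n ∈ ℕ ] η < lenQ (qs n)
              covers η η<ξ = let (n , le) = reach η η<ξ in ℕ.suc n , ≤-<-trans le (len-above n)

              InUnion : L → Set
              InUnion η = Σ[ n ∈ ℕ ] η < lenQ (qs n) × club (qs n) η ≡ true

              c : L → Bool
              c = splitAt ξ (decide InUnion) (only ξ)

              coherent : ∀ {m n η} → η < lenQ (qs m) → η < lenQ (qs n) → club (qs m) η ≡ club (qs n) η
              coherent {m} {n} {η} a b with ℕₚ.≤-total m n
              ... | inj₁ m≤n = sym (agreeQ (descend m≤n) η a)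
              ... | inj₂ n≤m = agreeQ (descend n≤m) η b

              c-< : ∀ n {η} → η < lenQ (qs n) → c η ≡ club (qs n) η
              c-< n {η} h = trans (splitAt-< ξ (decide InUnion) (only ξ) (<-trans h (qs< n)))
                (bool-ext (λ k → let (m , l , x) = decide-elim InUnion k in trans (coherent {n} {m} h l) x)
                          (λ x → decide-intro InUnion (n , h , x)))

              c-ξ : c ξ ≡ true
              c-ξ = trans (splitAt-≥ ξ (decide InUnion) (only ξ) ≤-refl) (only-self ξ)

              δ<ξ : δ < ξ
              -- `qs 1` has positive length, while `qs 0` may be the maximum of ℚ, whose closed set
              -- is empty on its domain.
              δ<ξ = go (shape (qs 1))
                where
                go : lenQ (qs 1) ≡ 0ₗ ⊎ Σ[ m ∈ L ] lenQ (qs 1) ≡ suc m × club (qs 1) m ≡ true → δ < ξ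
                go (inj₁ z) = ⊥-elim (≤⇒≯ (0≤ _) (subst (target (s 0) <_) z (len-above 0)))
                go (inj₂ (m , z , x)) = let m< = subst (m <_) (sym z) (<suc m) in
                  <-trans (above (qs 1) m m< x) (<-trans m< (qs< 1))

              upto : ∀ {ℓ} (Φ : L → Set ℓ) → (∀ η n → η < lenQ (qs n) → Φ η) → Φ ξ → ∀ η → η < suc ξ → Φ η
              upto Φ h k η l with <suc⇒≤ l
              ... | inj₁ η<ξ = let (n , x) = covers η η<ξ in h η n x
              ... | inj₂ refl = k

              capped = cap r ξ c (proj₁ good) c-ξ
                (upto (λ η → c η ≡ true → δ < η)
                  (λ η n l x → above (qs n) η l (trans (sym (c-< n l)) x)) (λ _ → δ<ξ))
                (upto (λ η → Lim η → AccPoint c η → c η ≡ true)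
                  (λ η n l lim near → trans (c-< n l) (closed (qs n) η l lim λ ζ h →
                     let (θ , a , b , x) = near ζ h in θ , a , b , trans (sym (c-< n (<-trans b l))) x))
                  (λ _ _ → c-ξ))
                (upto (λ η → c η ≡ true → Avoids δ (val r η) η)
                  (λ η n l x → avoids-cong (sym (agree (r≼qs n) η l)) (avoids (qs n) η l (trans (sym (c-< n l)) x)))
                  -- At ξ itself avoidance is the goodness of ξ: this is where it matters that the
                  -- other points of T have been discarded.
                  (λ _ → proj₂ good))

              q* : QCond δ
              q* = proj₁ capped

              q*≼r : base q* ≼ r
              q*≼r = proj₁ (proj₂ capped)

              q*≼ : ∀ n → q* ≼Q qs n
              q*≼ n = mk≼Q (≼-trans q*≼r (r≼qs n)) λ η l →
                trans (proj₂ (proj₂ capped) η (<-trans (<-trans l (qs< n)) (<suc ξ))) (c-< n l)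

              approach : ∀ β → β < ξ → MQ.Dense q* (λ w → Σ[ η ∈ L ] η < ξ × β ≤ η × N η w)
              approach β β<ξ w w≼q* =
                let (n , le) = reach β β<ξ
                    (ζ , a , b , k) = member n
                in w , ≼Q-refl , ζ , b , inj₁ (≤-<-trans le a) , N-mono ζ (≼Q-trans w≼q* (q*≼ (ℕ.suc n))) k

              found : Σ[ w ∈ QCond δ ] w ≼Q q₁ × Σ[ ξ ∈ L ] (elem ξ ∊ Λ) × N ξ w × T ξ (base w)
              found =
                let q*≼q₁ = ≼Q-trans (q*≼ 0) (qs-≼ 0)
                    (w , w≼q* , n) = QΛ.closed N-club ξ (elem∊ ξ) (S-lim sξ) (≼Q-trans q*≼q₁ q₁≼q) approach q* ≼Q-refl
                in w , ≼Q-trans w≼q* q*≼q₁ , ξ , elem∊ ξ , n , T-mono ξ (≼-trans (base≼ w≼q*) q*≼r) t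

            met : Σ[ w ∈ QCond δ ] w ≼Q q₁ × Σ[ ξ ∈ L ] (elem ξ ∊ Λ) × N ξ w × T ξ (base w)
            met =
              let q₁≼q₀ = base≼ (≼Q-trans q₁≼q q≼q₀)
                  (r , r≼q₁ , ξ , _ , e , t , good) = T-stat E E-mono q₁≼q₀ E-club (base q₁) ≼-refl
              in Capping.found ξ r r≼q₁ e t good (T-S (≼-trans r≼q₁ q₁≼q₀) t)

        -- The closure points E of the process that extends conditions of ℚ to decide members of N
        -- form a club in V^ℙ, which T meets in a good point ξ. As ξ has cofinality ω, an ω-sequence
        -- of conditions can be built up to ξ and capped by it, and the result forces ξ to be a
        -- limit of N.
        preservation : QΛ.StatSem (λ ξ q → T ξ (base q)) q₀
        preservation N N-mono q≼q₀ N-club q₁ q₁≼q = Meet.met N N-mono q≼q₀ N-club q₁ q₁≼q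

  -- Simultaneous reflection in the extension by ℙ

  module Reflection (𝓖 : Ground) (κ : V) (κ≤Λ : κ ≤V Ground.Λ 𝓖)
    (reflection : Refl* (Ground.Λ 𝓖) κ (Ground.S 𝓖)) where
    open Combinatorics 𝓖

    ∊κ⇒∊Λ : ∀ {x} → x ∊ κ → x ∊ Λ
    ∊κ⇒∊Λ {x} h = [ (λ m → proj₁ Λ-ord κ x m h) , (λ e → ∊-congʳ κ Λ e h) ]′ κ≤Λ

    -- By distributivity the family 𝓢 is decided to be {T η : In η}; the names T η
    -- are then reinterpreted over ℚ along the projection to ℙ.

    module Family (𝓢 f : MP.X) (θ : L) (θ∊κ : elem θ ∊ κ) (p₀ : Cond)
      (f-on : MP.Sat (FunctionOn f 𝓢) p₀)
      (f-range : ∀ {x y q} → q ≼ p₀ → MP.Map f x y q → MP.Mem y (MP.chk (elem θ)) q)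
      (f-inj : ∀ {x x′ y q} → q ≼ p₀ → MP.Map f x y q → MP.Map f x′ y q → MP.Eq x x′ q)
      (stationary : ∀ {T q} → q ≼ p₀ → MP.Mem T 𝓢 q → MP.Sat (StationarySubset (MP.chk Λ) (MP.chk S) T) q) where

      member-S : ∀ {T q ξ r} → q ≼ p₀ → MP.Mem T 𝓢 q → r ≼ q → MP.Mem (MP.ě ξ) T r → Sₗ ξ
      member-S {T} {q} {ξ} {r} q≼p₀ m r≼q n =
        ∊⇒S (MP.chk-mem⁻¹ S (lower (proj₁ (stationary q≼p₀ m) (MP.ě ξ) r r≼q (lift n))))

      -- Deciding an index η means excluding it below r, or fixing a name with that index together
      -- with an ordinal δ from Fodor's lemma. Once decided, these δ form a family of V, which
      -- regularity can bound.
      Absent Present : L → Cond → Set₁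
      Absent η r = ∀ T t → t ≼ r → MP.Mem T 𝓢 t → MP.Map f T (MP.ě η) t → ⊥
      Present η r = Σ[ T ∈ MP.X ] Σ[ δ ∈ L ] MP.Mem T 𝓢 r × MP.Map f T (MP.ě η) r ×
        PΛ.StatSem (λ ξ s → MP.Mem (MP.ě ξ) T s × GoodAt δ ξ s) r

      D : L → Cond → Set₁
      D η r = Absent η r ⊎ Present η r

      D-mono : ∀ η {r s} → s ≼ r → D η r → D η s
      D-mono η s≼r (inj₁ h) = inj₁ λ T t t≼s → h T t (≼-trans t≼s s≼r)
      D-mono η s≼r (inj₂ (T , δ , m , n , st)) =
        inj₂ (T , δ , MP.mem-mono s≼r m , MP.mem-mono s≼r n , PΛ.statSem-mono s≼r st)

      D-dense : ∀ η u → u ≼ p₀ → Σ[ r ∈ Cond ] r ≼ u × D η r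
      D-dense η u u≼p₀ with em {P = Σ[ t ∈ Cond ] t ≼ u × Σ[ T ∈ MP.X ] MP.Mem T 𝓢 t × MP.Map f T (MP.ě η) t}
      ... | no k = u , ≼-refl , inj₁ λ T t t≼u m n → k (t , t≼u , T , m , n)
      ... | yes (t , t≼u , T , m , n) =
        let t≼p₀ = ≼-trans t≼u u≼p₀
            (δ , r , r≼t , st) = Fodor.fodor (λ ξ → MP.Mem (MP.ě ξ) T) (λ ξ → MP.mem-mono) t
              (λ {ξ} → member-S t≼p₀ m)
              (PSΛ.stationary⇒ (proj₂ (stationary t≼p₀ m)))
        in r , ≼-trans r≼t t≼u , inj₂ (T , δ , MP.mem-mono r≼t m , MP.mem-mono r≼t n , st)

      abstract
        met : Σ[ r ∈ Cond ] r ≼ p₀ × (∀ η → η < θ → D η r)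
        met = Nice.distributive ℙ-nice p₀ θ D D-mono D-dense

      p₁ : Cond
      p₁ = proj₁ met

      p₁≼p₀ : p₁ ≼ p₀
      p₁≼p₀ = proj₁ (proj₂ met)

      In : L → Set
      In η = η < θ × Small (Present η p₁)

      T : L → MP.X
      T η with em {P = Present η p₁}
      ... | yes (T , _) = T
      ... | no _ = 𝓢

      δ-of : L → L
      δ-of η with em {P = Present η p₁}
      ... | yes (_ , δ , _) = δ
      ... | no _ = η

      T-spec : ∀ {η} → In η → MP.Mem (T η) 𝓢 p₁ × MP.Map f (T η) (MP.ě η) p₁ ×
               PΛ.StatSem (λ ξ s → MP.Mem (MP.ě ξ) (T η) s × GoodAt (δ-of η) ξ s) p₁
      T-spec {η} (_ , h) with em {P = Present η p₁}
      T-spec {η} (_ , h) | yes (_ , _ , k) = k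
      T-spec (_ , ()) | no _

      present : ∀ {η t T′} → η < θ → t ≼ p₁ → MP.Mem T′ 𝓢 t → MP.Map f T′ (MP.ě η) t → In η × MP.Eq T′ (T η) t
      present {η} {t} {T′} η<θ t≼p₁ m n with proj₂ (proj₂ met) η η<θ
      ... | inj₁ k = ⊥-elim (k T′ t t≼p₁ m n)
      ... | inj₂ k = let i = (η<θ , small k) in
        i , f-inj (≼-trans t≼p₁ p₁≼p₀) n (MP.mem-mono t≼p₁ (proj₁ (proj₂ (T-spec i))))

      T-distinct : ∀ {i j t} → t ≼ p₁ → In i → In j → MP.Eq (T i) (T j) t → i ≡ j
      T-distinct {i} {j} {t} t≼p₁ hi hj e = MP.ě-inj (MP.fun-single f-on (≼-trans t≼p₁ p₁≼p₀)
        (MP.map-cong e (MP.eq-refl) (MP.mem-mono t≼p₁ (proj₁ (proj₂ (T-spec hi)))))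
        (MP.mem-mono t≼p₁ (proj₁ (proj₂ (T-spec hj)))))

      T-S : ∀ {i ξ r} → In i → r ≼ p₁ → MP.Mem (MP.ě ξ) (T i) r → Sₗ ξ
      T-S {i} {ξ} {r} hi r≼p₁ = member-S p₁≼p₀ (proj₁ (T-spec hi)) r≼p₁

      T-⊆Λ : ∀ {i z r} → In i → r ≼ p₁ → MP.Mem z (T i) r → MP.Dense r (λ s → Σ[ ξ ∈ L ] MP.Eq z (MP.ě ξ) s)
      T-⊆Λ {i} {z} {r} hi r≼p₁ m =
        MP.dmap (MP.chk-elim′ S (lower (proj₁ (stationary p₁≼p₀ (proj₁ (T-spec hi))) z r r≼p₁ (lift m))))
          λ { {s} _ (u , u∊S , e) → let u∊Λ = proj₁ (S-elim u∊S) in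
            lab u∊Λ , MP.eq-trans e (MP.chk-eq u (elem (lab u∊Λ)) (lab-≋ u∊Λ)) }

      -- Raising δ only makes fewer points bad, so a common bound of the fewer than Λ ordinals
      -- `δ-of` η lets one forcing ℚ serve the whole family.
      δ* : L
      δ* = proj₁ (bounded θ δ-of)

      open Preservation δ*

      q₀ : QCond δ*
      q₀ = proj₁ (start p₁)

      q₀≼ : base q₀ ≼ p₁
      q₀≼ = proj₂ (start p₁)

      base≼p₁ : ∀ {q} → q ≼Q q₀ → base q ≼ p₁
      base≼p₁ h = ≼-trans (base≼ h) q₀≼

      InT : L → L → QCond δ* → Set
      InT i ξ q = MP.Mem (MP.ě ξ) (T i) (base q)

      InT-mono : ∀ i ξ {q r} → r ≼Q q → InT i ξ q → InT i ξ r
      InT-mono i ξ h = MP.mem-mono (base≼ h)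

      T′ : L → MQ.X
      T′ i = MQ.mk L MQ.ě (InT i)

      T′-intro : ∀ {i ξ q} → InT i ξ q → MQ.Mem (MQ.ě ξ) (T′ i) q
      T′-intro {i} {ξ} {q} h = MQ.mk-intro
        λ r r≼q → r , ≼Q-refl , ξ , InT-mono i ξ r≼q h , MQ.eq-refl

      T′-elim : ∀ {i z q} → MQ.Mem z (T′ i) q → MQ.Dense q (λ r → Σ[ ξ ∈ L ] InT i ξ r × MQ.Eq z (MQ.ě ξ) r)
      T′-elim {i} {z} {q} m = MQ.mk-elim (λ ξ → InT-mono i ξ) m

      T′-elimě : ∀ {i ξ q} → MQ.Mem (MQ.ě ξ) (T′ i) q → MQ.Dense q (InT i ξ)
      T′-elimě {i} {ξ} {q} m = MQ.dmap (T′-elim m) λ { {r} _ (η , h , e) →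
        subst (λ ζ → InT i ζ r) (sym (MQ.ě-inj {ξ} {η} e)) h }

      -- Every condition below base q lifts to ℚ, so membership in the reinterpreted sets can be
      -- read back over ℙ. With `T-distinct` this shows that `f′` is single-valued.
      T′-eq : ∀ {i j q} → q ≼Q q₀ → In i → In j → MQ.Eq (T′ i) (T′ j) q → MP.Eq (T i) (T j) (base q)
      T′-eq {i} {j} {q} q≼q₀ hi hj e = MP.extensionality
        (λ z → half hi (λ {ξ} r≼q → MQ.mem-cong (MQ.eq-refl) (MQ.eq-mono r≼q e)) z)
        (λ z → half hj (λ {ξ} r≼q → MQ.mem-cong (MQ.eq-refl) (MQ.eq-sym (MQ.eq-mono r≼q e))) z)
        where
        half : ∀ {i} → In i → ∀ {j} → (∀ {ξ r} → r ≼Q q → MQ.Mem (MQ.ě ξ) (T′ i) r → MQ.Mem (MQ.ě ξ) (T′ j) r) →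
               ∀ z {r} → r ≼ base q → MP.Mem z (T i) r → MP.Mem z (T j) r
        half {i} hi {j} into z {r} r≼q m = MP.mem-dense λ s s≼r →
          let (s₁ , s₁≼s , ξ , e) = T-⊆Λ hi (≼-trans r≼q (base≼p₁ q≼q₀)) m s s≼r
              s₁≼q = ≼-trans s₁≼s (≼-trans s≼r r≼q)
              m₁ = MP.mem-cong e (MP.eq-refl) (MP.mem-mono (≼-trans s₁≼s s≼r) m)
              (q′ , q′≼q , q′≼s₁) = lift≼ q s₁ s₁≼q
              (q″ , q″≼q′ , n) = MQ.now (T′-elimě {j} {ξ} (into {ξ} q′≼q (T′-intro {i} {ξ} (MP.mem-mono q′≼s₁ m₁))))
              q″≼s₁ = ≼-trans (base≼ q″≼q′) q′≼s₁
          in base q″ , ≼-trans q″≼s₁ s₁≼s ,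
             MP.mem-cong (MP.eq-sym (MP.eq-mono q″≼s₁ e)) (MP.eq-refl) n

      𝓢′ f′ : MQ.X
      𝓢′ = MQ.mk L T′ (λ i _ → In i)
      f′ = MQ.graph L T′ MQ.ě (λ i _ → In i)

      𝓢′-elim : ∀ {z q} → MQ.Mem z 𝓢′ q → MQ.Dense q (λ r → Σ[ i ∈ L ] In i × MQ.Eq z (T′ i) r)
      𝓢′-elim {z} {q} = MQ.mk-elim {L} {T′} {λ i _ → In i} {z} {q} (λ _ _ h → h)

      𝓢′-intro : ∀ {i q} → In i → MQ.Mem (T′ i) 𝓢′ q
      𝓢′-intro {i} {q} h = MQ.mk-intro {L} {T′} {λ i _ → In i} {T′ i} {q} λ r _ → r , ≼Q-refl , i , h , MQ.eq-refl {T′ i}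

      T′-stationary : ∀ {i q} → q ≼Q q₀ → In i → MQ.Sat (StationarySubset (MQ.chk Λ) (MQ.chk S) (T′ i)) q
      T′-stationary {i} {q} q≼q₀ hi =
        (λ z r r≼q (lift m) → lift (MQ.mem-by {p = r} {x = z} {y = MQ.chk S} (T′-elim {i} {z} {r} m) λ { {s} s≼r (ξ , h , e) →
           MQ.mem-cong {MQ.ě ξ} {z} {MQ.chk S} {MQ.chk S} {s} (MQ.eq-sym {z} {MQ.ě ξ} e) (MQ.eq-refl {MQ.chk S})
             (MQ.chk-mem S (S⇒∊ (T-S {i} {ξ} {base s} hi (base≼p₁ (≼Q-trans s≼r (≼Q-trans r≼q q≼q₀))) h))) })) ,
        MQ.StatAt.⇒stationary Λ Λ-ord (λ y h → h) {T′ i} {q} λ N N-mono r≼q club → MQ.dmap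
          (preservation (λ ξ → MP.Mem (MP.ě ξ) (T i)) (λ ξ → MP.mem-mono {MP.ě ξ} {T i}) q₀
            (λ {ξ} {r} r≼q₀ → T-S {i} {ξ} {r} hi (≼-trans r≼q₀ q₀≼)) stat N N-mono (≼Q-trans r≼q q≼q₀) club)
          λ { {s} _ (ξ , ξ∊Λ , n , m) → ξ , ξ∊Λ , n , T′-intro {i} {ξ} {s} m }
        where
        stat : PΛ.StatSem (λ ξ r → MP.Mem (MP.ě ξ) (T i) r × GoodAt δ* ξ r) (base q₀)
        stat N N-mono r≼q₀ club = MP.dmap (proj₂ (proj₂ (T-spec hi)) N N-mono (≼-trans r≼q₀ q₀≼) club)
          λ { _ (ξ , ξ∊Λ , n , m , l , av) → ξ , ξ∊Λ , n , m , l , λ s le →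
            av s (≤-trans (inj₁ (proj₂ (bounded θ δ-of) i (proj₁ hi))) le) }

      family-stationary : MQ.Sat (all∈ 𝓢′ λ T → StationarySubset (MQ.chk Λ) (MQ.chk S) T) q₀
      family-stationary x q q≼q₀ (lift m) = MQ.sat-by (StationarySubset (MQ.chk Λ) (MQ.chk S) x) (𝓢′-elim {x} {q} m)
        λ { {r} r≼q (i , hi , e) → MQ.stationarySubset-cong {MQ.chk Λ} {MQ.chk S} {T′ i} {x} {r}
          (MQ.eq-sym {x} {T′ i} e) (T′-stationary (≼Q-trans r≼q q≼q₀) hi) }

      f′-elim : ∀ {x y q} → MQ.Map f′ x y q → MQ.Dense q (λ r → Σ[ i ∈ L ] In i × MQ.Eq x (T′ i) r × MQ.Eq y (MQ.ě i) r)
      f′-elim {x} {y} {q} = MQ.graph-elim {L} {T′} {MQ.ě} {λ i _ → In i} (λ _ _ h → h) {x} {y} {q}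

      family-small : MQ.Sat (FewerThan 𝓢′ (MQ.chk κ)) q₀
      family-small q q≼q₀ = q , ≼Q-refl , MQ.chk (elem θ) , lift (MQ.chk-mem κ θ∊κ) , λ r r≼q → r , ≼Q-refl , f′ ,
        (MQ.graph-functionOn {L} {T′} {MQ.ě} {λ i _ → In i} (λ _ _ h → h) {r} {𝓢′}
           (λ {z} {s} _ m → 𝓢′-elim {z} {s} m)
           (λ {i} {s} _ hi → 𝓢′-intro {i} {s} hi)
           (λ {i} {j} {s} s≼r hi hj e →
             subst (λ k → MQ.Eq (MQ.ě i) (MQ.ě k) s) (distinct (≼Q-trans s≼r (≼Q-trans r≼q q≼q₀)) hi hj e) (MQ.eq-refl {MQ.ě i})) ,
         λ x y s _ m → lift (MQ.mem-by {p = s} {x = y} {y = MQ.chk (elem θ)} (f′-elim {x} {y} {s} (MQ.maps⇒ {x} {y} {s} {f′} m))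
           λ { {t} _ (i , (i<θ , _) , _ , e) → MQ.mem-cong {MQ.ě i} {y} {MQ.chk (elem θ)} {MQ.chk (elem θ)} {t}
             (MQ.eq-sym {y} {MQ.ě i} e) (MQ.eq-refl {MQ.chk (elem θ)}) (MQ.chk-mem (elem θ) (<⇒∊ i<θ)) })) ,
        λ x x′ y s _ m t t≼s m′ → lift (MQ.eq-dense {x} {x′} {t} (MQ.bind
          (f′-elim {x} {y} {t} (MQ.mem-mono {MQ.opair x y} {f′} t≼s (MQ.maps⇒ {x} {y} {s} {f′} m)))
          λ { {u} u≼t (i , _ , e₁ , e₂) → MQ.dmap (f′-elim {x′} {y} {u} (MQ.mem-mono {MQ.opair x′ y} {f′} u≼t (MQ.maps⇒ {x′} {y} {t} {f′} m′)))
            λ { {v} v≼u (j , _ , e₃ , e₄) →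
              let i≡j = MQ.ě-inj {i} {j} {v} (MQ.eq-trans {MQ.ě i} {y} {MQ.ě j} (MQ.eq-sym {y} {MQ.ě i} (MQ.eq-mono {y} {MQ.ě i} v≼u e₂)) e₄) in
              MQ.eq-trans {x} {T′ i} {x′} (MQ.eq-mono {x} {T′ i} v≼u e₁)
                (subst (λ k → MQ.Eq (T′ k) x′ v) (sym i≡j) (MQ.eq-sym {x′} {T′ j} e₃)) } }))
        where
        distinct : ∀ {i j s} → s ≼Q q₀ → In i → In j → MQ.Eq (T′ i) (T′ j) s → i ≡ j
        distinct s≼q₀ hi hj e = T-distinct (base≼p₁ s≼q₀) hi hj (T′-eq s≼q₀ hi hj e)

      ℚ-preserves : MQ.Preserves
      ℚ-preserves = nice⇒preserves (FM ℚ) ℚ-nice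

      Reflected : L → QCond δ* → Set₁
      Reflected g q = ∀ {i} → In i → MQ.Sat (Reflects (T′ i) (MQ.ě g)) q

      -- The only appeal to `Refl*`, made for ℚ and the reinterpreted family.
      reflected : Σ[ q ∈ QCond δ* ] q ≼Q q₀ × Σ[ g ∈ L ] Reflected g q
      reflected =
        let all-refl = forces⇒sat ℚ (Refl (MQ.chk Λ) (MQ.chk κ) (MQ.chk S)) (reflection ℚ ℚ-closed ℚ-size q₀)
            (q₁ , q₁≼q₀ , γ , lift m , h) = MQ.now (all-refl 𝓢′ q₀ ≼Q-refl family-stationary q₀ ≼Q-refl family-small)
            (q₂ , q₂≼q₁ , g , e) = MQ.now (MQ.elimΛ {γ} {q₁} m)
        in q₂ , ≼Q-trans q₂≼q₁ q₁≼q₀ , g , λ {i} hi →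
             MQ.reflects-cong {T′ i} {T′ i} {γ} {MQ.ě g} {q₂} (MQ.eq-refl {T′ i}) e
               (h (T′ i) q₂ q₂≼q₁ (lift (𝓢′-intro {i} {q₂} hi)))

      module _ (g : L) where
        private
          module PG = MP.AtL g
          module QG = MQ.AtL g

        -- Density passes up the projection for the two conclusions, by lifting the conditions
        -- found, and down for the hypothesis of `closed`, by taking bases of conditions found below
        -- lifts.
        lift-club : ∀ {N : L → Cond → Set} → (∀ ξ {a b} → b ≼ a → N ξ a → N ξ b) → ∀ {q} →
                    PG.ClubSem N (base q) → QG.ClubSem (λ ξ s → N ξ (base s)) q
        lift-club {N} N-mono club = record
          { unbounded = λ β β∊g s s≼q →
              let (r , r≼s , η , η∊g , le , n) = PG.unbounded club β β∊g (base s) (base≼ s≼q)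
                  (s′ , s′≼s , s′≼r) = lift≼ s r r≼s
              in s′ , s′≼s , η , η∊g , le , N-mono η s′≼r n
          ; closed = λ α α∊g lim {s} s≼q hyp t t≼s →
              let (r , r≼t , n) = PG.closed club α α∊g lim (base≼ s≼q) (λ β β<α r r≼s →
                    let (s₁ , s₁≼s , s₁≼r) = lift≼ s r r≼s
                        (s₂ , s₂≼s₁ , η , η<α , le , n) = hyp β β<α s₁ s₁≼s
                    in base s₂ , ≼-trans (base≼ s₂≼s₁) s₁≼r , η , η<α , le , n) (base t) (base≼ t≼s)
                  (t′ , t′≼t , t′≼r) = lift≼ t r r≼t
              in t′ , t′≼t , N-mono α t′≼r n }

        stationary-down : ∀ {i q} → MQ.Sat (Stationary (T′ i) (MQ.ě g)) q → MP.Sat (Stationary (T i) (MP.ě g)) (base q)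
        stationary-down {i} {q} h = MP.StatAt.⇒stationary (elem g) (elem-ord g) (λ y → ∊elem⇒∊Λ g {y}) {T i} {base q} stat
          where
          statQ : QG.StatSem (λ ξ → MQ.Mem (MQ.ě ξ) (T′ i)) q
          statQ = MQ.StatAt.stationary⇒ (elem g) (elem-ord g) (λ y → ∊elem⇒∊Λ g {y}) {T′ i} {q} h
          stat : PG.StatSem (λ ξ → MP.Mem (MP.ě ξ) (T i)) (base q)
          stat N N-mono {r} r≼q club s s≼r =
            let (q₁ , q₁≼q , q₁≼s) = lift≼ q s (≼-trans s≼r r≼q)
                (q₂ , q₂≼q₁ , ξ , ξ∊g , n , m) = MQ.now (statQ (λ ξ w → N ξ (base w)) (λ ξ w≼ → N-mono ξ (base≼ w≼)) q₁≼q
                  (lift-club N-mono (PG.clubSem-mono (≼-trans q₁≼s s≼r) club)))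
                (q₃ , q₃≼q₂ , m′) = MQ.now (T′-elimě {i} {ξ} {q₂} m)
            in base q₃ , ≼-trans (base≼ (≼Q-trans q₃≼q₂ q₂≼q₁)) q₁≼s , ξ , ξ∊g , N-mono ξ (base≼ q₃≼q₂) n , m′

      reflects-down : ∀ {g q i T₀ u} → Reflected g q → u ≼ base q → In i → MP.Eq T₀ (T i) u →
                      MP.Sat (Reflects T₀ (MP.ě g)) u
      reflects-down {g} {q} {i} {T₀} {u} h u≼q hi e = MP.reflects-cong {T i} {T₀} {MP.ě g} {MP.ě g} {u}
        (MP.eq-sym {T₀} {T i} e) (MP.eq-refl {MP.ě g})
        (MP.sat-mono (Reflects (T i) (MP.ě g)) u≼q (uncountable , stationary-down g {i} {q} (proj₂ (h hi))))
        where
        -- Both forcings preserve cofinalities, so uncountable cofinality is carried from V^ℚ to V^ℙ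
        -- by way of V.
        uncountable : MP.Sat (UncountableCofinality (MP.ě g)) (base q)
        uncountable =
          let (μ , cof , ω∊μ) = MQ.uncountable-chk⁻¹ ℚ-preserves {ω = ω} ω-omega {γ = elem g} (elem-ord g) (proj₁ (h hi))
          in MP.uncountable-chk ℙ-preserves {ω = ω} ω-omega {γ = elem g} {μ} (elem-ord g) cof ω∊μ

      -- The map f gives T₀ some index below θ, and p₁ has decided which member of 𝓢, if any, has
      -- that index.
      value : ∀ {T₀ t} → t ≼ p₁ → MP.Mem T₀ 𝓢 t → MP.Dense t (λ u → Σ[ i ∈ L ] In i × MP.Eq T₀ (T i) u)
      value {T₀} {t} t≼p₁ m = MP.bind (MP.fun-total {f = f} {A = 𝓢} f-on (≼-trans t≼p₁ p₁≼p₀) m) λ { {u} u≼t (y , n) →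
        MP.dmap (MP.chk-elim′ {z = y} {p = u} (elem θ) (f-range (≼-trans u≼t (≼-trans t≼p₁ p₁≼p₀)) n)) λ { {v} v≼u (w , w∊θ , e) →
          let i = lab (∊elem⇒∊Λ θ w∊θ)
              y≐i = MP.eq-trans {y} {MP.chk w} {MP.ě i} e (MP.chk-eq w (elem i) (lab-≋ (∊elem⇒∊Λ θ w∊θ)))
          in i , present (lab< θ w∊θ) (≼-trans (≼-trans v≼u u≼t) t≼p₁) (MP.mem-mono {T₀} {𝓢} (≼-trans v≼u u≼t) m)
               (MP.map-cong {T₀} {T₀} {v} {y} {MP.ě i} {f} (MP.eq-refl {T₀}) y≐i (MP.mem-mono {MP.opair T₀ y} {f} v≼u n)) } }

      conclusion : Σ[ r ∈ Cond ] r ≼ p₀ × Σ[ g ∈ L ] MP.Sat (all∈ 𝓢 λ T → Reflects T (MP.ě g)) r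
      conclusion =
        let (q , q≼q₀ , g , h) = reflected in
        base q , ≼-trans (base≼p₁ q≼q₀) p₁≼p₀ , g , λ T₀ t t≼q (lift m) →
          MP.sat-by (Reflects T₀ (MP.ě g)) (value (≼-trans t≼q (base≼p₁ q≼q₀)) m) λ { u≼t (i , hi , e) →
            reflects-down {g} {q} {i} h (≼-trans u≼t t≼q) hi e }

    family-reflects : ∀ 𝓢 α f w s → w ∊ κ → MP.Eq α (MP.chk w) s → MP.Sat (Function f 𝓢 α) s → MP.Sat (Injective f) s →
      MP.Sat (all∈ 𝓢 λ T → StationarySubset (MP.chk Λ) (MP.chk S) T) s →
      Σ[ t ∈ Cond ] t ≼ s × Σ[ g ∈ L ] MP.Sat (all∈ 𝓢 λ T → Reflects T (MP.ě g)) t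
    family-reflects 𝓢 α f w s w∊κ e f-fun f-inj stationary =
      Family.conclusion 𝓢 f θ (∊-congˡ κ (lab-≋ w∊Λ) w∊κ) s (proj₁ f-fun) range inj
        (λ {T} {u} u≼s n → stationary T u u≼s (lift n))
      where
      w∊Λ : w ∊ Λ
      w∊Λ = ∊κ⇒∊Λ w∊κ
      θ : L
      θ = lab w∊Λ
      α≐θ : MP.Eq α (MP.ě θ) s
      α≐θ = MP.eq-trans {α} {MP.chk w} {MP.ě θ} {s} e (MP.chk-eq w (elem θ) (lab-≋ w∊Λ))
      range : ∀ {x y q} → q ≼ s → MP.Map f x y q → MP.Mem y (MP.chk (elem θ)) q
      range {x} {y} {u} u≼s n = MP.mem-cong {y} {y} {α} {MP.ě θ} {u} (MP.eq-refl {y}) (MP.eq-mono {α} {MP.ě θ} u≼s α≐θ)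
        (lower (proj₂ f-fun x y u u≼s (MP.⇒maps {x} {y} {u} {f} n)))
      inj : ∀ {x x′ y q} → q ≼ s → MP.Map f x y q → MP.Map f x′ y q → MP.Eq x x′ q
      inj {x} {x′} {y} {u} u≼s n n′ = lower (f-inj x x′ y u u≼s (MP.⇒maps {x} {y} {u} {f} n) u ≼-refl (MP.⇒maps {x′} {y} {u} {f} n′))

    ℙ-reflection : ∀ {p} → MP.Sat (Refl (MP.chk Λ) (MP.chk κ) (MP.chk S)) p
    ℙ-reflection 𝓢 q _ stationary r r≼q few = MP.bind {D = Bounded} {E = Goal} few λ { {s₁} s₁≼r (α , lift m , d) →
      MP.bind {E = Goal} (MP.chk-elim′ {z = α} {p = s₁} κ m) λ { {s₂} s₂≼s₁ (w , w∊κ , e) →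
        MP.bind {D = Injected α} {E = Goal} (MP.dense-mono {D = Injected α} s₂≼s₁ d) λ { {s₃} s₃≼s₂ (f , f-fun , f-inj) →
          last α f w s₃ w∊κ (MP.eq-mono {α} {MP.chk w} s₃≼s₂ e) f-fun f-inj
            (≼-trans s₃≼s₂ (≼-trans s₂≼s₁ (≼-trans s₁≼r r≼q))) } } }
      where
      Goal Bounded : Cond → Set₁
      Goal u = Σ[ γ ∈ MP.X ] MP.Sat (γ ∈ MP.chk Λ ∧ (all∈ 𝓢 λ T → Reflects T γ)) u
      Bounded u = Σ[ α ∈ MP.X ] MP.Sat (α ∈ MP.chk κ ∧ (ex λ f → Function f 𝓢 α ∧ Injective f)) u
      Injected : MP.X → Cond → Set₁
      Injected α u = Σ[ f ∈ MP.X ] MP.Sat (Function f 𝓢 α ∧ Injective f) u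
      last : ∀ α f w s → w ∊ κ → MP.Eq α (MP.chk w) s → MP.Sat (Function f 𝓢 α) s → MP.Sat (Injective f) s →
             s ≼ q → MP.Dense s Goal
      last α f w s w∊κ e f-fun f-inj s≼q u u≼s =
        let (t , t≼u , g , h) = family-reflects 𝓢 α f w u w∊κ (MP.eq-mono {α} {MP.chk w} u≼s e)
              (MP.sat-mono (Function f 𝓢 α) u≼s f-fun) (MP.sat-mono (Injective f) u≼s f-inj)
              (MP.sat-mono (all∈ 𝓢 λ T → StationarySubset (MP.chk Λ) (MP.chk S) T) (≼-trans u≼s s≼q) stationary)
        in t , t≼u , MP.ě g , lift (MP.chk-mem Λ (elem∊ g)) , h

  -- From the formal hypotheses to the ground-model data

  module _ (Λ κ S : V) where
    theorem :
      V⊨ Regular Λ →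
      V⊨ WeakPowerFixed Λ →
      V⊨ (ex λ ℵ₂ → IsAleph2 ℵ₂ ∧ ℵ₂ ≤ₒ Λ) →
      V⊨ Cardinal κ →
      V⊨ (ex λ one → IsOne one ∧ one ∈ κ) →
      V⊨ (κ ≤ₒ Λ) →
      V⊨ IsSω Λ S →
      Refl* Λ κ S →
      Σ[ ℙ ∈ Forcing ]
        CofinalityPreserving ℙ ×
        (ℙ ⊩ (ex λ s → IsSω (check ℙ Λ) s ∧
                        Refl (check ℙ Λ) (check ℙ κ) s ∧
                        ¬ uDSR₁ (check ℙ Λ) s))
    theorem regular weakPower (ℵ₂ , (ω , b , ω-is , (_ , lift ω∊b , _) , (ℵ₂-card , lift b∊ℵ₂ , _)) , ℵ₂≤Λ) _ _ κ≤Λ S-is reflection =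
      ℙ , cofinality ,
      λ p q _ → q , ≼-refl , check ℙ S , sat⇒forces ℙ (IsSω (check ℙ Λ) (check ℙ S) ∧ Refl (check ℙ Λ) (check ℙ κ) (check ℙ S) ∧ ¬ uDSR₁ (check ℙ Λ) (check ℙ S))
        (MP.isSω-chk ℙ-preserves {ω = ω} ω-omega {Λ = Λ} {S = S} S-elim S-intro , Reflection.ℙ-reflection 𝓖 κ (le κ≤Λ) reflection , ¬uDSR)
      where
      le : ∀ {x y} → V⊨ (x ≤ₒ y) → x ≤V y
      le (inj₁ (lift h)) = inj₁ h
      le (inj₂ (lift h)) = inj₂ h

      Λ-ord : OrdV Λ
      Λ-ord = ordinal⇒ordV (proj₁ (proj₁ regular))

      ω-omega : OmegaV ω
      ω-omega = VT.omega-chk⁻¹ ω (V⊨⇒sat (IsOmega ω) ω-is)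

      ω∊ℵ₂ : ω ∊ ℵ₂
      ω∊ℵ₂ = proj₁ (ordinal⇒ordV {ℵ₂} (proj₁ ℵ₂-card)) b ω b∊ℵ₂ ω∊b

      ω∊Λ : ω ∊ Λ
      ω∊Λ = [ (λ h → proj₁ Λ-ord ℵ₂ ω h ω∊ℵ₂) , (λ e → ∊-congʳ ℵ₂ Λ e ω∊ℵ₂) ]′ (le ℵ₂≤Λ)

      S-elim : ∀ {x} → x ∊ S → x ∊ Λ × LimV x × CofV x ω
      S-elim {x} h =
        let (lift x∊Λ , l , w , w-is , c) = proj₁ (S-is x) (lift h)
            x-lim = VT.limit-chk⁻¹ x (V⊨⇒sat (Limit x) l)
            w≋ω = VT.omega-unique (V⊨⇒sat (IsOmega w) w-is) (V⊨⇒sat (IsOmega ω) ω-is)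
        in x∊Λ , x-lim , cofV-cong {x} {w} {ω} w≋ω (isCofinality⇒cofV {x} {w} (proj₁ x-lim) c)

      S-intro : ∀ {x} → x ∊ Λ → LimV x → CofV x ω → x ∊ S
      S-intro {x} x∊Λ l c = lower (proj₂ (S-is x)
        (lift x∊Λ , sat⇒V⊨ (Limit x) (VT.limit-chk x l) , ω , ω-is , cofV⇒isCofinality {x} {ω} (proj₁ l) c))

      𝓖 : Ground
      𝓖 = record
        { Λ = Λ ; ω = ω ; S = S ; Λ-ord = Λ-ord
        ; Λ-regular = proj₂ (proj₂ (isCofinality⇒cofV {Λ} {Λ} Λ-ord (proj₂ (proj₂ regular))))
        ; ω-omega = ω-omega ; ω∊Λ = ω∊Λ ; weakPower = weakPower
        ; S-elim = S-elim ; S-intro = S-intro }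

      open Stationarity 𝓖 using (ℙ; ℙ-preserves; ¬uDSR; module MP; ≼-refl)

      cofinality : CofinalityPreserving ℙ
      cofinality δ μ δ-ord c p = let o = ordinal⇒ordV {δ} δ-ord in
        sat⇒forces ℙ (IsCofinality (check ℙ δ) (check ℙ μ))
          (MP.isCofinality-chk ℙ-preserves {δ = δ} {μ} o (isCofinality⇒cofV {δ} {μ} o c))

theorem3p10 :
  (∀ {ℓ} → ExcludedMiddle ℓ) →
  (∀ {a b} → Extensionality a b) →
  (Λ κ S : V) →
  V⊨ Regular Λ →
  V⊨ WeakPowerFixed Λ →
  V⊨ (ex λ ℵ₂ → IsAleph2 ℵ₂ ∧ ℵ₂ ≤ₒ Λ) →
  V⊨ Cardinal κ →
  V⊨ (ex λ one → IsOne one ∧ one ∈ κ) →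
  V⊨ (κ ≤ₒ Λ) →
  V⊨ IsSω Λ S →
  Refl* Λ κ S →
  Σ[ ℙ ∈ Forcing ]
    CofinalityPreserving ℙ ×
    (ℙ ⊩ (ex λ s → IsSω (check ℙ Λ) s ∧
                    Refl (check ℙ Λ) (check ℙ κ) s ∧
                    ¬ uDSR₁ (check ℙ Λ) s))
theorem3p10 em fe = Classical.theorem em fe
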